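{- Let $G$ be a finite subgroup of the additive group $\mathbb{K}^+$ of a field $\mathbb{K}$, and let $\mathcal{C}^G_+$ be the smallest class of loopless gain graphs with gain group $G$ satisfying: (i) the null graph belongs to $\mathcal{C}^G_+$; (ii) if $\Gamma$ has a link-simplicial vertex $v$ and $\Gamma\setminus v\in\mathcal{C}^G_+$, then $\Gamma\in\mathcal{C}^G_+$; (iii) if $V_\Gamma=V_1\cup V_2$ with $\Gamma[V_1],\Gamma[V_2]\in\mathcal{C}^G_+$, $E_\Gamma=E_{\Gamma[V_1]}\cup E_{\Gamma[V_2]}$, and $\Gamma[V_1\cap V_2]\simeq K_n^G$ for some $n$, then $\Gamma\in\mathcal{C}^G_+$. Then for every $\Gamma\in\mathcal{C}^G_+$ the arrangement $\mathcal{A}_+(\Gamma)$ is divisionally free.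
   Context: A loopless gain graph $\Gamma=(V_\Gamma,E_\Gamma,G_\Gamma)$ consists of a finite vertex set, a group $G_\Gamma$ (here written additively), and a finite set $E_\Gamma$ of edges $\{u,v\}_g$ (classes of triples $(u,v,g)$, $u\ne v$, $g\in G_\Gamma$, with $(u,v,g)\sim(v,u,-g)$). $\Gamma[W]$ is the induced subgraph on $W$ and $\Gamma\setminus v=\Gamma[V_\Gamma\setminus\{v\}]$. $K_n^G$ is the loopless gain graph on $[n]$ with all edges $\{i,j\}_g$ ($i\ne j$, $g\in G$); thus $\Gamma[V_1\cap V_2]\simeq K_n^G$ means all edges $\{u,v\}_g$ with $u\ne v$ in $V_1\cap V_2$ and $g\in G$ are present. A vertex $v$ is link simplicial if whenever $\{u,v\}_g,\{v,w\}_h\in E_\Gamma$ with $u\ne w$, then $\{u,w\}_{g+h}\in E_\Gamma$. For $\Gamma$ with vertex set $[N]$ (after labeling) and gain group $G\le\mathbb{K}^+$, $\mathcal{A}_+(\Gamma)$ is the arrangement in $\mathbb{K}^{N+1}$ with coordinates $z,x_1,\dots,x_N$ consisting of $\{z=0\}$ and the hyperplanes $\{x_i-x_j=gz\}$ for $\{i,j\}_g\in E_\Gamma$. For a simple matroid $M$ on $E$ with rank function $r$ and lattice of flats $L(M)$, $\chi(M,t)=\sum_{X\in L(M)}\mu(X)t^{r(E)-r(X)}$ ($\mu$ the Möbius function from the bottom), computed for contractions from their lattice of flats. A divisional flag of $M$ of rank $n$ is a chain of flats $\varnothing=X_0\subseteq\dots\subseteq X_n=E$ with $r(X_i)=i$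 and $\chi(M/X_{i+1},t)\mid\chi(M/X_i,t)$. The linear dependence matroid $M(\mathcal{A})$ of a central arrangement $\mathcal{A}$ is the matroid on $\mathcal{A}$ where $\{H_1,\dots,H_k\}$ is independent iff $\operatorname{codim}(H_1\cap\dots\cap H_k)=k$; $\mathcal{A}$ is divisionally free if $M(\mathcal{A})$ has a divisional flag. -}

module Defs where

open import Level using (Level; _⊔_)
open import Algebra.Bundles using (CommutativeRing)
open import Data.Bool using (Bool; true; false; _∧_; _∨_; not; if_then_else_)
open import Data.Nat as ℕ using (ℕ; zero; suc; _∸_; _<ᵇ_; _≡ᵇ_; _≤_; _<_)
open import Data.Fin as Fin using (Fin; toℕ)
open import Data.Fin.Subset as Sub using (Subset; inside; outside; ∁; _∪_; ⁅_⁆)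
open import Data.Vec as Vec using (Vec; []; _∷_)
open import Data.List as List using (List; []; _∷_; [_]; map; _++_; filterᵇ; concatMap; allFin; length; foldr; upTo)
open import Data.Integer as ℤ using (ℤ; 0ℤ; 1ℤ)
open import Data.Product using (Σ; _×_; _,_)
open import Relation.Nullary using (¬_; Dec; does)
open import Relation.Binary.PropositionalEquality using (_≡_; _≢_)

record IsField {c ℓ} (K : CommutativeRing c ℓ) : Set (c ⊔ ℓ) where
  open CommutativeRing K
  field
    0≉1 : ¬ (0# ≈ 1#)
    inverse : ∀ x → ¬ (x ≈ 0#) → Σ Carrier λ y → x * y ≈ 1#

record FinSubgroup {c ℓ} (K : CommutativeRing c ℓ) (k : ℕ) : Set (c ⊔ ℓ) where
  open CommutativeRing K
  field
    gs       : Fin k → Carrier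
    distinct : ∀ a b → gs a ≈ gs b → a ≡ b
    hasZero  : Σ (Fin k) λ a → gs a ≈ 0#
    closed+  : ∀ a b → Σ (Fin k) λ d → gs d ≈ gs a + gs b
    closed-  : ∀ a → Σ (Fin k) λ b → gs b ≈ - gs a

-- Loopless gain graphs with gain group G (gains indexed by Fin k via gs),
-- with vertex set V a subset of an ambient finite set Fin N.
-- E u v a = true means the triple (u , v , gs a) represents an edge
-- {u,v}_{gs a}.

record GainGraph (N k : ℕ) : Set where
  constructor mkGG
  field
    V : Subset N
    E : Fin N → Fin N → Fin k → Bool
open GainGraph public

mem : ∀ {n} → Fin n → Subset n → Bool
mem i W = Vec.lookup W i

module GainGraphs {c ℓ} (K : CommutativeRing c ℓ) {k : ℕ} (G : FinSubgroup K k) where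
  open CommutativeRing K
  open FinSubgroup G

  -- well-formedness: edges join distinct vertices of V, and
  -- (u,v,g) ~ (v,u,-g) denote the same edge
  record WF {N} (Γ : GainGraph N k) : Set (c ⊔ ℓ) where
    field
      endpoints : ∀ u v a → E Γ u v a ≡ true →
                  (mem u (V Γ) ≡ true) × (mem v (V Γ) ≡ true) × (u ≢ v)
      symmetric : ∀ u v a b → gs b ≈ - gs a → E Γ u v a ≡ E Γ v u b

  induced : ∀ {N} → GainGraph N k → Subset N → GainGraph N k
  induced Γ W = mkGG W (λ u v a → mem u W ∧ mem v W ∧ E Γ u v a)

  delete : ∀ {N} → GainGraph N k → Fin N → GainGraph N k
  delete Γ v = induced Γ (V Γ Sub.─ ⁅ v ⁆)

  LinkSimplicial : ∀ {N} → GainGraph N k → Fin N → Set ℓ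
  LinkSimplicial Γ v = ∀ u w a b d → E Γ u v a ≡ true → E Γ v w b ≡ true →
                       u ≢ w → gs d ≈ gs a + gs b → E Γ u w d ≡ true

  data InC {N} : GainGraph N k → Set (c ⊔ ℓ) where
    null   : ∀ Γ → WF Γ → V Γ ≡ Sub.⊥ → (∀ u v a → E Γ u v a ≡ false) → InC Γ
    simpl  : ∀ Γ v → WF Γ → mem v (V Γ) ≡ true → LinkSimplicial Γ v →
             InC (delete Γ v) → InC Γ
    glue   : ∀ Γ V₁ V₂ → WF Γ → V Γ ≡ V₁ ∪ V₂ →
             InC (induced Γ V₁) → InC (induced Γ V₂) →
             (∀ u v a → E Γ u v a ≡ (E (induced Γ V₁) u v a ∨ E (induced Γ V₂) u v a)) →
             -- Γ[V₁ ∩ V₂] ≃ K_n^G : all edges {u,v}_g present on V₁ ∩ V₂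
             (∀ u v → mem u V₁ ∧ mem u V₂ ≡ true → mem v V₁ ∧ mem v V₂ ≡ true →
                u ≢ v → ∀ a → E Γ u v a ≡ true) →
             InC Γ

  -- The arrangement A_+(Γ) in K^{N+1}, coordinates z = index zero,
  -- x_i = index suc i.  Hyperplanes are given by defining linear forms
  -- (coefficient vectors).

  δ : ∀ {N} → Fin N → Fin N → Carrier
  δ l i = if does (l Fin.≟ i) then 1# else 0#

  formZ : ∀ {N} → Fin (suc N) → Carrier
  formZ Fin.zero    = 1#
  formZ (Fin.suc _) = 0#

  formE : ∀ {N} → Fin N → Fin N → Fin k → Fin (suc N) → Carrier
  formE i j a Fin.zero    = - gs a
  formE i j a (Fin.suc l) = δ l i - δ l j

  -- one representative (i , j , a) with i < j per edge class
  edgeList : ∀ {N} → GainGraph N k → List (Fin N × Fin N × Fin k)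
  edgeList {N} Γ =
    concatMap (λ i → concatMap (λ j → concatMap (λ a →
      if (toℕ i <ᵇ toℕ j) ∧ E Γ i j a then [ (i , j , a) ] else [])
      (allFin k)) (allFin N)) (allFin N)

  arrForms : ∀ {N} → GainGraph N k → List (Fin (suc N) → Carrier)
  arrForms Γ = formZ ∷ map (λ { (i , j , a) → formE i j a }) (edgeList Γ)

-- Linear dependence matroid of a finite family of hyperplanes given by
-- defining forms f : Fin m → (Fin d → K): S is independent iff the forms
-- in S are linearly independent (⇔ codim of the intersection is |S|).

sumK : ∀ {c ℓ} (K : CommutativeRing c ℓ) {m} → (Fin m → CommutativeRing.Carrier K) → CommutativeRing.Carrier K
sumK K {zero}  f = CommutativeRing.0# K
sumK K {suc m} f = CommutativeRing._+_ K (f Fin.zero) (sumK K (λ i → f (Fin.suc i)))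

LinIndep : ∀ {c ℓ} (K : CommutativeRing c ℓ) {m d} →
           (Fin m → Fin d → CommutativeRing.Carrier K) → Subset m → Set (c ⊔ ℓ)
LinIndep K {m} {d} f S =
  ∀ (coef : Fin m → Carrier) →
    (∀ j → sumK K (λ i → if mem i S then coef i * f i j else 0#) ≈ 0#) →
    ∀ i → mem i S ≡ true → coef i ≈ 0#
  where open CommutativeRing K

allSubsets : ∀ m → List (Subset m)
allSubsets zero    = [ [] ]
allSubsets (suc m) = map (outside ∷_) (allSubsets m) ++ map (inside ∷_) (allSubsets m)

_⊆ᵇ_ : ∀ {m} → Subset m → Subset m → Bool
[]       ⊆ᵇ []       = true
(x ∷ xs) ⊆ᵇ (y ∷ ys) = (not x ∨ y) ∧ (xs ⊆ᵇ ys)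

_=ᵇ_ : ∀ {m} → Subset m → Subset m → Bool
X =ᵇ Y = (X ⊆ᵇ Y) ∧ (Y ⊆ᵇ X)

allᵇ : ∀ {A : Set} → (A → Bool) → List A → Bool
allᵇ p = foldr (λ x b → p x ∧ b) true

maxL : List ℕ → ℕ
maxL = foldr ℕ._⊔_ 0

sumℤ : List ℤ → ℤ
sumℤ = foldr ℤ._+_ 0ℤ

rankOf : ∀ {m} → (Subset m → Bool) → Subset m → ℕ
rankOf {m} ind X = maxL (map Sub.∣_∣ (filterᵇ (λ S → (S ⊆ᵇ X) ∧ ind S) (allSubsets m)))

-- A matroid is presented by its ground set D ⊆ Fin m and rank function ρ
-- (on subsets of D).
module MatroidOps {m : ℕ} (D : Subset m) (ρ : Subset m → ℕ) where

  isFlat : Subset m → Bool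
  isFlat Y = (Y ⊆ᵇ D) ∧
    allᵇ (λ e → not (mem e D ∧ not (mem e Y)) ∨ (ρ Y <ᵇ ρ (Y ∪ ⁅ e ⁆))) (allFin m)

  flats : List (Subset m)
  flats = filterᵇ isFlat (allSubsets m)

  bottom : Subset m
  bottom = Vec.tabulate (λ e → mem e D ∧ (ρ ⁅ e ⁆ ≡ᵇ ρ Sub.⊥))

  -- Möbius function of the lattice of flats (ordered by ⊆):
  -- μ(X,X) = 1, μ(X,Y) = - Σ_{X ⊆ Z ⊊ Y, Z flat} μ(X,Z) for X ⊊ Y,
  -- 0 otherwise.  The fuel argument bounds the recursion depth; fuel m
  -- suffices since chains of flats have length ≤ m.
  mobF : ℕ → Subset m → Subset m → ℤ
  mobF zero    X Y = if X =ᵇ Y then 1ℤ else 0ℤ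
  mobF (suc f) X Y =
    if X =ᵇ Y then 1ℤ else
    (if X ⊆ᵇ Y
      then ℤ.- sumℤ (map (mobF f X)
             (filterᵇ (λ Z → (X ⊆ᵇ Z) ∧ (Z ⊆ᵇ Y) ∧ not (Z =ᵇ Y)) flats))
      else 0ℤ)

  μ : Subset m → Subset m → ℤ
  μ = mobF m

  -- characteristic polynomial χ(M,t) = Σ_{X ∈ L(M)} μ(X) t^{r(E) - r(X)},
  -- as its coefficient sequence
  charPoly : ℕ → ℤ
  charPoly d = sumℤ (map (λ Y → if (ρ D ∸ ρ Y) ≡ᵇ d then μ bottom Y else 0ℤ) flats)

coeffL : List ℤ → ℕ → ℤ
coeffL []       _       = 0ℤ
coeffL (x ∷ xs) zero    = x
coeffL (x ∷ xs) (suc n) = coeffL xs n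

PolyDivides : (ℕ → ℤ) → (ℕ → ℤ) → Set
PolyDivides p q = Σ (List ℤ) λ r →
  ∀ n → sumℤ (map (λ i → p i ℤ.* coeffL r (n ∸ i)) (upTo (suc n))) ≡ q n

charPolyContr : ∀ {m} → (Subset m → ℕ) → Subset m → ℕ → ℤ
charPolyContr rk X = MatroidOps.charPoly (∁ X) (λ Y → rk (Y ∪ X) ∸ rk X)

record DivisionalFlag {m} (rk : Subset m → ℕ) : Set where
  field
    X     : ℕ → Subset m
    X₀    : X 0 ≡ Sub.⊥
    Xₙ    : X (rk Sub.⊤) ≡ Sub.⊤
    flat  : ∀ i → i ≤ rk Sub.⊤ → MatroidOps.isFlat Sub.⊤ rk (X i) ≡ true
    chain : ∀ i → i < rk Sub.⊤ → (X i ⊆ᵇ X (suc i)) ≡ true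
    rank  : ∀ i → i ≤ rk Sub.⊤ → rk (X i) ≡ i
    div   : ∀ i → i < rk Sub.⊤ →
            PolyDivides (charPolyContr rk (X (suc i))) (charPolyContr rk (X i))

-- An arrangement, given by a list of defining forms, is divisionally free
-- if its linear dependence matroid has a divisional flag.  The rank is
-- computed from (any) decision procedure for linear independence; all
-- such procedures agree, so we quantify over them.
DivisionallyFree : ∀ {c ℓ} (K : CommutativeRing c ℓ) {d} →
                   List (Fin d → CommutativeRing.Carrier K) → Set (c ⊔ ℓ)
DivisionallyFree K hs =
  (dec : ∀ S → Dec (LinIndep K (List.lookup hs) S)) →
  DivisionalFlag (rankOf (λ S → does (dec S)))

{-# OPTIONS --safe #-}
-- Colour the vertices by q copies of G, so that t = q|G| colours are available, and add a
-- coordinate z with t values of which only z = 0 matters. The points satisfying a set of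
-- hyperplanes are then counted by t to the power of its corank, so Möbius inversion expresses
-- t^(N+1-r) χ(M/X,t) as the number of points whose set of hyperplanes is exactly X. For X not
-- containing {z = 0} this is, up to factors t - 1 and t, the number of proper colourings of the
-- graph contracted along X. It remains to contract Γ edge by edge down to an edgeless graph so
-- that each step divides the number of proper colourings by t - d.
--
-- Let Γ in the class sit inside a larger graph, sharing with the rest a complete graph on the
-- vertices T; then Γ can be contracted away, leaving the rest. A gluing is contracted one part at
-- a time, the part containing T last. A link-simplicial v outside T is contracted onto any
-- neighbour, and v can be coloured in t - deg v ways. If v lies in T and has a neighbour w outside T,
-- contract w onto v, which then plays the rôle of w in Γ ∖ v: by the automorphisms of the set
-- of colours, the number of extensions of a colouring of T does not depend on that colouring, so
-- again the quotient is t - deg v. If all neighbours of v ∈ T are in T, nothing is to be done.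
module Submission where

open import Level using (_⊔_)
open import Defs
open import Algebra.Bundles using (CommutativeRing)
open import Algebra.Structures using (IsAbelianGroup)
open import Data.Bool using (Bool; true; false; _∧_; _∨_; not; if_then_else_; T)
import Data.Bool.Properties as Bool
open import Data.Nat as ℕ using (ℕ; zero; suc; z≤n; s≤s; _∸_; _≡ᵇ_; _<ᵇ_)
import Data.Nat.Properties as ℕ
open import Data.Integer as ℤ using (ℤ; 0ℤ; 1ℤ; _+_; _*_; _-_; -_; _^_) renaming (+_ to pos)
import Data.Integer.Properties as ℤ
open import Data.Integer.Tactic.RingSolver using (solve-∀)
open import Data.Fin as Fin using (Fin; toℕ)
import Data.Fin.Properties as Fin
open import Data.Fin.Subset as Sub using (Subset; inside; outside; ∁; _∪_; ⁅_⁆; ⊤; ⊥; ∣_∣)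
import Data.Fin.Subset.Properties as Sub
open import Data.Vec as Vec using (Vec; []; _∷_; lookup; _[_]≔_; tabulate)
import Data.Vec.Properties as Vec
open import Data.List as List using (List; []; _∷_; map; _++_; filterᵇ; allFin; upTo; length; cartesianProduct)
import Data.List.Properties as List
open import Data.List.Membership.Propositional using (_∈_; lose; find)
import Data.List.Membership.Propositional.Properties as Mem
open import Data.List.Relation.Unary.Any using (here; there)
open import Data.List.Relation.Unary.All using (All; []; _∷_)
open import Data.List.Relation.Unary.AllPairs using (AllPairs; []; _∷_)
import Data.List.Relation.Unary.Unique.Propositional.Properties as Unique
open import Data.Product using (Σ; ∃; _×_; _,_; proj₁; proj₂)
open import Data.Product.Properties using (≡-dec)
open import Data.Sum using (_⊎_; inj₁; inj₂)
open import Data.Unit using (tt)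
open import Function using (_∘_; id; case_of_)
open import Relation.Nullary using (¬_; Dec; does; yes; no; contradiction)
open import Relation.Nullary.Decidable using (dec-true; dec-false)
open import Relation.Binary.Definitions using (DecidableEquality; tri<; tri≈; tri>)
open import Relation.Binary.PropositionalEquality

-- Finite sums

-- Colours form copies of G rather than a field, because the equation x i = x j + g z only asks for
-- an action of G: for z ≠ 0 this is translation on each copy, which is free, and for z = 0 it is
-- the trivial action. The price is that numbers of common zeros must be matched with linear
-- independence over K; eliminating one vertex at a time does this for both in parallel. Only
-- multiples of |G| occur as t, so divisibility of polynomials is recovered from infinitely many
-- values.
--
-- The case v ∈ T is the obstacle: the colour of v is already prescribed by the surrounding graph.
-- Here it matters that T is complete with all gains. The colours on T then forbid whole orbits, so
-- an automorphism exchanging two other orbits fixes them, and it may be applied to the inner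
-- vertices alone. This symmetry is used as a double count with a spare colour, at the cost of
-- multiplying both sides by the number of colours outside the orbits of the other shared vertices.
-- The factor is cancelled at the end, so it must not vanish, which is why q has to exceed the
-- number of vertices.

⟦_⟧ : Bool → ℤ
⟦ true ⟧ = 1ℤ
⟦ false ⟧ = 0ℤ

⟦∧⟧ : ∀ a b → ⟦ a ∧ b ⟧ ≡ ⟦ a ⟧ * ⟦ b ⟧
⟦∧⟧ true  b = sym (ℤ.*-identityˡ _)
⟦∧⟧ false b = refl

⟦⟧-nonneg : ∀ b → 0ℤ ℤ.≤ ⟦ b ⟧
⟦⟧-nonneg true  = ℤ.+≤+ z≤n
⟦⟧-nonneg false = ℤ.≤-refl

⟦⟧-mono : ∀ {a b} → (a ≡ true → b ≡ true) → ⟦ a ⟧ ℤ.≤ ⟦ b ⟧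
⟦⟧-mono {true}  f rewrite f refl = ℤ.≤-refl
⟦⟧-mono {false} f = ⟦⟧-nonneg _

true⇔⇒≡ : ∀ {a b} → (a ≡ true → b ≡ true) → (b ≡ true → a ≡ true) → a ≡ b
true⇔⇒≡ {true}          f g = sym (f refl)
true⇔⇒≡ {false} {true}  f g = g refl
true⇔⇒≡ {false} {false} f g = refl

¬true⇒false : ∀ {a} → ¬ (a ≡ true) → a ≡ false
¬true⇒false {true}  h = contradiction refl h
¬true⇒false {false} h = refl

∧-true : ∀ {a b} → a ∧ b ≡ true → a ≡ true × b ≡ true
∧-true {true} {true} _ = refl , refl

∧-intro : ∀ {a b} → a ≡ true → b ≡ true → a ∧ b ≡ true
∧-intro refl refl = refl

∨-true : ∀ {a b} → a ∨ b ≡ true → a ≡ true ⊎ b ≡ true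
∨-true {true}  _ = inj₁ refl
∨-true {false} h = inj₂ h

∨-introˡ : ∀ {a b} → a ≡ true → a ∨ b ≡ true
∨-introˡ refl = refl

∨-introʳ : ∀ {a b} → b ≡ true → a ∨ b ≡ true
∨-introʳ {true}  refl = refl
∨-introʳ {false} refl = refl

does-true : ∀ {p} {P : Set p} (d : Dec P) → does d ≡ true → P
does-true (yes p) _ = p

∑ : {I : Set} → List I → (I → ℤ) → ℤ
∑ []       F = 0ℤ
∑ (x ∷ xs) F = F x + ∑ xs F

private variable
  I I′ : Set

sumℤ-map : (xs : List I) (F : I → ℤ) → sumℤ (map F xs) ≡ ∑ xs F
sumℤ-map []       F = refl
sumℤ-map (x ∷ xs) F = cong (F x +_) (sumℤ-map xs F)

∑-cong : (xs : List I) {F F′ : I → ℤ} → (∀ x → F x ≡ F′ x) → ∑ xs F ≡ ∑ xs F′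
∑-cong []       h = refl
∑-cong (x ∷ xs) h = cong₂ _+_ (h x) (∑-cong xs h)

∑-zero : (xs : List I) → ∑ xs (λ _ → 0ℤ) ≡ 0ℤ
∑-zero []       = refl
∑-zero (x ∷ xs) = trans (ℤ.+-identityˡ _) (∑-zero xs)

∑-+ : (xs : List I) (F F′ : I → ℤ) → ∑ xs (λ x → F x + F′ x) ≡ ∑ xs F + ∑ xs F′
∑-+ []       F F′ = refl
∑-+ (x ∷ xs) F F′ rewrite ∑-+ xs F F′ = interchange (F x) (F′ x) (∑ xs F) (∑ xs F′)
  where
  interchange : ∀ a b c d → (a + b) + (c + d) ≡ (a + c) + (b + d)
  interchange = solve-∀

∑-*ˡ : (xs : List I) (a : ℤ) (F : I → ℤ) → ∑ xs (λ x → a * F x) ≡ a * ∑ xs F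
∑-*ˡ []       a F = sym (ℤ.*-zeroʳ a)
∑-*ˡ (x ∷ xs) a F rewrite ∑-*ˡ xs a F = sym (ℤ.*-distribˡ-+ a (F x) (∑ xs F))

∑-*ʳ : (xs : List I) (a : ℤ) (F : I → ℤ) → ∑ xs (λ x → F x * a) ≡ ∑ xs F * a
∑-*ʳ xs a F = trans (∑-cong xs (λ x → ℤ.*-comm (F x) a))
                    (trans (∑-*ˡ xs a F) (ℤ.*-comm a _))

∑-neg : (xs : List I) (F : I → ℤ) → ∑ xs (λ x → - F x) ≡ - ∑ xs F
∑-neg []       F = refl
∑-neg (x ∷ xs) F rewrite ∑-neg xs F = sym (ℤ.neg-distrib-+ (F x) (∑ xs F))

∑-++ : (xs ys : List I) (F : I → ℤ) → ∑ (xs ++ ys) F ≡ ∑ xs F + ∑ ys F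
∑-++ []       ys F = sym (ℤ.+-identityˡ _)
∑-++ (x ∷ xs) ys F rewrite ∑-++ xs ys F = sym (ℤ.+-assoc (F x) _ _)

∑-map : (f : I → I′) (xs : List I) (F : I′ → ℤ) → ∑ (map f xs) F ≡ ∑ xs (F ∘ f)
∑-map f []       F = refl
∑-map f (x ∷ xs) F = cong (F (f x) +_) (∑-map f xs F)

∑-swap : (xs : List I) (ys : List I′) (F : I → I′ → ℤ) →
         ∑ xs (λ x → ∑ ys (F x)) ≡ ∑ ys (λ y → ∑ xs (λ x → F x y))
∑-swap []       ys F = sym (∑-zero ys)
∑-swap (x ∷ xs) ys F = trans (cong (∑ ys (F x) +_) (∑-swap xs ys F))
                             (sym (∑-+ ys (F x) _))

∑-const : (xs : List I) (a : ℤ) → ∑ xs (λ _ → a) ≡ pos (length xs) * a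
∑-const []       a = sym (ℤ.*-zeroˡ a)
∑-const (x ∷ xs) a rewrite ∑-const xs a = sym (suc-* (pos (length xs)) a)
  where
  suc-* : ∀ n b → (1ℤ + n) * b ≡ b + n * b
  suc-* = solve-∀

∑-filter : (p : I → Bool) (xs : List I) (F : I → ℤ) →
           ∑ (filterᵇ p xs) F ≡ ∑ xs (λ x → ⟦ p x ⟧ * F x)
∑-filter p []       F = refl
∑-filter p (x ∷ xs) F with p x
... | true  = cong₂ _+_ (sym (ℤ.*-identityˡ (F x))) (∑-filter p xs F)
... | false = trans (∑-filter p xs F) (sym (ℤ.+-identityˡ _))

∑-product : (xs : List I) (ys : List I′) (F : I × I′ → ℤ) →
            ∑ (cartesianProduct xs ys) F ≡ ∑ xs (λ x → ∑ ys (λ y → F (x , y)))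
∑-product []       ys F = refl
∑-product (x ∷ xs) ys F =
  trans (∑-++ (map (x ,_) ys) (cartesianProduct xs ys) F)
        (cong₂ _+_ (∑-map (x ,_) ys F) (∑-product xs ys F))

∑-mono : (xs : List I) {F F′ : I → ℤ} → (∀ x → F x ℤ.≤ F′ x) → ∑ xs F ℤ.≤ ∑ xs F′
∑-mono []       h = ℤ.≤-refl
∑-mono (x ∷ xs) h = ℤ.+-mono-≤ (h x) (∑-mono xs h)

-- That each element is listed exactly once is expressed by the value of a sum against a Kronecker
-- delta, the form in which the counting uses it.
record Enumeration (I : Set) : Set where
  infix 4 _≟_ _==_
  field
    elements : List I
    _≟_      : DecidableEquality I
    ∑-pick   : ∀ d F → ∑ elements (λ x → ⟦ does (x ≟ d) ⟧ * F x) ≡ F d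

  _==_ : I → I → Bool
  x == y = does (x ≟ y)

  ==-refl : ∀ x → (x == x) ≡ true
  ==-refl x = dec-true (x ≟ x) refl

  ≡⇒== : ∀ {x y} → x ≡ y → (x == y) ≡ true
  ≡⇒== refl = ==-refl _

  ==⇒≡ : ∀ {x y} → (x == y) ≡ true → x ≡ y
  ==⇒≡ {x} {y} = does-true (x ≟ y)

  ∑-pick₁ : ∀ d → ∑ elements (λ x → ⟦ x == d ⟧) ≡ 1ℤ
  ∑-pick₁ d = trans (∑-cong elements (λ x → sym (ℤ.*-identityʳ _))) (∑-pick d (λ _ → 1ℤ))

  -- Expand F (σ x) as a sum of deltas over y; after exchanging the sums, the delta at y singles out
  -- x = τ y.
  ∑-reindex : (σ τ : I → I) → (∀ x → τ (σ x) ≡ x) → (∀ x → σ (τ x) ≡ x) →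
              ∀ F → ∑ elements (F ∘ σ) ≡ ∑ elements F
  ∑-reindex σ τ τσ στ F = begin
    ∑ es (F ∘ σ) ≡⟨ ∑-cong es (λ x → sym (∑-pick (σ x) F)) ⟩
    ∑ es (λ x → ∑ es (λ y → ⟦ y == σ x ⟧ * F y)) ≡⟨ ∑-swap es es _ ⟩
    ∑ es (λ y → ∑ es (λ x → ⟦ y == σ x ⟧ * F y)) ≡⟨ ∑-cong es (λ y → ∑-*ʳ es (F y) _) ⟩
    ∑ es (λ y → ∑ es (λ x → ⟦ y == σ x ⟧) * F y) ≡⟨ ∑-cong es (λ y → cong (_* F y) (trans (∑-cong es (λ x → cong ⟦_⟧ (flip x y))) (∑-pick₁ (τ y)))) ⟩
    ∑ es (λ y → 1ℤ * F y) ≡⟨ ∑-cong es (λ y → ℤ.*-identityˡ _) ⟩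
    ∑ es F ∎
    where
    open ≡-Reasoning
    es = elements
    flip : ∀ x y → (y == σ x) ≡ (x == τ y)
    flip x y = true⇔⇒≡
      (λ h → ≡⇒== (trans (sym (τσ x)) (cong τ (sym (==⇒≡ h)))))
      (λ h → ≡⇒== (trans (sym (στ y)) (cong σ (sym (==⇒≡ h)))))

  -- The gap at d, written as a delta sum, still fits between F and F′ pointwise, so the two sums
  -- differ by at least this positive amount.
  ∑-strict : ∀ {F F′ : I → ℤ} → (∀ x → F x ℤ.≤ F′ x) → ∀ d → F d ℤ.< F′ d →
             ∑ elements F ℤ.< ∑ elements F′
  ∑-strict {F} {F′} F≤F′ d lt = begin-strict
    ∑ es F ≡⟨ sym (ℤ.+-identityʳ _) ⟩
    ∑ es F + 0ℤ <⟨ ℤ.+-monoʳ-< (∑ es F) (subst (ℤ._< F′ d - F d) (ℤ.+-inverseʳ (F d)) (ℤ.+-monoˡ-< (- F d) lt)) ⟩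
    ∑ es F + (F′ d - F d) ≡⟨ cong (∑ es F +_) (sym (∑-pick d (λ x → F′ x - F x))) ⟩
    ∑ es F + ∑ es (λ x → ⟦ x == d ⟧ * (F′ x - F x)) ≡⟨ sym (∑-+ es F _) ⟩
    ∑ es (λ x → F x + ⟦ x == d ⟧ * (F′ x - F x)) ≤⟨ ∑-mono es below ⟩
    ∑ es F′ ∎
    where
    open ℤ.≤-Reasoning
    es = elements
    cancel : ∀ a b → a + 1ℤ * (b - a) ≡ b
    cancel = solve-∀
    below : ∀ x → F x + ⟦ x == d ⟧ * (F′ x - F x) ℤ.≤ F′ x
    below x with x == d
    ... | true  = ℤ.≤-reflexive (cancel (F x) (F′ x))
    ... | false = ℤ.≤-trans (ℤ.≤-reflexive (ℤ.+-identityʳ (F x))) (F≤F′ x)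

open Enumeration public using (elements)

finEnum : ∀ n → Enumeration (Fin n)
finEnum n = record { elements = allFin n ; _≟_ = Fin._≟_ ; ∑-pick = pick n }
  where
  pick : ∀ n (d : Fin n) (F : Fin n → ℤ) → ∑ (allFin n) (λ x → ⟦ does (x Fin.≟ d) ⟧ * F x) ≡ F d
  shift : ∀ {n} (F : Fin (suc n) → ℤ) → ∑ (List.tabulate Fin.suc) F ≡ ∑ (allFin n) (F ∘ Fin.suc)
  shift F = trans (cong (λ l → ∑ l F) (sym (List.map-tabulate id Fin.suc))) (∑-map Fin.suc (allFin _) F)
  pick (suc n) Fin.zero F =
    trans (cong₂ _+_ (ℤ.*-identityˡ (F Fin.zero)) (trans (shift (λ x → ⟦ does (x Fin.≟ Fin.zero) ⟧ * F x)) (∑-zero (allFin n)))) (ℤ.+-identityʳ _)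
  pick (suc n) (Fin.suc d) F =
    trans (ℤ.+-identityˡ _) (trans (shift (λ x → ⟦ does (x Fin.≟ Fin.suc d) ⟧ * F x)) (pick n d (F ∘ Fin.suc)))

boolEnum : Enumeration Bool
boolEnum = record
  { elements = false ∷ true ∷ [] ; _≟_ = Bool._≟_ ; ∑-pick = pick }
  where
  pick : ∀ d F → ∑ (false ∷ true ∷ []) (λ x → ⟦ does (x Bool.≟ d) ⟧ * F x) ≡ F d
  pick false F = trans (ℤ.+-identityʳ _) (ℤ.*-identityˡ _)
  pick true  F = trans (ℤ.+-identityˡ _) (trans (ℤ.+-identityʳ _) (ℤ.*-identityˡ _))

∑-pick-pair : (eA : Enumeration I) (eB : Enumeration I′) → ∀ a b (F : I → I′ → ℤ) →
  ∑ (elements eA) (λ x → ∑ (elements eB) (λ y →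
    ⟦ Enumeration._==_ eA x a ∧ Enumeration._==_ eB y b ⟧ * F x y)) ≡ F a b
∑-pick-pair eA eB a b F =
  trans (∑-cong (elements eA) (λ x →
          trans (∑-cong (elements eB) (λ y →
                  trans (cong (_* F x y) (⟦∧⟧ (x A.== a) _)) (ℤ.*-assoc ⟦ x A.== a ⟧ _ _)))
                (trans (∑-*ˡ (elements eB) ⟦ x A.== a ⟧ _)
                       (cong (⟦ x A.== a ⟧ *_) (B.∑-pick b (F x))))))
        (A.∑-pick a (λ x → F x b))
  where
  module A = Enumeration eA
  module B = Enumeration eB

productEnum : Enumeration I → Enumeration I′ → Enumeration (I × I′)
productEnum {I} {I′} eA eB = record
  { elements = cartesianProduct (elements eA) (elements eB)
  ; _≟_ = _≟′_
  ; ∑-pick = λ { (a , b) F →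
      trans (∑-product (elements eA) (elements eB) _)
     (trans (∑-cong (elements eA) (λ x → ∑-cong (elements eB) (λ y →
               cong (λ c → ⟦ c ⟧ * F (x , y)) (does-pair x y a b))))
            (∑-pick-pair eA eB a b (λ x y → F (x , y)))) } }
  where
  module EA = Enumeration eA
  module EB = Enumeration eB
  _≟′_ : DecidableEquality (I × I′)
  _≟′_ = ≡-dec EA._≟_ EB._≟_
  does-pair : ∀ x y a b → does ((x , y) ≟′ (a , b)) ≡ (x EA.== a) ∧ (y EB.== b)
  does-pair x y a b = true⇔⇒≡
    (λ h → case does-true ((x , y) ≟′ (a , b)) h of λ { refl → ∧-intro (EA.==-refl a) (EB.==-refl b) })
    (λ h → let p , q = ∧-true h in dec-true ((x , y) ≟′ (a , b)) (cong₂ _,_ (EA.==⇒≡ p) (EB.==⇒≡ q)))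

vecs : List I → ∀ n → List (Vec I n)
vecs cs zero    = [] ∷ []
vecs cs (suc n) = map (λ { (c , x) → c ∷ x }) (cartesianProduct cs (vecs cs n))

∑-vecs-suc : (cs : List I) (n : ℕ) (F : Vec I (suc n) → ℤ) →
             ∑ (vecs cs (suc n)) F ≡ ∑ cs (λ c → ∑ (vecs cs n) (λ x → F (c ∷ x)))
∑-vecs-suc cs n F = trans (∑-map _ (cartesianProduct cs (vecs cs n)) F) (∑-product cs (vecs cs n) _)

vecEnum : Enumeration I → ∀ n → Enumeration (Vec I n)
vecEnum {I} eA n = record { elements = vecs (elements eA) n ; _≟_ = Vec.≡-dec EA._≟_ ; ∑-pick = pick n }
  where
  module EA = Enumeration eA
  _≟′_ : ∀ {n} → DecidableEquality (Vec I n)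
  _≟′_ = Vec.≡-dec EA._≟_
  does-∷ : ∀ {n} c d (x y : Vec I n) → does ((c ∷ x) ≟′ (d ∷ y)) ≡ (c EA.== d) ∧ does (x ≟′ y)
  does-∷ c d x y = true⇔⇒≡
    (λ h → case does-true ((c ∷ x) ≟′ (d ∷ y)) h of λ { refl → ∧-intro (EA.==-refl d) (dec-true (y ≟′ y) refl) })
    (λ h → let p , q = ∧-true h in dec-true ((c ∷ x) ≟′ (d ∷ y)) (cong₂ _∷_ (EA.==⇒≡ p) (does-true (x ≟′ y) q)))
  pick : ∀ n (d : Vec I n) F → ∑ (vecs (elements eA) n) (λ x → ⟦ does (x ≟′ d) ⟧ * F x) ≡ F d
  pick zero    []      F = trans (ℤ.+-identityʳ _) (ℤ.*-identityˡ _)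
  pick (suc n) (d ∷ y) F =
    trans (∑-vecs-suc (elements eA) n _)
   (trans (∑-cong (elements eA) (λ c → ∑-cong (vecs (elements eA) n) (λ x →
             cong (λ b → ⟦ b ⟧ * F (c ∷ x)) (does-∷ c d x y))))
          (∑-pick-pair eA (record { elements = vecs (elements eA) n ; _≟_ = _≟′_ ; ∑-pick = pick n }) d y (λ c x → F (c ∷ x))))

-- Subsets are Boolean vectors, so `subsetEnum` can inherit its delta property from `vecEnum` once
-- sums over the two lists agree.
∑-allSubsets : ∀ m (F : Subset m → ℤ) → ∑ (allSubsets m) F ≡ ∑ (vecs (elements boolEnum) m) F
∑-allSubsets zero    F = refl
∑-allSubsets (suc m) F =
  trans (∑-++ (map (outside ∷_) (allSubsets m)) _ F)
 (trans (cong₂ _+_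
          (trans (∑-map (outside ∷_) (allSubsets m) F) (∑-allSubsets m _))
          (trans (∑-map (inside ∷_) (allSubsets m) F) (∑-allSubsets m _)))
 (trans (cong (λ s → ∑ (vecs (elements boolEnum) m) (F ∘ (outside ∷_)) + s) (sym (ℤ.+-identityʳ _)))
        (sym (∑-vecs-suc (elements boolEnum) m F))))

subsetEnum : ∀ m → Enumeration (Subset m)
subsetEnum m = record
  { elements = allSubsets m
  ; _≟_ = V._≟_
  ; ∑-pick = λ d F → trans (∑-allSubsets m _) (V.∑-pick d F) }
  where module V = Enumeration (vecEnum boolEnum m)

-- Polynomials given by coefficient sequences

-- Horner evaluation of the part of degree at most `n`: a coefficient sequence carries no degree of
-- its own.
evalPoly : (ℕ → ℤ) → ℕ → ℤ → ℤ
evalPoly p zero    t = p 0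
evalPoly p (suc n) t = p 0 + t * evalPoly (p ∘ suc) n t

evalPoly-cong : ∀ {p q} n t → (∀ d → p d ≡ q d) → evalPoly p n t ≡ evalPoly q n t
evalPoly-cong zero    t h = h 0
evalPoly-cong (suc n) t h = cong₂ (λ a b → a + t * b) (h 0) (evalPoly-cong n t (h ∘ suc))

evalPoly-zero : ∀ n t → evalPoly (λ _ → 0ℤ) n t ≡ 0ℤ
evalPoly-zero zero    t = refl
evalPoly-zero (suc n) t rewrite evalPoly-zero n t = trans (ℤ.+-identityˡ _) (ℤ.*-zeroʳ t)

evalPoly-linear : ∀ p q a n t → evalPoly (λ d → p d + a * q d) n t ≡ evalPoly p n t + a * evalPoly q n t
evalPoly-linear p q a zero    t = refl
evalPoly-linear p q a (suc n) t rewrite evalPoly-linear (p ∘ suc) (q ∘ suc) a n t =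
  rearrange (p 0) (q 0) a t (evalPoly (p ∘ suc) n t) (evalPoly (q ∘ suc) n t)
  where
  rearrange : ∀ x y a t u v → (x + a * y) + t * (u + a * v) ≡ (x + t * u) + a * (y + t * v)
  rearrange = solve-∀

evalPoly-∑ : (xs : List I) (p : I → ℕ → ℤ) → ∀ n t →
             evalPoly (λ d → ∑ xs (λ x → p x d)) n t ≡ ∑ xs (λ x → evalPoly (p x) n t)
evalPoly-∑ []       p n t = evalPoly-zero n t
evalPoly-∑ (x ∷ xs) p n t = begin
  evalPoly (λ d → p x d + ∑ xs (λ y → p y d)) n t ≡⟨ evalPoly-cong n t (λ d → cong (p x d +_) (sym (ℤ.*-identityˡ _))) ⟩
  evalPoly (λ d → p x d + 1ℤ * ∑ xs (λ y → p y d)) n t ≡⟨ evalPoly-linear (p x) _ 1ℤ n t ⟩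
  evalPoly (p x) n t + 1ℤ * evalPoly (λ d → ∑ xs (λ y → p y d)) n t ≡⟨ cong (λ s → evalPoly (p x) n t + s) (trans (ℤ.*-identityˡ _) (evalPoly-∑ xs p n t)) ⟩
  evalPoly (p x) n t + ∑ xs (λ y → evalPoly (p y) n t) ∎
  where open ≡-Reasoning

evalPoly-monomial : ∀ e a n t → e ℕ.≤ n → evalPoly (λ d → if e ≡ᵇ d then a else 0ℤ) n t ≡ a * t ^ e
evalPoly-monomial zero a zero t _ = sym (ℤ.*-identityʳ a)
evalPoly-monomial zero a (suc n) t _ rewrite evalPoly-zero n t =
  trans (cong (a +_) (ℤ.*-zeroʳ t)) (trans (ℤ.+-identityʳ a) (sym (ℤ.*-identityʳ a)))
evalPoly-monomial (suc e) a (suc n) t (s≤s e≤n) rewrite evalPoly-monomial e a n t e≤n =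
  trans (ℤ.+-identityˡ _) (swap t a (t ^ e))
  where
  swap : ∀ t a b → t * (a * b) ≡ a * (t * b)
  swap = solve-∀

mulX : (ℕ → ℤ) → ℕ → ℤ
mulX p zero    = 0ℤ
mulX p (suc n) = p n

pos≢0 : ∀ {n} → 0 ℕ.< n → ℤ.NonZero (pos n)
pos≢0 {suc n} _ = _

-- t divides a, so |a| < t leaves only a = 0.
small-constant-term : ∀ a b t → ℤ.∣ a ∣ ℕ.< t → a + pos t * b ≡ 0ℤ → b ≡ 0ℤ
small-constant-term a b t a<t h = go ℤ.∣ b ∣ refl
  where
  open ℕ.≤-Reasoning
  a≡-c : a ≡ - (pos t * b)
  a≡-c = trans (shift a (pos t * b)) (trans (cong (_- pos t * b) h) (ℤ.+-identityˡ _))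
    where
    shift : ∀ a c → a ≡ (a + c) - c
    shift = solve-∀
  go : ∀ m → ℤ.∣ b ∣ ≡ m → b ≡ 0ℤ
  go zero    eq = ℤ.∣i∣≡0⇒i≡0 eq
  go (suc m) eq = contradiction (ℕ.<-≤-trans a<t (begin
    t ≤⟨ ℕ.m≤m+n t (t ℕ.* m) ⟩
    t ℕ.+ t ℕ.* m ≡⟨ sym (ℕ.*-suc t m) ⟩
    t ℕ.* suc m ≡⟨ cong (t ℕ.*_) (sym eq) ⟩
    t ℕ.* ℤ.∣ b ∣ ≡⟨ sym (ℤ.abs-* (pos t) b) ⟩
    ℤ.∣ pos t * b ∣ ≡⟨ sym (ℤ.∣-i∣≡∣i∣ (pos t * b)) ⟩
    ℤ.∣ - (pos t * b) ∣ ≡⟨ cong ℤ.∣_∣ (sym a≡-c) ⟩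
    ℤ.∣ a ∣ ∎)) (ℕ.<-irrefl refl)

-- At a zero larger than |p 0| the higher terms must vanish together, by `small-constant-term`,
-- hence so does p 0. Dividing by the zeros then leaves `p ∘ suc` with the same zeros, and the
-- degree drops.
evalPoly-zeros : (τ : ℕ → ℕ) → (∀ s → s ℕ.< τ s) → ∀ n p →
                 (∀ s → evalPoly p n (pos (τ s)) ≡ 0ℤ) → ∀ d → d ℕ.≤ n → p d ≡ 0ℤ
evalPoly-zeros τ τ> zero p h .zero z≤n = h 0
evalPoly-zeros τ τ> (suc n) p h d d≤n = case d , d≤n
  where
  s₀ = ℤ.∣ p 0 ∣
  rest₀ : evalPoly (p ∘ suc) n (pos (τ s₀)) ≡ 0ℤ
  rest₀ = small-constant-term (p 0) _ (τ s₀) (τ> s₀) (h s₀)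
  p0≡0 : p 0 ≡ 0ℤ
  p0≡0 = trans (sym (ℤ.+-identityʳ (p 0)))
        (trans (cong (p 0 +_) (sym (trans (cong (pos (τ s₀) *_) rest₀) (ℤ.*-zeroʳ (pos (τ s₀)))))) (h s₀))
  rest : ∀ s → evalPoly (p ∘ suc) n (pos (τ s)) ≡ 0ℤ
  rest s = ℤ.*-cancelˡ-≡ (pos (τ s)) _ 0ℤ {{pos≢0 (ℕ.≤-trans (s≤s z≤n) (τ> s))}}
    (trans (trans (sym (ℤ.+-identityˡ _)) (trans (cong (_+ pos (τ s) * evalPoly (p ∘ suc) n (pos (τ s))) (sym p0≡0)) (h s))) (sym (ℤ.*-zeroʳ (pos (τ s)))))
  case_,_ : ∀ d → d ℕ.≤ suc n → p d ≡ 0ℤ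
  case zero  , _       = p0≡0
  case suc d , s≤s d≤n = evalPoly-zeros τ τ> n (p ∘ suc) rest d d≤n

∑-upTo-suc : ∀ n F → ∑ (upTo (suc n)) F ≡ ∑ (upTo n) F + F n
∑-upTo-suc n F = trans (cong (λ l → ∑ l F) (sym (List.upTo-∷ʳ n)))
  (trans (∑-++ (upTo n) _ F) (cong (∑ (upTo n) F +_) (ℤ.+-identityʳ (F n))))

∑-upTo-zero : ∀ n F → (∀ i → i ℕ.< n → F i ≡ 0ℤ) → ∑ (upTo n) F ≡ 0ℤ
∑-upTo-zero zero    F h = refl
∑-upTo-zero (suc n) F h = trans (∑-upTo-suc n F)
  (cong₂ _+_ (∑-upTo-zero n F (λ i i<n → h i (ℕ.m<n⇒m<1+n i<n))) (h n (ℕ.n<1+n n)))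

evalPoly-extend : ∀ p n t → (∀ d → n ℕ.< d → p d ≡ 0ℤ) → evalPoly p (suc n) t ≡ evalPoly p n t
evalPoly-extend p zero    t h = trans (cong (λ c → p 0 + t * c) (h 1 (s≤s z≤n))) (trans (cong (p 0 +_) (ℤ.*-zeroʳ t)) (ℤ.+-identityʳ (p 0)))
evalPoly-extend p (suc n) t h = cong (λ c → p 0 + t * c) (evalPoly-extend (p ∘ suc) n t (λ d lt → h (suc d) (s≤s lt)))

linear-factor⇒PolyDivides : ∀ p q a → (∀ n → p n ≡ mulX q n - a * q n) → PolyDivides q p
linear-factor⇒PolyDivides p q a h = r , coeffs
  where
  -- The cofactor is t - a, so only the last two terms of the convolution survive.
  r = - a ∷ 1ℤ ∷ []
  F : ℕ → ℕ → ℤ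
  F n i = q i * coeffL r (n ∸ i)
  tail≡0 : ∀ j → coeffL r (suc (suc j)) ≡ 0ℤ
  tail≡0 zero    = refl
  tail≡0 (suc j) = refl
  head : ∀ n → F n n ≡ q n * - a
  head n rewrite ℕ.n∸n≡0 n = refl
  diag : ∀ n → F (suc n) n ≡ q n
  diag n rewrite ℕ.+-∸-assoc 1 (ℕ.≤-refl {n}) | ℕ.n∸n≡0 n = ℤ.*-identityʳ (q n)
  low : ∀ n i → i ℕ.< n → F (suc n) i ≡ 0ℤ
  low n i i<n with j , refl ← ℕ.m≤n⇒∃[o]m+o≡n i<n
    rewrite ℕ.+-∸-assoc 1 {suc (i ℕ.+ j)} {i} (ℕ.≤-trans (ℕ.m≤m+n i j) (ℕ.n≤1+n _))
          | ℕ.+-∸-assoc 1 {i ℕ.+ j} {i} (ℕ.m≤m+n i j)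
          | tail≡0 (i ℕ.+ j ∸ i) = ℤ.*-zeroʳ (q i)
  coeffs : ∀ n → sumℤ (map (F n) (upTo (suc n))) ≡ p n
  coeffs n = trans (sumℤ-map (upTo (suc n)) (F n)) (trans (∑-upTo-suc n (F n)) (trans (last n) (sym (h n))))
    where
    final : ∀ x y a → x + y * - a ≡ x - a * y
    final = solve-∀
    last : ∀ n → ∑ (upTo n) (F n) + F n n ≡ mulX q n - a * q n
    last zero    = trans (cong (0ℤ +_) (head 0)) (final 0ℤ (q 0) a)
    last (suc n) = trans (cong₂ _+_
      (trans (∑-upTo-suc n (F (suc n))) (trans (cong₂ _+_ (∑-upTo-zero n _ (low n)) (diag n)) (ℤ.+-identityˡ (q n))))
      (head (suc n))) (final (q n) (q (suc n)) a)

-- The difference of p and (t - a) q has degree at most n + 1 and vanishes at the arbitrarily large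
-- arguments τ s, so it is zero.
values-factor⇒PolyDivides : (τ : ℕ → ℕ) → (∀ s → s ℕ.< τ s) → ∀ p q a n →
  (∀ d → n ℕ.< d → p d ≡ 0ℤ) → (∀ d → n ℕ.< d → q d ≡ 0ℤ) →
  (∀ s → evalPoly p n (pos (τ s)) ≡ (pos (τ s) - a) * evalPoly q n (pos (τ s))) → PolyDivides q p
values-factor⇒PolyDivides τ τ> p q a n p-high q-high values = linear-factor⇒PolyDivides p q a (λ e →
    trans (rearrange (p e) (a * q e) (mulX q e)) (trans (cong (_+ (mulX q e - a * q e)) (r≡0 e)) (ℤ.+-identityˡ _)))
  where
  r : ℕ → ℤ
  r e = (p e + a * q e) + - 1ℤ * mulX q e
  rearrange : ∀ x y z → x ≡ ((x + y) + - 1ℤ * z) + (z - y)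
  rearrange = solve-∀
  cancel : ∀ t a e → ((t - a) * e + a * e) + - 1ℤ * (t * e) ≡ 0ℤ
  cancel = solve-∀
  vanish : ∀ s → evalPoly r (suc n) (pos (τ s)) ≡ 0ℤ
  vanish s = begin
    evalPoly r (suc n) t ≡⟨ evalPoly-linear (λ e → p e + a * q e) (mulX q) (- 1ℤ) (suc n) t ⟩
    evalPoly (λ e → p e + a * q e) (suc n) t + - 1ℤ * evalPoly (mulX q) (suc n) t
      ≡⟨ cong₂ (λ x y → x + - 1ℤ * y) (trans (evalPoly-linear p q a (suc n) t)
           (cong₂ (λ x y → x + a * y) (trans (evalPoly-extend p n t p-high) (values s)) (evalPoly-extend q n t q-high))) (ℤ.+-identityˡ (t * evalPoly q n t)) ⟩
    ((t - a) * e + a * e) + - 1ℤ * (t * e) ≡⟨ cancel t a e ⟩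
    0ℤ ∎
    where
    open ≡-Reasoning
    t = pos (τ s)
    e = evalPoly q n t
  r≡0 : ∀ e → r e ≡ 0ℤ
  r≡0 e with ℕ.≤-<-connex e (suc n)
  ... | inj₁ e≤ = evalPoly-zeros τ τ> (suc n) r vanish e e≤
  r≡0 (suc e) | inj₂ (s≤s lt) = cong₂ (λ x y → x + - 1ℤ * y)
    (trans (cong₂ (λ x y → x + a * y) (p-high (suc e) (ℕ.m≤n⇒m≤1+n lt)) (q-high (suc e) (ℕ.m≤n⇒m≤1+n lt)))
           (trans (ℤ.+-identityˡ _) (ℤ.*-zeroʳ a)))
    (q-high e lt)

-- Since q is the constant 1, the quotient is p itself; the degree bound serves to write it as a
-- finite list.
one-PolyDivides : ∀ p q n → q 0 ≡ 1ℤ → (∀ d → q (suc d) ≡ 0ℤ) → (∀ d → n ℕ.< d → p d ≡ 0ℤ) → PolyDivides q p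
one-PolyDivides p q n q0 q+ p+ = r , coeffs
  where
  r = List.applyUpTo p (suc n)
  coeffL-applyUpTo : ∀ (p : ℕ → ℤ) n → (∀ d → n ℕ.≤ d → p d ≡ 0ℤ) → ∀ d → coeffL (List.applyUpTo p n) d ≡ p d
  coeffL-applyUpTo p zero    h d       = sym (h d z≤n)
  coeffL-applyUpTo p (suc n) h zero    = refl
  coeffL-applyUpTo p (suc n) h (suc d) = coeffL-applyUpTo (p ∘ suc) n (λ d le → h (suc d) (s≤s le)) d
  coeffs : ∀ d → sumℤ (map (λ i → q i * coeffL r (d ∸ i)) (upTo (suc d))) ≡ p d
  coeffs d = trans (sumℤ-map (upTo (suc d)) (λ i → q i * coeffL r (d ∸ i)))
    (trans (cong₂ _+_ (trans (cong (_* coeffL r d) q0) (trans (ℤ.*-identityˡ _) (coeffL-applyUpTo p (suc n) p+ d))) (rest d))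
           (ℤ.+-identityʳ (p d)))
    where
    vanish : ∀ (f : ℕ → ℕ) m → ∑ (List.applyUpTo (suc ∘ f) m) (λ i → q i * coeffL r (d ∸ i)) ≡ 0ℤ
    vanish f zero    = refl
    vanish f (suc m) = cong₂ _+_ (trans (cong (_* coeffL r (d ∸ suc (f 0))) (q+ (f 0))) (ℤ.*-zeroˡ (coeffL r (d ∸ suc (f 0))))) (vanish (f ∘ suc) m)
    rest : ∀ m → ∑ (List.applyUpTo suc m) (λ i → q i * coeffL r (d ∸ i)) ≡ 0ℤ
    rest m = vanish id m

-- Characteristic polynomials of matroids realized by points

mem-∪ : ∀ {m} (X Y : Subset m) i → mem i (X ∪ Y) ≡ mem i X ∨ mem i Y
mem-∪ X Y i = Vec.lookup-zipWith _∨_ i X Y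

mem-∁ : ∀ {m} (X : Subset m) i → mem i (∁ X) ≡ not (mem i X)
mem-∁ X i = Vec.lookup-map i not X

mem-⊥ : ∀ {m} (i : Fin m) → mem i ⊥ ≡ false
mem-⊥ i = Vec.lookup-replicate i false

mem-⊤ : ∀ {m} (i : Fin m) → mem i ⊤ ≡ true
mem-⊤ i = Vec.lookup-replicate i true

mem-⁅⁆ : ∀ {m} (i : Fin m) → mem i ⁅ i ⁆ ≡ true
mem-⁅⁆ i = Vec.[]=⇒lookup (Sub.x∈⁅x⁆ i)

mem-⁅⁆⇒≡ : ∀ {m} {i j : Fin m} → mem i ⁅ j ⁆ ≡ true → i ≡ j
mem-⁅⁆⇒≡ {i = i} h = Sub.x∈⁅y⁆⇒x≡y _ (Vec.lookup⇒[]= i _ h)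

subset-ext : ∀ {m} {X Y : Subset m} → (∀ i → mem i X ≡ mem i Y) → X ≡ Y
subset-ext {X = []}    {[]}    h = refl
subset-ext {X = x ∷ X} {y ∷ Y} h = cong₂ _∷_ (h Fin.zero) (subset-ext (h ∘ Fin.suc))

⊆ᵇ-intro : ∀ {m} (X Y : Subset m) → (∀ i → mem i X ≡ true → mem i Y ≡ true) → (X ⊆ᵇ Y) ≡ true
⊆ᵇ-intro []          []      h = refl
⊆ᵇ-intro (true  ∷ X) (y ∷ Y) h = ∧-intro (h Fin.zero refl) (⊆ᵇ-intro X Y (h ∘ Fin.suc))
⊆ᵇ-intro (false ∷ X) (y ∷ Y) h = ⊆ᵇ-intro X Y (h ∘ Fin.suc)

⊆ᵇ-elim : ∀ {m} (X Y : Subset m) → (X ⊆ᵇ Y) ≡ true → ∀ i → mem i X ≡ true → mem i Y ≡ true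
⊆ᵇ-elim (true ∷ X) (y ∷ Y) h Fin.zero    _ = proj₁ (∧-true h)
⊆ᵇ-elim (x ∷ X)    (y ∷ Y) h (Fin.suc i)   = ⊆ᵇ-elim X Y (proj₂ (∧-true {not x ∨ y} h)) i

⊆ᵇ-antisym : ∀ {m} (X Y : Subset m) → (X ⊆ᵇ Y) ≡ true → (Y ⊆ᵇ X) ≡ true → X ≡ Y
⊆ᵇ-antisym X Y p q = subset-ext (λ i → true⇔⇒≡ (⊆ᵇ-elim X Y p i) (⊆ᵇ-elim Y X q i))

⊆ᵇ-refl : ∀ {m} (X : Subset m) → (X ⊆ᵇ X) ≡ true
⊆ᵇ-refl X = ⊆ᵇ-intro X X (λ i → id)

⊥⊆ᵇ : ∀ {m} (X : Subset m) → (⊥ ⊆ᵇ X) ≡ true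
⊥⊆ᵇ X = ⊆ᵇ-intro ⊥ X (λ i h → case trans (sym h) (mem-⊥ i) of λ ())

=ᵇ-refl : ∀ {m} (X : Subset m) → (X =ᵇ X) ≡ true
=ᵇ-refl X = ∧-intro (⊆ᵇ-refl X) (⊆ᵇ-refl X)

=ᵇ⇒≡ : ∀ {m} (X Y : Subset m) → (X =ᵇ Y) ≡ true → X ≡ Y
=ᵇ⇒≡ X Y h = let p , q = ∧-true h in ⊆ᵇ-antisym X Y p q

=ᵇ-does : ∀ {m} (X Y : Subset m) → (X =ᵇ Y) ≡ Enumeration._==_ (subsetEnum m) X Y
=ᵇ-does {m} X Y = true⇔⇒≡ (λ h → S.≡⇒== (=ᵇ⇒≡ X Y h)) (λ h → subst (λ Z → (X =ᵇ Z) ≡ true) (S.==⇒≡ h) (=ᵇ-refl X))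
  where module S = Enumeration (subsetEnum m)

∣∣-mono : ∀ {m} (X Y : Subset m) → (X ⊆ᵇ Y) ≡ true → ∣ X ∣ ℕ.≤ ∣ Y ∣
∣∣-mono X Y h = Sub.p⊆q⇒∣p∣≤∣q∣ {p = X} {Y} (λ {i} i∈X → Vec.lookup⇒[]= i _ (⊆ᵇ-elim X Y h i (Vec.[]=⇒lookup i∈X)))

∣∣-strict : ∀ {m} (X Y : Subset m) → (X ⊆ᵇ Y) ≡ true → ¬ X ≡ Y → ∣ X ∣ ℕ.< ∣ Y ∣
∣∣-strict []          []          h X≢Y = contradiction refl X≢Y
∣∣-strict (true ∷ X)  (true ∷ Y)  h X≢Y = s≤s (∣∣-strict X Y h (X≢Y ∘ cong (true ∷_)))
∣∣-strict (false ∷ X) (false ∷ Y) h X≢Y = ∣∣-strict X Y h (X≢Y ∘ cong (false ∷_))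
∣∣-strict (false ∷ X) (true ∷ Y)  h X≢Y = s≤s (∣∣-mono X Y h)

allᵇ-intro : {A : Set} (p : A → Bool) (xs : List A) → (∀ x → p x ≡ true) → allᵇ p xs ≡ true
allᵇ-intro p []       h = refl
allᵇ-intro p (x ∷ xs) h = ∧-intro (h x) (allᵇ-intro p xs h)

allᵇ-elim : {A : Set} (p : A → Bool) (xs : List A) → allᵇ p xs ≡ true → ∀ {x} → x ∈ xs → p x ≡ true
allᵇ-elim p (x ∷ xs) h (here refl) = proj₁ (∧-true h)
allᵇ-elim p (x ∷ xs) h (there x∈)  = allᵇ-elim p xs (proj₂ (∧-true {p x} h)) x∈

<⇒<ᵇ-true : ∀ {a b} → a ℕ.< b → (a <ᵇ b) ≡ true
<⇒<ᵇ-true {a} {b} lt with a <ᵇ b | ℕ.<⇒<ᵇ lt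
... | true | _ = refl

<ᵇ-true⇒< : ∀ {a b} → (a <ᵇ b) ≡ true → a ℕ.< b
<ᵇ-true⇒< {a} {b} h = ℕ.<ᵇ⇒< a b (subst T (sym h) tt)

-- The Möbius function on the lattice of flats

module Flats {m : ℕ} (D : Subset m) (ρ : Subset m → ℕ) where
  open MatroidOps D ρ
  private
    module S = Enumeration (subsetEnum m)
    Ss = allSubsets m

  isFlat-intro : ∀ Y → (Y ⊆ᵇ D) ≡ true →
                 (∀ e → mem e D ≡ true → mem e Y ≡ false → ρ Y ℕ.< ρ (Y ∪ ⁅ e ⁆)) → isFlat Y ≡ true
  isFlat-intro Y Y⊆D grows = ∧-intro Y⊆D (allᵇ-intro _ (allFin m) each)
    where
    each : ∀ e → not (mem e D ∧ not (mem e Y)) ∨ (ρ Y <ᵇ ρ (Y ∪ ⁅ e ⁆)) ≡ true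
    each e with mem e D in eD | mem e Y in eY
    ... | false | _     = refl
    ... | true  | true  = refl
    ... | true  | false = <⇒<ᵇ-true (grows e eD eY)

  isFlat⇒⊆ : ∀ {Y} → isFlat Y ≡ true → (Y ⊆ᵇ D) ≡ true
  isFlat⇒⊆ = proj₁ ∘ ∧-true

  isFlat⇒grows : ∀ {Y} → isFlat Y ≡ true → ∀ e → mem e D ≡ true → mem e Y ≡ false → ρ Y ℕ.< ρ (Y ∪ ⁅ e ⁆)
  isFlat⇒grows {Y} h e eD eY = <ᵇ-true⇒< (subst₂ (λ a b → not (a ∧ not b) ∨ (ρ Y <ᵇ ρ (Y ∪ ⁅ e ⁆)) ≡ true) eD eY
    (allᵇ-elim _ (allFin m) (proj₂ (∧-true {Y ⊆ᵇ D} h)) (Mem.∈-allFin e)))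

  below : Subset m → Subset m → Subset m → Bool
  below X Y Z = (X ⊆ᵇ Z) ∧ (Z ⊆ᵇ Y) ∧ not (Z =ᵇ Y)

  lowerSum : ℕ → Subset m → Subset m → ℤ
  lowerSum f X Y = ∑ flats (λ Z → ⟦ below X Y Z ⟧ * mobF f X Z)

  mobF-suc : ∀ f X Y → mobF (suc f) X Y ≡
             (if X =ᵇ Y then 1ℤ else (if X ⊆ᵇ Y then - lowerSum f X Y else 0ℤ))
  mobF-suc f X Y = cong (λ s → if X =ᵇ Y then 1ℤ else (if X ⊆ᵇ Y then - s else 0ℤ))
    (trans (sumℤ-map (filterᵇ (below X Y) flats) (mobF f X)) (∑-filter (below X Y) flats (mobF f X)))

  mobF-self : ∀ f X → mobF f X X ≡ 1ℤ
  mobF-self zero    X rewrite =ᵇ-refl X = refl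
  mobF-self (suc f) X rewrite =ᵇ-refl X = refl

  below⇒< : ∀ {X Y Z} → below X Y Z ≡ true → ∣ Z ∣ ℕ.< ∣ Y ∣
  below⇒< {X} {Y} {Z} h with _ , q ← ∧-true {X ⊆ᵇ Z} h with p , r ← ∧-true {Z ⊆ᵇ Y} q =
    ∣∣-strict Z Y p (λ { refl → case trans (sym r) (cong not (=ᵇ-refl Z)) of λ () })

  -- Each recursive call goes to a flat of smaller cardinality, so the fuel never runs out before Y
  -- is empty, and nothing lies strictly below the empty set.
  mobF-fuel : ∀ f f′ X Y → ∣ Y ∣ ℕ.≤ f → ∣ Y ∣ ℕ.≤ f′ → mobF f X Y ≡ mobF f′ X Y
  mobF-fuel zero zero X Y _ _ = refl
  mobF-fuel zero (suc f′) X Y Y≤0 _ with X ⊆ᵇ Y in sub | Y ⊆ᵇ X in sup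
  ... | false | _     = refl
  ... | true  | true  = refl
  ... | true  | false = contradiction (ℕ.≤-trans Y≤0 z≤n)
    (ℕ.<⇒≱ (∣∣-strict X Y sub (λ { refl → case trans (sym sup) sub of λ () })))
  mobF-fuel (suc f) zero X Y p q = sym (mobF-fuel zero (suc f) X Y q p)
  mobF-fuel (suc f) (suc f′) X Y p q = trans (mobF-suc f X Y)
    (trans (cong (λ s → if X =ᵇ Y then 1ℤ else (if X ⊆ᵇ Y then - s else 0ℤ)) (∑-cong flats same))
           (sym (mobF-suc f′ X Y)))
    where
    same : ∀ Z → ⟦ below X Y Z ⟧ * mobF f X Z ≡ ⟦ below X Y Z ⟧ * mobF f′ X Z
    same Z with below X Y Z in eq
    ... | false = refl
    ... | true  = cong (1ℤ *_) (mobF-fuel f f′ X Z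
                    (ℕ.≤-pred (ℕ.≤-trans (below⇒< {X} {Y} {Z} eq) p)) (ℕ.≤-pred (ℕ.≤-trans (below⇒< {X} {Y} {Z} eq) q)))

  -- Unfolding consumes one unit of fuel; raising the fuel to m + 1 beforehand makes the recursion
  -- close up with μ on both sides.
  μ-strict : ∀ {X Y} → (X ⊆ᵇ Y) ≡ true → ¬ X ≡ Y → μ X Y ≡ - ∑ flats (λ Z → ⟦ below X Y Z ⟧ * μ X Z)
  μ-strict {X} {Y} X⊆Y X≢Y = trans (mobF-fuel m (suc m) X Y (Sub.∣p∣≤n Y) (ℕ.m≤n⇒m≤1+n (Sub.∣p∣≤n Y)))
    (trans (mobF-suc m X Y) (cong₂ (λ a b → if a then 1ℤ else (if b then - lowerSum m X Y else 0ℤ))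
      (¬true⇒false (X≢Y ∘ =ᵇ⇒≡ X Y)) X⊆Y))

  ∑-flats : (F : Subset m → ℤ) → ∑ flats F ≡ ∑ Ss (λ Y → ⟦ isFlat Y ⟧ * F Y)
  ∑-flats = ∑-filter isFlat Ss

  ∑-flats-cong : {F F′ : Subset m → ℤ} → (∀ Y → isFlat Y ≡ true → F Y ≡ F′ Y) → ∑ flats F ≡ ∑ flats F′
  ∑-flats-cong {F} {F′} h = trans (∑-flats F) (trans (∑-cong Ss same) (sym (∑-flats F′)))
    where
    same : ∀ Y → ⟦ isFlat Y ⟧ * F Y ≡ ⟦ isFlat Y ⟧ * F′ Y
    same Y with isFlat Y in eq
    ... | true  = cong (1ℤ *_) (h Y eq)
    ... | false = refl

  ∑-flats-pick : ∀ Y (F : Subset m → ℤ) → isFlat Y ≡ true → ∑ flats (λ Z → ⟦ Z =ᵇ Y ⟧ * F Z) ≡ F Y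
  ∑-flats-pick Y F Yflat = begin
    ∑ flats (λ Z → ⟦ Z =ᵇ Y ⟧ * F Z) ≡⟨ ∑-flats (λ Z → ⟦ Z =ᵇ Y ⟧ * F Z) ⟩
    ∑ Ss (λ Z → ⟦ isFlat Z ⟧ * (⟦ Z =ᵇ Y ⟧ * F Z)) ≡⟨ ∑-cong Ss (λ Z → cong (λ b → ⟦ isFlat Z ⟧ * (⟦ b ⟧ * F Z)) (=ᵇ-does Z Y)) ⟩
    ∑ Ss (λ Z → ⟦ isFlat Z ⟧ * (⟦ Z S.== Y ⟧ * F Z)) ≡⟨ ∑-cong Ss (λ Z → swap ⟦ isFlat Z ⟧ ⟦ Z S.== Y ⟧ (F Z)) ⟩
    ∑ Ss (λ Z → ⟦ Z S.== Y ⟧ * (⟦ isFlat Z ⟧ * F Z)) ≡⟨ S.∑-pick Y (λ Z → ⟦ isFlat Z ⟧ * F Z) ⟩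
    ⟦ isFlat Y ⟧ * F Y ≡⟨ cong (λ b → ⟦ b ⟧ * F Y) Yflat ⟩
    1ℤ * F Y ≡⟨ ℤ.*-identityˡ (F Y) ⟩
    F Y ∎
    where
    open ≡-Reasoning
    swap : ∀ a b c → a * (b * c) ≡ b * (a * c)
    swap = solve-∀

  -- This is the recursion that defines μ with its term Z = Y moved to the other side; only Y = ⊥
  -- has nothing to cancel.
  ∑-μ : isFlat ⊥ ≡ true → ∀ Y → isFlat Y ≡ true →
        ∑ flats (λ Z → ⟦ Z ⊆ᵇ Y ⟧ * μ ⊥ Z) ≡ ⟦ Y =ᵇ ⊥ ⟧
  ∑-μ ⊥flat Y Yflat = trans (∑-cong flats split) (trans (∑-+ flats (λ Z → ⟦ Z =ᵇ Y ⟧ * μ ⊥ Z) (λ Z → ⟦ below ⊥ Y Z ⟧ * μ ⊥ Z))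
      (trans (cong (_+ lower) (∑-flats-pick Y (μ ⊥) Yflat)) total))
    where
    lower : ℤ
    lower = ∑ flats (λ Z → ⟦ below ⊥ Y Z ⟧ * μ ⊥ Z)
    split : ∀ Z → ⟦ Z ⊆ᵇ Y ⟧ * μ ⊥ Z ≡ ⟦ Z =ᵇ Y ⟧ * μ ⊥ Z + ⟦ below ⊥ Y Z ⟧ * μ ⊥ Z
    split Z rewrite ⊥⊆ᵇ Z with Z ⊆ᵇ Y | Y ⊆ᵇ Z
    ... | true  | true  = sym (ℤ.+-identityʳ (1ℤ * μ ⊥ Z))
    ... | true  | false = sym (ℤ.+-identityˡ (1ℤ * μ ⊥ Z))
    ... | false | _     = refl
    total : μ ⊥ Y + lower ≡ ⟦ Y =ᵇ ⊥ ⟧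
    total with S._≟_ ⊥ Y
    ... | no ⊥≢Y = trans (cong (_+ lower) (μ-strict (⊥⊆ᵇ Y) ⊥≢Y))
                 (trans (ℤ.+-inverseˡ lower) (cong ⟦_⟧ (sym (¬true⇒false (⊥≢Y ∘ sym ∘ =ᵇ⇒≡ Y ⊥)))))
    ... | yes refl = trans (cong₂ _+_ (mobF-self m ⊥) (trans (∑-cong flats none) (∑-zero flats)))
                           (cong ⟦_⟧ (sym (=ᵇ-refl (⊥ {m}))))
      where
      none : ∀ Z → ⟦ below ⊥ ⊥ Z ⟧ * μ ⊥ Z ≡ 0ℤ
      none Z with below ⊥ ⊥ Z in eq
      ... | false = refl
      ... | true  = contradiction (below⇒< {⊥} {⊥} {Z} eq) (ℕ.≤⇒≯ (∣∣-mono ⊥ Z (⊥⊆ᵇ Z)))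

-- Matroids whose rank is read off from numbers of points

pos-^ : ∀ t n → pos (t ℕ.^ n) ≡ pos t ^ n
pos-^ t zero    = refl
pos-^ t (suc n) = trans (ℤ.pos-* t (t ℕ.^ n)) (cong (pos t *_) (pos-^ t n))

^-cancel-≤ : ∀ t a b → 1 ℕ.< t → t ℕ.^ a ℕ.≤ t ℕ.^ b → a ℕ.≤ b
^-cancel-≤ t a b 1<t h = ℕ.≮⇒≥ (λ b<a → ℕ.<⇒≱ (ℕ.^-monoʳ-< t 1<t b<a) h)

^-cancel-< : ∀ t a b → 1 ℕ.< t → t ℕ.^ a ℕ.< t ℕ.^ b → a ℕ.< b
^-cancel-< (suc t) a b 1<t h = ℕ.≰⇒> (λ b≤a → ℕ.<⇒≱ h (ℕ.^-monoʳ-≤ (suc t) b≤a))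

∸-reflects-≤ : ∀ {R a b} → a ℕ.≤ R → R ∸ b ℕ.≤ R ∸ a → a ℕ.≤ b
∸-reflects-≤ a≤R h = ℕ.≮⇒≥ (λ b<a → ℕ.<⇒≱ (ℕ.∸-monoʳ-< b<a a≤R) h)

-- Here `sat ω` is the set of hyperplanes through the point ω, and `count` says that the points
-- common to S number t to the power of its corank. Monotonicity of `rk` and the flats used below
-- all come from comparing such numbers.
module Realization {m : ℕ} (rk : Subset m → ℕ) (R : ℕ) (rk≤R : ∀ S → rk S ℕ.≤ R)
  {Ω : Set} (eΩ : Enumeration Ω) (sat : Ω → Subset m) (t : ℕ) (1<t : 1 ℕ.< t)
  (count : ∀ S → ∑ (elements eΩ) (λ ω → ⟦ S ⊆ᵇ sat ω ⟧) ≡ pos (t ℕ.^ (R ∸ rk S))) where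

  private
    ωs = elements eΩ
    module Ω = Enumeration eΩ

  rk-mono : ∀ S S′ → (∀ ω → (S′ ⊆ᵇ sat ω) ≡ true → (S ⊆ᵇ sat ω) ≡ true) → rk S ℕ.≤ rk S′
  rk-mono S S′ h = ∸-reflects-≤ (rk≤R S) (^-cancel-≤ t (R ∸ rk S′) (R ∸ rk S) 1<t
    (ℤ.drop‿+≤+ (subst₂ ℤ._≤_ (count S′) (count S) (∑-mono ωs (λ ω → ⟦⟧-mono (h ω))))))

  rk-⊆ : ∀ S S′ → (∀ i → mem i S ≡ true → mem i S′ ≡ true) → rk S ℕ.≤ rk S′
  rk-⊆ S S′ h = rk-mono S S′ (λ ω S′⊆ → ⊆ᵇ-intro S (sat ω) (λ i → ⊆ᵇ-elim S′ (sat ω) S′⊆ i ∘ h i))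

  -- The point ω is lost in passing from S to S′, so strictly fewer points remain and the corank
  -- must drop.
  rk-strict : ∀ S S′ → (∀ i → mem i S ≡ true → mem i S′ ≡ true) →
              ∀ ω → (S ⊆ᵇ sat ω) ≡ true → (S′ ⊆ᵇ sat ω) ≡ false → rk S ℕ.< rk S′
  rk-strict S S′ h ω S⊆ S′⊈ = ℕ.≰⇒> (λ le → ℕ.<⇒≱
    (^-cancel-< t (R ∸ rk S′) (R ∸ rk S) 1<t
      (ℤ.drop‿+<+ (subst₂ ℤ._<_ (count S′) (count S)
        (Ω.∑-strict (λ ω → ⟦⟧-mono (λ S′⊆ → ⊆ᵇ-intro S (sat ω) (λ i → ⊆ᵇ-elim S′ (sat ω) S′⊆ i ∘ h i)))
          ω (subst₂ (λ a b → ⟦ a ⟧ ℤ.< ⟦ b ⟧) (sym S′⊈) (sym S⊆) (ℤ.+<+ (s≤s z≤n)))))))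
    (ℕ.∸-monoʳ-≤ R le))

  rk-sat-∪ : ∀ ω Y e → mem e (sat ω) ≡ false → (∀ i → mem i (sat ω) ≡ true → mem i Y ≡ true) →
             mem e Y ≡ true → rk (sat ω) ℕ.< rk Y
  rk-sat-∪ ω Y e e∉ sub e∈ = rk-strict (sat ω) Y sub ω (⊆ᵇ-refl (sat ω))
    (¬true⇒false (λ h → case trans (sym e∉) (⊆ᵇ-elim Y (sat ω) h e e∈) of λ ()))

  sat-isFlat : ∀ ω → MatroidOps.isFlat ⊤ rk (sat ω) ≡ true
  sat-isFlat ω = Flats.isFlat-intro ⊤ rk (sat ω) (⊆ᵇ-intro (sat ω) ⊤ (λ i _ → mem-⊤ i))
    (λ e _ e∉ → rk-sat-∪ ω (sat ω ∪ ⁅ e ⁆) e e∉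
      (λ i i∈ → trans (mem-∪ (sat ω) ⁅ e ⁆ i) (∨-introˡ i∈))
      (trans (mem-∪ (sat ω) ⁅ e ⁆ e) (∨-introʳ (mem-⁅⁆ e))))

  -- The ground set and rank are those in `charPolyContr`, so everything proved about `charPoly`
  -- here speaks of χ(M/X) by definition.
  module Contraction (ω₀ : Ω) where
    X = sat ω₀
    D = ∁ X
    ρ : Subset m → ℕ
    ρ Y = rk (Y ∪ X) ∸ rk X
    open MatroidOps D ρ
    open Flats D ρ

    X⊆∪ : ∀ Y i → mem i X ≡ true → mem i (Y ∪ X) ≡ true
    X⊆∪ Y i h = trans (mem-∪ Y X i) (∨-introʳ h)

    rkX≤ : ∀ Y → rk X ℕ.≤ rk (Y ∪ X)
    rkX≤ Y = rk-⊆ X (Y ∪ X) (X⊆∪ Y)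

    ρD≤R : ρ D ℕ.≤ R
    ρD≤R = ℕ.≤-trans (ℕ.m∸n≤m (rk (D ∪ X)) (rk X)) (rk≤R (D ∪ X))

    ⊥∪X : ⊥ ∪ X ≡ X
    ⊥∪X = Sub.∪-identityˡ X

    D∪X : D ∪ X ≡ ⊤
    D∪X = subset-ext (λ i → trans (mem-∪ D X i) (trans (cong (_∨ mem i X) (mem-∁ X i)) (trans (or (mem i X)) (sym (mem-⊤ i)))))
      where
      or : ∀ b → not b ∨ b ≡ true
      or true  = refl
      or false = refl

    rest : Ω → Subset m
    rest ω = sat ω Sub.∩ D

    mem-rest : ∀ ω i → mem i (rest ω) ≡ mem i (sat ω) ∧ mem i D
    mem-rest ω i = Vec.lookup-zipWith _∧_ i (sat ω) D

    rest∪X : ∀ ω → (X ⊆ᵇ sat ω) ≡ true → rest ω ∪ X ≡ sat ω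
    rest∪X ω X⊆ = subset-ext (λ i → trans (mem-∪ (rest ω) X i)
      (trans (cong (_∨ mem i X) (trans (mem-rest ω i) (cong (mem i (sat ω) ∧_) (mem-∁ X i))))
             (bool (mem i (sat ω)) (mem i X) (⊆ᵇ-elim X (sat ω) X⊆ i))))
      where
      bool : ∀ s x → (x ≡ true → s ≡ true) → (s ∧ not x) ∨ x ≡ s
      bool true  true  h = refl
      bool true  false h = refl
      bool false true  h = sym (h refl)
      bool false false h = refl

    rest-isFlat : ∀ ω → (X ⊆ᵇ sat ω) ≡ true → isFlat (rest ω) ≡ true
    rest-isFlat ω X⊆ = isFlat-intro (rest ω)
      (⊆ᵇ-intro (rest ω) D (λ i h → proj₂ (∧-true {mem i (sat ω)} (trans (sym (mem-rest ω i)) h))))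
      (λ e e∈D e∉ → ℕ.∸-monoˡ-< (subst (λ Z → rk Z ℕ.< rk ((rest ω ∪ ⁅ e ⁆) ∪ X)) (sym (rest∪X ω X⊆)) (grows e e∈D e∉)) (rkX≤ (rest ω)))
      where
      grows : ∀ e → mem e D ≡ true → mem e (rest ω) ≡ false → rk (sat ω) ℕ.< rk ((rest ω ∪ ⁅ e ⁆) ∪ X)
      grows e e∈D e∉ = rk-sat-∪ ω ((rest ω ∪ ⁅ e ⁆) ∪ X) e
        (¬true⇒false (λ h → case trans (sym e∉) (trans (mem-rest ω e) (∧-intro h e∈D)) of λ ()))
        (λ i h → trans (mem-∪ (rest ω ∪ ⁅ e ⁆) X i) (trans (cong (_∨ mem i X) (mem-∪ (rest ω) ⁅ e ⁆ i))
          (case ∨-true {mem i (rest ω)} (trans (sym (mem-∪ (rest ω) X i)) (trans (cong (mem i) (rest∪X ω X⊆)) h)) of λ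
            { (inj₁ p) → ∨-introˡ (∨-introˡ p) ; (inj₂ q) → ∨-introʳ q })))
        (trans (mem-∪ (rest ω ∪ ⁅ e ⁆) X e) (∨-introˡ (trans (mem-∪ (rest ω) ⁅ e ⁆ e) (∨-introʳ (mem-⁅⁆ e)))))

    rest₀ : rest ω₀ ≡ ⊥
    rest₀ = subset-ext (λ i → trans (mem-rest ω₀ i) (trans (cong (mem i X ∧_) (mem-∁ X i)) (trans (and (mem i X)) (sym (mem-⊥ i)))))
      where
      and : ∀ b → b ∧ not b ≡ false
      and true  = refl
      and false = refl

    ⊥-isFlat : isFlat ⊥ ≡ true
    ⊥-isFlat = subst (λ Z → isFlat Z ≡ true) rest₀ (rest-isFlat ω₀ (⊆ᵇ-refl X))

    -- X is a flat, so each further element raises the rank and the contraction has no loops.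
    bottom≡⊥ : bottom ≡ ⊥
    bottom≡⊥ = subset-ext (λ e → trans (Vec.lookup∘tabulate _ e) (trans (no-loop e) (sym (mem-⊥ e))))
      where
      no-loop : ∀ e → mem e D ∧ (ρ ⁅ e ⁆ ≡ᵇ ρ ⊥) ≡ false
      no-loop e with mem e D in e∈D
      ... | false = refl
      ... | true  = ¬true⇒false (λ h → ℕ.<-irrefl
        (sym (ℕ.≡ᵇ⇒≡ (ρ ⁅ e ⁆) (ρ ⊥) (subst T (sym h) tt)))
        (subst (λ Z → ρ ⊥ ℕ.< ρ Z) (Sub.∪-identityˡ ⁅ e ⁆) (isFlat⇒grows {⊥} ⊥-isFlat e e∈D (mem-⊥ e))))

    -- The corank of Y in the contraction and the surplus of R over the full rank add up to the
    -- corank of Y ∪ X, which is the exponent in `count`.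
    exponent : ∀ Y → (R ∸ rk ⊤) ℕ.+ (ρ D ∸ ρ Y) ≡ R ∸ rk (Y ∪ X)
    exponent Y rewrite D∪X = begin
      (R ∸ c) ℕ.+ ((c ∸ a) ∸ (b ∸ a)) ≡⟨ cong ((R ∸ c) ℕ.+_) (ℕ.∸-+-assoc c a (b ∸ a)) ⟩
      (R ∸ c) ℕ.+ (c ∸ (a ℕ.+ (b ∸ a))) ≡⟨ cong (λ s → (R ∸ c) ℕ.+ (c ∸ s)) (ℕ.m+[n∸m]≡n (rkX≤ Y)) ⟩
      (R ∸ c) ℕ.+ (c ∸ b) ≡⟨ sym (ℕ.+-∸-assoc (R ∸ c) b≤c) ⟩
      (R ∸ c) ℕ.+ c ∸ b ≡⟨ cong (_∸ b) (ℕ.m∸n+n≡m (rk≤R ⊤)) ⟩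
      R ∸ b ∎
      where
      open ≡-Reasoning
      a = rk X
      b = rk (Y ∪ X)
      c = rk ⊤
      b≤c : b ℕ.≤ c
      b≤c = rk-⊆ (Y ∪ X) ⊤ (λ i _ → mem-⊤ i)

    charPoly-flats : ∀ d → charPoly d ≡ ∑ flats (λ Y → if (ρ D ∸ ρ Y) ≡ᵇ d then μ ⊥ Y else 0ℤ)
    charPoly-flats d = trans (sumℤ-map flats _)
      (cong (λ b → ∑ flats (λ Y → if (ρ D ∸ ρ Y) ≡ᵇ d then μ b Y else 0ℤ)) bottom≡⊥)

    charPoly-high : ∀ d → ρ D ℕ.< d → charPoly d ≡ 0ℤ
    charPoly-high d lt = trans (charPoly-flats d) (trans (∑-cong flats vanish) (∑-zero flats))
      where
      vanish : ∀ Y → (if (ρ D ∸ ρ Y) ≡ᵇ d then μ ⊥ Y else 0ℤ) ≡ 0ℤ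
      vanish Y with (ρ D ∸ ρ Y) ≡ᵇ d in eq
      ... | false = refl
      ... | true  = contradiction
        (ℕ.<-≤-trans lt (subst (ℕ._≤ ρ D) (ℕ.≡ᵇ⇒≡ (ρ D ∸ ρ Y) d (subst T (sym eq) tt)) (ℕ.m∸n≤m (ρ D) (ρ Y))))
        (ℕ.<-irrefl refl)

    -- If ω misses a hyperplane of X, both sides vanish. Otherwise the flats Y that contribute are
    -- those contained in `rest ω`, itself a flat of the contraction, and their Möbius sum is 1
    -- exactly when `rest ω` is empty.
    μ-count : ∀ ω → ∑ flats (λ Y → μ ⊥ Y * ⟦ (Y ∪ X) ⊆ᵇ sat ω ⟧) ≡ ⟦ sat ω =ᵇ X ⟧
    μ-count ω = cases (X ⊆ᵇ sat ω) refl
     where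
     cases : ∀ b → (X ⊆ᵇ sat ω) ≡ b → ∑ flats (λ Y → μ ⊥ Y * ⟦ (Y ∪ X) ⊆ᵇ sat ω ⟧) ≡ ⟦ sat ω =ᵇ X ⟧
     cases false X⊆ = trans (∑-cong flats none) (trans (∑-zero flats)
          (cong ⟦_⟧ (sym (¬true⇒false {sat ω =ᵇ X} (λ h → case trans (sym X⊆) (proj₂ (∧-true {sat ω ⊆ᵇ X} h)) of λ ())))))
      where
      none : ∀ Y → μ ⊥ Y * ⟦ (Y ∪ X) ⊆ᵇ sat ω ⟧ ≡ 0ℤ
      none Y = trans (cong (λ b → μ ⊥ Y * ⟦ b ⟧) (¬true⇒false (λ h →
        case trans (sym X⊆) (⊆ᵇ-intro X (sat ω) (λ i → ⊆ᵇ-elim (Y ∪ X) (sat ω) h i ∘ X⊆∪ Y i)) of λ ())))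
        (ℤ.*-zeroʳ (μ ⊥ Y))
     cases true X⊆ = trans (∑-flats-cong step) (trans (∑-μ ⊥-isFlat (rest ω) (rest-isFlat ω X⊆)) (cong ⟦_⟧ closed))
      where
      same : ∀ Y → isFlat Y ≡ true → ((Y ∪ X) ⊆ᵇ sat ω) ≡ (Y ⊆ᵇ rest ω)
      same Y Yflat = true⇔⇒≡
        (λ h → ⊆ᵇ-intro Y (rest ω) (λ i i∈ → trans (mem-rest ω i)
          (∧-intro (⊆ᵇ-elim (Y ∪ X) (sat ω) h i (trans (mem-∪ Y X i) (∨-introˡ i∈))) (⊆ᵇ-elim Y D (isFlat⇒⊆ {Y} Yflat) i i∈))))
        (λ h → ⊆ᵇ-intro (Y ∪ X) (sat ω) (λ i i∈ → case ∨-true {mem i Y} (trans (sym (mem-∪ Y X i)) i∈) of λ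
          { (inj₁ p) → proj₁ (∧-true (trans (sym (mem-rest ω i)) (⊆ᵇ-elim Y (rest ω) h i p)))
          ; (inj₂ q) → ⊆ᵇ-elim X (sat ω) X⊆ i q }))
      step : ∀ Y → isFlat Y ≡ true → μ ⊥ Y * ⟦ (Y ∪ X) ⊆ᵇ sat ω ⟧ ≡ ⟦ Y ⊆ᵇ rest ω ⟧ * μ ⊥ Y
      step Y Yflat = trans (cong (λ b → μ ⊥ Y * ⟦ b ⟧) (same Y Yflat)) (ℤ.*-comm (μ ⊥ Y) ⟦ Y ⊆ᵇ rest ω ⟧)
      closed : (rest ω =ᵇ ⊥) ≡ (sat ω =ᵇ X)
      closed = true⇔⇒≡
        (λ h → subst (λ Z → (Z =ᵇ X) ≡ true)
          (trans (sym (trans (cong (_∪ X) (=ᵇ⇒≡ (rest ω) ⊥ h)) ⊥∪X)) (rest∪X ω X⊆)) (=ᵇ-refl X))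
        (λ h → subst (λ Z → (Z =ᵇ ⊥) ≡ true) (sym (trans (cong (Sub._∩ D) (=ᵇ⇒≡ (sat ω) X h)) rest₀)) (=ᵇ-refl (⊥ {m})))

    -- Möbius inversion over the flats, exchanged with the sum over points.
    charPoly-count : ∀ n → ρ D ℕ.≤ n →
      pos (t ℕ.^ (R ∸ rk ⊤)) * evalPoly charPoly n (pos t) ≡ ∑ ωs (λ ω → ⟦ sat ω =ᵇ X ⟧)
    charPoly-count n ρD≤n = begin
      u * evalPoly charPoly n (pos t)
        ≡⟨ cong (u *_) (evalPoly-cong n (pos t) charPoly-flats) ⟩
      u * evalPoly (λ d → ∑ flats (λ Y → if (ρ D ∸ ρ Y) ≡ᵇ d then μ ⊥ Y else 0ℤ)) n (pos t)
        ≡⟨ cong (u *_) (evalPoly-∑ flats (λ Y d → if (ρ D ∸ ρ Y) ≡ᵇ d then μ ⊥ Y else 0ℤ) n (pos t)) ⟩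
      u * ∑ flats (λ Y → evalPoly (λ d → if (ρ D ∸ ρ Y) ≡ᵇ d then μ ⊥ Y else 0ℤ) n (pos t))
        ≡⟨ cong (u *_) (∑-cong flats (λ Y → evalPoly-monomial (ρ D ∸ ρ Y) (μ ⊥ Y) n (pos t) (ℕ.≤-trans (ℕ.m∸n≤m (ρ D) (ρ Y)) ρD≤n))) ⟩
      u * ∑ flats (λ Y → μ ⊥ Y * pos t ^ (ρ D ∸ ρ Y))
        ≡⟨ sym (∑-*ˡ flats u _) ⟩
      ∑ flats (λ Y → u * (μ ⊥ Y * pos t ^ (ρ D ∸ ρ Y)))
        ≡⟨ ∑-cong flats (λ Y → trans (swap u (μ ⊥ Y) (pos t ^ (ρ D ∸ ρ Y))) (cong (μ ⊥ Y *_) (points Y))) ⟩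
      ∑ flats (λ Y → μ ⊥ Y * ∑ ωs (λ ω → ⟦ (Y ∪ X) ⊆ᵇ sat ω ⟧))
        ≡⟨ ∑-cong flats (λ Y → sym (∑-*ˡ ωs (μ ⊥ Y) _)) ⟩
      ∑ flats (λ Y → ∑ ωs (λ ω → μ ⊥ Y * ⟦ (Y ∪ X) ⊆ᵇ sat ω ⟧))
        ≡⟨ ∑-swap flats ωs (λ Y ω → μ ⊥ Y * ⟦ (Y ∪ X) ⊆ᵇ sat ω ⟧) ⟩
      ∑ ωs (λ ω → ∑ flats (λ Y → μ ⊥ Y * ⟦ (Y ∪ X) ⊆ᵇ sat ω ⟧))
        ≡⟨ ∑-cong ωs μ-count ⟩
      ∑ ωs (λ ω → ⟦ sat ω =ᵇ X ⟧) ∎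
      where
      open ≡-Reasoning
      u = pos (t ℕ.^ (R ∸ rk ⊤))
      swap : ∀ a b c → a * (b * c) ≡ b * (a * c)
      swap = solve-∀
      points : ∀ Y → u * pos t ^ (ρ D ∸ ρ Y) ≡ ∑ ωs (λ ω → ⟦ (Y ∪ X) ⊆ᵇ sat ω ⟧)
      points Y = begin
        u * pos t ^ (ρ D ∸ ρ Y) ≡⟨ cong (u *_) (sym (pos-^ t (ρ D ∸ ρ Y))) ⟩
        u * pos (t ℕ.^ (ρ D ∸ ρ Y)) ≡⟨ sym (ℤ.pos-* (t ℕ.^ (R ∸ rk ⊤)) (t ℕ.^ (ρ D ∸ ρ Y))) ⟩
        pos (t ℕ.^ (R ∸ rk ⊤) ℕ.* t ℕ.^ (ρ D ∸ ρ Y)) ≡⟨ cong pos (sym (ℕ.^-distribˡ-+-* t (R ∸ rk ⊤) (ρ D ∸ ρ Y))) ⟩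
        pos (t ℕ.^ ((R ∸ rk ⊤) ℕ.+ (ρ D ∸ ρ Y))) ≡⟨ cong (λ e → pos (t ℕ.^ e)) (exponent Y) ⟩
        pos (t ℕ.^ (R ∸ rk (Y ∪ X))) ≡⟨ sym (count (Y ∪ X)) ⟩
        ∑ ωs (λ ω → ⟦ (Y ∪ X) ⊆ᵇ sat ω ⟧) ∎

-- Divisional flags built step by step

module _ {m : ℕ} (rk : Subset m → ℕ) where

  -- The part of a divisional flag from the flat X of rank i up to the whole set; this form lets the
  -- flag grow along a chain of contractions.
  data Flag : ℕ → Subset m → Set where
    top    : ∀ {i} → rk ⊤ ≡ i → MatroidOps.isFlat ⊤ rk ⊤ ≡ true → Flag i ⊤
    extend : ∀ {i} X {Y} → rk X ≡ i → MatroidOps.isFlat ⊤ rk X ≡ true → (X ⊆ᵇ Y) ≡ true →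
             PolyDivides (charPolyContr rk Y) (charPolyContr rk X) → Flag (suc i) Y → Flag i X

  level : ∀ {i X} → Flag i X → ℕ → Subset m
  level (top _ _)              j       = ⊤
  level (extend X _ _ _ _ f)   zero    = X
  level (extend X _ _ _ _ f)   (suc j) = level f j

  level-zero : ∀ {i X} (f : Flag i X) → level f 0 ≡ X
  level-zero (top _ _)            = refl
  level-zero (extend X _ _ _ _ f) = refl

  shift≤ : ∀ i j {n} → i ℕ.+ suc j ℕ.≤ n → suc i ℕ.+ j ℕ.≤ n
  shift≤ i j {n} = subst (ℕ._≤ n) (ℕ.+-suc i j)

  beyond : ∀ {i j n} → n ≡ i → ¬ i ℕ.+ suc j ℕ.≤ n
  beyond {i} {j} refl h = ℕ.<⇒≱ (ℕ.m<m+n i {suc j} (s≤s z≤n)) h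

  level-top : ∀ {i X} (f : Flag i X) j → i ℕ.+ j ≡ rk ⊤ → level f j ≡ ⊤
  level-top (top _ _)            j e = refl
  -- An `extend` cannot occur at rank `rk ⊤`: the remaining flag would start above the rank at which
  -- it has to end.
  level-top {i} (extend X r _ _ _ f) zero e = below-top f (trans (sym e) (ℕ.+-identityʳ i))
    where
    below-top : ∀ {i Y} → Flag (suc i) Y → rk ⊤ ≡ i → X ≡ ⊤
    below-top f e = contradiction (bound f) (λ le → ℕ.<-irrefl (sym e) le)
      where
      bound : ∀ {i Y} → Flag i Y → i ℕ.≤ rk ⊤
      bound (top e _)            = ℕ.≤-reflexive (sym e)
      bound (extend _ _ _ _ _ f) = ℕ.≤-trans (ℕ.n≤1+n _) (bound f)
  level-top {i} (extend X _ _ _ _ f) (suc j) e = level-top f j (trans (sym (ℕ.+-suc i j)) e)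

  level-flat : ∀ {i X} (f : Flag i X) j → i ℕ.+ j ℕ.≤ rk ⊤ → MatroidOps.isFlat ⊤ rk (level f j) ≡ true
  level-flat (top _ fl)             j       h = fl
  level-flat (extend X _ fl _ _ f)  zero    h = fl
  level-flat {i} (extend X _ _ _ _ f) (suc j) h = level-flat f j (shift≤ i j h)

  level-rank : ∀ {i X} (f : Flag i X) j → i ℕ.+ j ℕ.≤ rk ⊤ → rk (level f j) ≡ i ℕ.+ j
  level-rank {i} (top e _)            zero    h = trans e (sym (ℕ.+-identityʳ i))
  level-rank {i} (top e _)            (suc j) h = contradiction h (beyond e)
  level-rank {i} (extend X r _ _ _ f) zero    h = trans r (sym (ℕ.+-identityʳ i))
  level-rank {i} (extend X _ _ _ _ f) (suc j) h = trans (level-rank f j (shift≤ i j h)) (sym (ℕ.+-suc i j))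

  level-chain : ∀ {i X} (f : Flag i X) j → i ℕ.+ j ℕ.< rk ⊤ → (level f j ⊆ᵇ level f (suc j)) ≡ true
  level-chain {i} (top e _) j h = ⊆ᵇ-refl (⊤ {m})
  level-chain {i} (extend X {Y} _ _ c _ f) zero h = subst (λ Z → (X ⊆ᵇ Z) ≡ true) (sym (level-zero f)) c
  level-chain {i} (extend X _ _ _ _ f) (suc j) h = level-chain f j (subst (ℕ._< rk ⊤) (ℕ.+-suc i j) h)

  level-div : ∀ {i X} (f : Flag i X) j → i ℕ.+ j ℕ.< rk ⊤ →
              PolyDivides (charPolyContr rk (level f (suc j))) (charPolyContr rk (level f j))
  level-div {i} (top e _) j h = contradiction (ℕ.≤-<-trans (ℕ.m≤m+n i j) h) (λ lt → ℕ.<-irrefl (sym e) lt)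
  level-div {i} (extend X {Y} _ _ _ d f) zero h = subst (λ Z → PolyDivides (charPolyContr rk Z) (charPolyContr rk X)) (sym (level-zero f)) d
  level-div {i} (extend X _ _ _ _ f) (suc j) h = level-div f j (subst (ℕ._< rk ⊤) (ℕ.+-suc i j) h)

  toDivisionalFlag : Flag 0 ⊥ → DivisionalFlag rk
  toDivisionalFlag f = record
    { X = level f ; X₀ = level-zero f ; Xₙ = level-top f (rk ⊤) refl
    ; flat = level-flat f ; chain = level-chain f ; rank = level-rank f ; div = level-div f }

-- Colourings of gain graphs

module Averaging {C : Set} (eC : Enumeration C) where

  size : ℤ
  size = pos (length (elements eC))

  ∑-one : ∑ (elements eC) (λ _ → 1ℤ) ≡ size
  ∑-one = trans (∑-const (elements eC) 1ℤ) (ℤ.*-identityʳ size)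

  -- (x , c) ↦ (x [ w ]≔ c , x w) is an involution.
  ∑-average : ∀ {n} (w : Fin n) (F : Vec C n → ℤ) →
    ∑ (vecs (elements eC) n) (λ x → ∑ (elements eC) (λ c → F (x [ w ]≔ c))) ≡
    size * ∑ (vecs (elements eC) n) F
  ∑-average {n} w F = begin
    ∑ xs (λ x → ∑ cs (λ c → F (x [ w ]≔ c))) ≡⟨ sym (∑-product xs cs (λ { (x , c) → F (x [ w ]≔ c) })) ⟩
    ∑ (elements pairs) (F ∘ proj₁ ∘ swap) ≡⟨ Enumeration.∑-reindex pairs swap swap swap-swap swap-swap (F ∘ proj₁) ⟩
    ∑ (elements pairs) (F ∘ proj₁) ≡⟨ ∑-product xs cs (F ∘ proj₁) ⟩
    ∑ xs (λ x → ∑ cs (λ _ → F x)) ≡⟨ ∑-cong xs (λ x → ∑-const cs (F x)) ⟩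
    ∑ xs (λ x → size * F x) ≡⟨ ∑-*ˡ xs size F ⟩
    size * ∑ xs F ∎
    where
    open ≡-Reasoning
    xs = vecs (elements eC) n
    cs = elements eC
    pairs = productEnum (vecEnum eC n) eC
    swap : Vec C n × C → Vec C n × C
    swap (x , c) = (x [ w ]≔ c) , lookup x w
    swap-swap : ∀ p → swap (swap p) ≡ p
    swap-swap (x , c) = cong₂ _,_
      (trans (Vec.[]≔-idempotent x w) (Vec.[]≔-lookup x w)) (Vec.lookup∘updateAt w x)

allᵇ-intro-∈ : {A : Set} (p : A → Bool) (xs : List A) → (∀ {x} → x ∈ xs → p x ≡ true) → allᵇ p xs ≡ true
allᵇ-intro-∈ p []       h = refl
allᵇ-intro-∈ p (x ∷ xs) h = ∧-intro (h (here refl)) (allᵇ-intro-∈ p xs (h ∘ there))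

allᵇ-++ : {A : Set} (p : A → Bool) (xs ys : List A) → allᵇ p (xs ++ ys) ≡ allᵇ p xs ∧ allᵇ p ys
allᵇ-++ p []       ys = refl
allᵇ-++ p (x ∷ xs) ys = trans (cong (p x ∧_) (allᵇ-++ p xs ys)) (sym (Bool.∧-assoc (p x) _ _))

allᵇ-map : {A B : Set} (p : B → Bool) (f : A → B) (xs : List A) → allᵇ p (map f xs) ≡ allᵇ (p ∘ f) xs
allᵇ-map p f []       = refl
allᵇ-map p f (x ∷ xs) = cong (p (f x) ∧_) (allᵇ-map p f xs)

allᵇ-cong-∈ : {A : Set} {p q : A → Bool} (xs : List A) → (∀ {x} → x ∈ xs → p x ≡ q x) → allᵇ p xs ≡ allᵇ q xs
allᵇ-cong-∈ []       h = refl
allᵇ-cong-∈ (x ∷ xs) h = cong₂ _∧_ (h (here refl)) (allᵇ-cong-∈ xs (h ∘ there))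

AllPairs-map-∈ : {A B : Set} (f : A → B) (xs : List A) → AllPairs _≢_ xs →
                 (∀ {x y} → x ∈ xs → y ∈ xs → x ≢ y → f x ≢ f y) → AllPairs _≢_ (map f xs)
AllPairs-map-∈ f [] [] h = []
AllPairs-map-∈ f (x ∷ xs) (x≢ ∷ u) h =
  heads xs x≢ there ∷ AllPairs-map-∈ f xs u (λ x∈ y∈ → h (there x∈) (there y∈))
  where
  heads : ∀ ys → All (x ≢_) ys → (∀ {y} → y ∈ ys → y ∈ x ∷ xs) → All (f x ≢_) (map f ys)
  heads []       []        sub = []
  heads (y ∷ ys) (ne ∷ nes) sub = h (here refl) (sub (here refl)) ne ∷ heads ys nes (sub ∘ there)

≡true⇒T : ∀ {b} → b ≡ true → T b
≡true⇒T refl = tt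

T⇒≡true : ∀ {b} → T b → b ≡ true
T⇒≡true {true} _ = refl

∈-filterᵇ : {A : Set} (p : A → Bool) {xs : List A} {x : A} → x ∈ xs → p x ≡ true → x ∈ filterᵇ p xs
∈-filterᵇ p x∈ px = Mem.∈-filter⁺ (Bool.T? ∘ p) x∈ (≡true⇒T px)

∈-filterᵇ⁻ : {A : Set} (p : A → Bool) {xs : List A} {x : A} → x ∈ filterᵇ p xs → p x ≡ true
∈-filterᵇ⁻ p {xs} x∈ = T⇒≡true (proj₂ (Mem.∈-filter⁻ (Bool.T? ∘ p) {xs = xs} x∈))

allPairs : ∀ n k → List (Fin n × Fin k)
allPairs n k = cartesianProduct (allFin n) (allFin k)

∈-allPairs : ∀ {n k} (s : Fin n × Fin k) → s ∈ allPairs n k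
∈-allPairs (j , b) = Mem.∈-cartesianProduct⁺ (Mem.∈-allFin j) (Mem.∈-allFin b)

selectPairs : ∀ {n k} → (Fin n × Fin k → Bool) → List (Fin n × Fin k)
selectPairs {n} {k} p = filterᵇ p (allPairs n k)

selectPairs-unique : ∀ {n k} (p : Fin n × Fin k → Bool) → AllPairs _≢_ (selectPairs p)
selectPairs-unique {n} {k} p = Unique.filter⁺ (Bool.T? ∘ p) (Unique.cartesianProduct⁺ (Unique.allFin⁺ n) (Unique.allFin⁺ k))

length-product : {A B : Set} (xs : List A) (ys : List B) → length (cartesianProduct xs ys) ≡ length xs ℕ.* length ys
length-product []       ys = refl
length-product (x ∷ xs) ys = trans (List.length-++ (map (x ,_) ys)) (cong₂ ℕ._+_ (List.length-map (x ,_) ys) (length-product xs ys))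

length-allFin : ∀ n → length (allFin n) ≡ n
length-allFin n = List.length-tabulate {n = n} id

selectPairs-length : ∀ {n k} (p : Fin n × Fin k → Bool) → length (selectPairs p) ℕ.≤ n ℕ.* k
selectPairs-length {n} {k} p = ℕ.≤-trans (List.length-filter (Bool.T? ∘ p) (allPairs n k))
  (ℕ.≤-reflexive (trans (length-product (allFin n) (allFin k))
    (cong₂ ℕ._*_ (length-allFin n) (length-allFin k))))

-- Gain groups, relabellings and palettes

module Gains {k : ℕ} (_⊕_ : Fin k → Fin k → Fin k) (ε : Fin k) (⊖_ : Fin k → Fin k)
             (isAb : IsAbelianGroup _≡_ _⊕_ ε ⊖_) where

  open IsAbelianGroup isAb public using ()
    renaming (assoc to ⊕-assoc; identityˡ to ⊕-identityˡ; identityʳ to ⊕-identityʳ;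
              inverseˡ to ⊖-inverseˡ; inverseʳ to ⊖-inverseʳ; comm to ⊕-comm)

  infixl 6 _⊞_
  data Expr (n : ℕ) : Set where
    var  : Fin n → Expr n
    _⊞_  : Expr n → Expr n → Expr n
    ⊟_   : Expr n → Expr n
    nil  : Expr n

  -- A decision procedure for abelian group identities: a term is flattened
  -- to a list of signed variables, cancelling opposite ones on insertion.
  module Solver {n : ℕ} (env : Vec (Fin k) n) where

    eval : Expr n → Fin k
    eval (var i) = lookup env i
    eval (e ⊞ f) = eval e ⊕ eval f
    eval (⊟ e)   = ⊖ eval e
    eval nil     = ε

    signed : Bool → Fin k → Fin k
    signed true  a = a
    signed false a = ⊖ a

    evalList : List (Bool × Fin n) → Fin k
    evalList []            = ε
    evalList ((s , i) ∷ l) = signed s (lookup env i) ⊕ evalList l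

    cancels : Bool → Fin n → Bool → Fin n → Bool
    cancels true  i false j = does (i Fin.≟ j)
    cancels false i true  j = does (i Fin.≟ j)
    cancels _     _ _     _ = false

    insert : Bool → Fin n → List (Bool × Fin n) → List (Bool × Fin n)
    insert s i []            = (s , i) ∷ []
    insert s i ((r , j) ∷ l) = if cancels s i r j then l else (r , j) ∷ insert s i l

    flatten : Expr n → Bool → List (Bool × Fin n) → List (Bool × Fin n)
    flatten (var i) s l = insert s i l
    flatten (e ⊞ f) s l = flatten e s (flatten f s l)
    flatten (⊟ e)   s l = flatten e (not s) l
    flatten nil     s l = l

    cancels-sound : ∀ s i r j → cancels s i r j ≡ true →
                    signed s (lookup env i) ⊕ signed r (lookup env j) ≡ ε
    cancels-sound true  i false j h with does-true (i Fin.≟ j) h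
    ... | refl = ⊖-inverseʳ _
    cancels-sound false i true  j h with does-true (i Fin.≟ j) h
    ... | refl = ⊖-inverseˡ _

    insert-sound : ∀ s i l → evalList (insert s i l) ≡ signed s (lookup env i) ⊕ evalList l
    insert-sound s i [] = refl
    insert-sound s i ((r , j) ∷ l) with cancels s i r j in eq
    ... | true  = trans (sym (⊕-identityˡ _)) (trans (cong (_⊕ evalList l) (sym (cancels-sound s i r j eq)))
                        (⊕-assoc _ _ _))
    ... | false = trans (cong (signed r (lookup env j) ⊕_) (insert-sound s i l))
                 (trans (sym (⊕-assoc _ _ _)) (trans (cong (_⊕ evalList l) (⊕-comm _ _)) (⊕-assoc _ _ _)))

    ⊖-unique : ∀ {a b} → a ⊕ b ≡ ε → a ≡ ⊖ b
    ⊖-unique {a} {b} h = trans (sym (⊕-identityʳ a)) (trans (cong (a ⊕_) (sym (⊖-inverseʳ b)))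
      (trans (sym (⊕-assoc a b _)) (trans (cong (_⊕ (⊖ b)) h) (⊕-identityˡ _))))

    ⊖-⊕ : ∀ a b → (⊖ a) ⊕ (⊖ b) ≡ ⊖ (a ⊕ b)
    ⊖-⊕ a b = ⊖-unique (begin
      ((⊖ a) ⊕ (⊖ b)) ⊕ (a ⊕ b) ≡⟨ cong (_⊕ (a ⊕ b)) (⊕-comm _ _) ⟩
      ((⊖ b) ⊕ (⊖ a)) ⊕ (a ⊕ b) ≡⟨ ⊕-assoc _ _ _ ⟩
      (⊖ b) ⊕ ((⊖ a) ⊕ (a ⊕ b)) ≡⟨ cong ((⊖ b) ⊕_) (trans (sym (⊕-assoc _ _ _)) (trans (cong (_⊕ b) (⊖-inverseˡ a)) (⊕-identityˡ b))) ⟩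
      (⊖ b) ⊕ b ≡⟨ ⊖-inverseˡ b ⟩
      ε ∎)
      where open ≡-Reasoning

    signed-⊕ : ∀ s a b → signed s a ⊕ signed s b ≡ signed s (a ⊕ b)
    signed-⊕ true  a b = refl
    signed-⊕ false a b = ⊖-⊕ a b

    signed-not : ∀ s a → signed (not s) a ≡ signed s (⊖ a)
    signed-not true  a = refl
    signed-not false a = ⊖-unique (⊖-inverseʳ a)

    signed-ε : ∀ s → signed s ε ≡ ε
    signed-ε true  = refl
    signed-ε false = sym (⊖-unique (⊕-identityˡ ε))

    flatten-sound : ∀ e s l → evalList (flatten e s l) ≡ signed s (eval e) ⊕ evalList l
    flatten-sound (var i) s l = insert-sound s i l
    flatten-sound (e ⊞ f) s l = trans (flatten-sound e s (flatten f s l))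
      (trans (cong (signed s (eval e) ⊕_) (flatten-sound f s l))
      (trans (sym (⊕-assoc _ _ _)) (cong (_⊕ evalList l) (signed-⊕ s (eval e) (eval f)))))
    flatten-sound (⊟ e)   s l = trans (flatten-sound e (not s) l) (cong (_⊕ evalList l) (signed-not s (eval e)))
    flatten-sound nil     s l = trans (sym (⊕-identityˡ _)) (cong (_⊕ evalList l) (sym (signed-ε s)))

    solve : ∀ e f → flatten (e ⊞ ⊟ f) true [] ≡ [] → eval e ≡ eval f
    solve e f h = trans (⊖-unique (trans (sym (⊕-identityʳ _))
      (trans (sym (flatten-sound (e ⊞ ⊟ f) true [])) (cong evalList h)))) (sym (signed-not false (eval f)))

  pattern v0 = var Fin.zero
  pattern v1 = var (Fin.suc Fin.zero)
  pattern v2 = var (Fin.suc (Fin.suc Fin.zero))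
  pattern v3 = var (Fin.suc (Fin.suc (Fin.suc Fin.zero)))
  pattern v4 = var (Fin.suc (Fin.suc (Fin.suc (Fin.suc Fin.zero))))

  record Action (C : Set) : Set where
    infixl 7 _·_
    field
      _·_ : C → Fin k → C
      ·-⊕ : ∀ c a b → c · a · b ≡ c · (a ⊕ b)
      ·-ε : ∀ c → c · ε ≡ c

    ·-⊖ʳ : ∀ c a → c · (⊖ a) · a ≡ c
    ·-⊖ʳ c a = trans (·-⊕ c _ _) (trans (cong (c ·_) (⊖-inverseˡ a)) (·-ε c))

    ·-⊖ˡ : ∀ c a → c · a · (⊖ a) ≡ c
    ·-⊖ˡ c a = trans (·-⊕ c _ _) (trans (cong (c ·_) (⊖-inverseʳ a)) (·-ε c))

    ·-cancel : ∀ {c d} a → c · a ≡ d · a → c ≡ d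
    ·-cancel {c} {d} a h = trans (sym (·-⊖ˡ c a)) (trans (cong (_· (⊖ a)) h) (·-⊖ˡ d a))

  -- The action through which the equations x i = x j + a z are read: the
  -- flag records whether z = 0.
  scaled : ∀ {C} → Bool → Action C → Action C
  scaled false A = A
  scaled true  A = record { _·_ = λ c _ → c ; ·-⊕ = λ _ _ _ → refl ; ·-ε = λ _ → refl }

  Triple : ℕ → Set
  Triple n = Fin n × Fin n × Fin k

  -- A relabelling ξ is the substitution x j = x (root ξ j) + gain ξ j. Contractions, their
  -- composites and placements in a larger graph all have this shape.
  Relabelling : ℕ → ℕ → Set
  Relabelling n m = Fin n → Fin m × Fin k

  root : ∀ {n m} → Relabelling n m → Fin n → Fin m
  root ξ j = proj₁ (ξ j)

  gain : ∀ {n m} → Relabelling n m → Fin n → Fin k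
  gain ξ j = proj₂ (ξ j)

  idᵣ : ∀ {n} → Relabelling n n
  idᵣ j = j , ε

  infixr 9 _⊙_
  _⊙_ : ∀ {l n m} → Relabelling n m → Relabelling l n → Relabelling l m
  (τ ⊙ ξ) j = root τ (root ξ j) , gain τ (root ξ j) ⊕ gain ξ j

  -- The new gain comes from substituting into x i = x j + a and solving for x (root ξ i).
  move : ∀ {n m} → Relabelling n m → Triple n → Triple m
  move ξ (i , j , a) = root ξ i , root ξ j , (a ⊕ gain ξ j) ⊕ (⊖ gain ξ i)

  move-⊙ : ∀ {l n m} (τ : Relabelling n m) (ξ : Relabelling l n) e → move τ (move ξ e) ≡ move (τ ⊙ ξ) e
  move-⊙ τ ξ (i , j , a) = cong (λ g → root (τ ⊙ ξ) i , root (τ ⊙ ξ) j , g)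
    (Solver.solve (a ∷ gain ξ i ∷ gain ξ j ∷ gain τ (root ξ i) ∷ gain τ (root ξ j) ∷ [])
      (((v0 ⊞ v2) ⊞ (⊟ v1)) ⊞ v4 ⊞ (⊟ v3)) ((v0 ⊞ (v4 ⊞ v2)) ⊞ (⊟ (v3 ⊞ v1))) refl)

  move-id : ∀ {n} (e : Triple n) → move idᵣ e ≡ e
  move-id (i , j , a) = cong (λ g → i , j , g) (Solver.solve (a ∷ []) ((v0 ⊞ nil) ⊞ (⊟ nil)) v0 refl)

  flip : ∀ {n} → Triple n → Triple n
  flip (i , j , a) = j , i , ⊖ a

  -- The equation x i = x i. A loop with non-zero gain is different: contraction may create it, and
  -- it holds only where z = 0.
  trivial : ∀ {n} → Triple n → Bool
  trivial (i , j , a) = does (i Fin.≟ j) ∧ does (a Fin.≟ ε)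

  -- Contraction of the edge (w , v , a), under which x w = x v + a.
  contract : ∀ {n} → Fin n → Fin n → Fin k → Relabelling n n
  contract w v a j = if does (j Fin.≟ w) then (v , a) else (j , ε)

  contract-at : ∀ {n} (w v : Fin n) a → contract w v a w ≡ (v , a)
  contract-at w v a rewrite dec-true (w Fin.≟ w) refl = refl

  contract-off : ∀ {n} {w : Fin n} {v a j} → j ≢ w → contract w v a j ≡ (j , ε)
  contract-off {w = w} {j = j} j≢w rewrite dec-false (j Fin.≟ w) j≢w = refl

  module Colouring {C : Set} (eC : Enumeration C) (A : Action C) where
    open Enumeration eC using (_==_; ==⇒≡; ≡⇒==; ==-refl) public
    open Action A public

    sat : ∀ {n} → Vec C n → Triple n → Bool
    sat x (i , j , a) = lookup x i == lookup x j · a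

    pull : ∀ {n m} → Vec C m → Relabelling n m → Vec C n
    pull x ξ = tabulate (λ j → lookup x (root ξ j) · gain ξ j)

    lookup-pull : ∀ {n m} (x : Vec C m) (ξ : Relabelling n m) j →
                  lookup (pull x ξ) j ≡ lookup x (root ξ j) · gain ξ j
    lookup-pull x ξ = Vec.lookup∘tabulate _

    pull-⊙ : ∀ {l n m} (x : Vec C m) (τ : Relabelling n m) (ξ : Relabelling l n) → pull (pull x τ) ξ ≡ pull x (τ ⊙ ξ)
    pull-⊙ x τ ξ = Vec.tabulate-cong (λ j → trans (cong (_· gain ξ j) (lookup-pull x τ (root ξ j))) (·-⊕ _ _ _))

    pull-id : ∀ {n} (x : Vec C n) → pull x idᵣ ≡ x
    pull-id x = trans (Vec.tabulate-cong (λ j → ·-ε _)) (Vec.tabulate∘lookup x)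

    sat-move : ∀ {n m} (x : Vec C m) (ξ : Relabelling n m) e → sat x (move ξ e) ≡ sat (pull x ξ) e
    sat-move x ξ (i , j , a) rewrite lookup-pull x ξ i | lookup-pull x ξ j = true⇔⇒≡
      (λ h → ≡⇒== (trans (cong (_· gain ξ i) (==⇒≡ h)) (trans (·-⊕ _ _ _) (trans (cong (lookup x (root ξ j) ·_) eq) (sym (·-⊕ _ _ _))))))
      (λ h → ≡⇒== (·-cancel (gain ξ i) (trans (==⇒≡ h) (trans (·-⊕ _ _ _) (trans (cong (lookup x (root ξ j) ·_) (sym eq)) (sym (·-⊕ _ _ _)))))))
      where
      eq : ((a ⊕ gain ξ j) ⊕ (⊖ gain ξ i)) ⊕ gain ξ i ≡ gain ξ j ⊕ a
      eq = Solver.solve (a ∷ gain ξ i ∷ gain ξ j ∷ []) (((v0 ⊞ v2) ⊞ (⊟ v1)) ⊞ v1) (v2 ⊞ v0) refl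

    sat-flip : ∀ {n} (x : Vec C n) e → sat x (flip e) ≡ sat x e
    sat-flip x (i , j , a) = true⇔⇒≡
      (λ h → ≡⇒== (trans (sym (·-⊖ʳ _ a)) (cong (_· a) (sym (==⇒≡ h)))))
      (λ h → ≡⇒== (trans (sym (·-⊖ˡ _ a)) (cong (_· (⊖ a)) (sym (==⇒≡ h)))))

    sat-trivial : ∀ {n} (x : Vec C n) e → trivial e ≡ true → sat x e ≡ true
    sat-trivial x (i , j , a) h with p , q ← ∧-true {does (i Fin.≟ j)} h
      with refl ← does-true (i Fin.≟ j) p | refl ← does-true (a Fin.≟ ε) q = ≡⇒== (sym (·-ε _))

    pull-contract : ∀ {n} (x : Vec C n) w v a → pull x (contract w v a) ≡ x [ w ]≔ (lookup x v · a)
    pull-contract x w v a = trans (Vec.tabulate-cong each) (Vec.tabulate∘lookup _)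
      where
      each : ∀ j → lookup x (root (contract w v a) j) · gain (contract w v a) j ≡ lookup (x [ w ]≔ (lookup x v · a)) j
      each j with j Fin.≟ w
      ... | yes refl = sym (Vec.lookup∘updateAt w x)
      ... | no  j≢w  = trans (·-ε _) (sym (Vec.lookup∘updateAt′ j w j≢w x))

  record Palette : Set₁ where
    field
      Colour : Set
      enum   : Enumeration Colour
      action : Action Colour
    open Action action public
    field
      free    : ∀ c {a b} → c · a ≡ c · b → a ≡ b
      -- σ c d exchanges the orbits of c and d, matching c with d.
      σ       : Colour → Colour → Colour → Colour
      σ-·     : ∀ c d e a → σ c d (e · a) ≡ σ c d e · a
      σ-maps  : ∀ c d → σ c d c ≡ d
      σ-fixes : ∀ c d e → (∀ a → e ≢ c · a) → (∀ a → e ≢ d · a) → σ c d e ≡ e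
      σ-σ     : ∀ c d e → σ d c (σ c d e) ≡ e

  palette : ℕ → Palette
  palette q = record
    { Colour  = Fin q × Fin k
    ; enum    = productEnum (finEnum q) (finEnum k)
    ; action  = record
      { _·_ = λ { (b , h) a → b , h ⊕ a }
      ; ·-⊕ = λ { (b , h) a a′ → cong (b ,_) (⊕-assoc h a a′) }
      ; ·-ε = λ { (b , h) → cong (b ,_) (⊕-identityʳ h) } }
    ; free    = λ { (b , h) {a} {a′} e → trans (expand h a) (trans (cong ((⊖ h) ⊕_) (cong proj₂ e)) (sym (expand h a′))) }
    ; σ       = swap
    ; σ-·     = swap-·
    ; σ-maps  = λ { (b , h) (b′ , h′) → maps b h b′ h′ }
    ; σ-fixes = λ { (b , h) (b′ , h′) (e , l) ne ne′ → fixes b h b′ h′ e l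
        (λ { refl → ne (l ⊕ (⊖ h)) (cong (b ,_) (reach l h)) })
        (λ { refl → ne′ (l ⊕ (⊖ h′)) (cong (b′ ,_) (reach l h′)) }) }
    ; σ-σ     = swap-swap }
    where
    expand : ∀ h a → a ≡ (⊖ h) ⊕ (h ⊕ a)
    expand h a = Solver.solve (h ∷ a ∷ []) v1 ((⊟ v0) ⊞ (v0 ⊞ v1)) refl
    reach : ∀ l h → l ≡ h ⊕ (l ⊕ (⊖ h))
    reach l h = Solver.solve (l ∷ h ∷ []) v0 (v1 ⊞ (v0 ⊞ (⊟ v1))) refl
    -- If c and d lie in one orbit, the first branch translates this orbit and the second is never
    -- reached; hence the inverse is `swap d c` rather than `swap c d`.
    swap : Fin q × Fin k → Fin q × Fin k → Fin q × Fin k → Fin q × Fin k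
    swap (b , h) (b′ , h′) (e , l) =
      if does (e Fin.≟ b) then (b′ , l ⊕ (h′ ⊕ (⊖ h)))
      else if does (e Fin.≟ b′) then (b , l ⊕ (h ⊕ (⊖ h′))) else (e , l)
    shift : ∀ l a d → (l ⊕ a) ⊕ d ≡ (l ⊕ d) ⊕ a
    shift l a d = Solver.solve (l ∷ a ∷ d ∷ []) ((v0 ⊞ v1) ⊞ v2) ((v0 ⊞ v2) ⊞ v1) refl
    swap-· : ∀ c d e a → swap c d (proj₁ e , proj₂ e ⊕ a) ≡ (proj₁ (swap c d e) , proj₂ (swap c d e) ⊕ a)
    swap-· (b , h) (b′ , h′) (e , l) a with does (e Fin.≟ b)
    ... | true  = cong (b′ ,_) (shift l a _)
    ... | false with does (e Fin.≟ b′)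
    ...   | true  = cong (b ,_) (shift l a _)
    ...   | false = refl
    maps : ∀ b h b′ h′ → swap (b , h) (b′ , h′) (b , h) ≡ (b′ , h′)
    maps b h b′ h′ rewrite dec-true (b Fin.≟ b) refl =
      cong (b′ ,_) (Solver.solve (h ∷ h′ ∷ []) (v0 ⊞ (v1 ⊞ (⊟ v0))) v1 refl)
    fixes : ∀ b h b′ h′ e l → e ≢ b → e ≢ b′ → swap (b , h) (b′ , h′) (e , l) ≡ (e , l)
    fixes b h b′ h′ e l e≢b e≢b′ rewrite dec-false (e Fin.≟ b) e≢b | dec-false (e Fin.≟ b′) e≢b′ = refl
    undo : ∀ l h h′ → (l ⊕ (h′ ⊕ (⊖ h))) ⊕ (h ⊕ (⊖ h′)) ≡ l
    undo l h h′ = Solver.solve (l ∷ h ∷ h′ ∷ []) ((v0 ⊞ (v2 ⊞ (⊟ v1))) ⊞ (v1 ⊞ (⊟ v2))) v0 refl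
    swap-swap : ∀ c d e → swap d c (swap c d e) ≡ e
    swap-swap (b , h) (b′ , h′) (e , l) with e Fin.≟ b
    ... | yes refl rewrite dec-true (b′ Fin.≟ b′) refl = cong (b ,_) (undo l h h′)
    ... | no e≢b with e Fin.≟ b′
    ...   | yes refl rewrite dec-false (b Fin.≟ b′) (e≢b ∘ sym) | dec-true (b Fin.≟ b) refl = cong (b′ ,_) (undo l h′ h)
    ...   | no e≢b′ rewrite dec-false (e Fin.≟ b′) e≢b′ | dec-false (e Fin.≟ b) e≢b = refl

  _∈±_ : ∀ {n} → Triple n → List (Triple n) → Set
  e ∈± L = e ∈ L ⊎ flip e ∈ L

  -- A star at w is given by the pairs (j , b) of its edges (w , j , b).
  star : ∀ {n} → Fin n → List (Fin n × Fin k) → List (Triple n)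
  star w = map (λ { (j , b) → w , j , b })

  Avoids : ∀ {n} → Fin n → List (Triple n) → Set
  Avoids w L = ∀ {i j a} → (i , j , a) ∈ L → i ≢ w × j ≢ w

  -- A star at w split off from the remaining edges A. The equations x w = x j + b and x w = x j′ +
  -- b′ imply x j = x j′ + b′ - b, and `closed` asks for this edge in A.
  record Simplicial {n} (A : List (Triple n)) (w : Fin n) (S : List (Fin n × Fin k)) : Set where
    field
      A-avoids : Avoids w A
      S-avoids : ∀ {j b} → (j , b) ∈ S → j ≢ w
      S-unique : AllPairs _≢_ S
      closed   : ∀ {j b j′ b′} → (j , b) ∈ S → (j′ , b′) ∈ S → j ≢ j′ → (j , j′ , b′ ⊕ (⊖ b)) ∈± A

  -- Counting proper colourings around a simplicial vertex

  module Proper (P : Palette) where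
    open Palette P
    open Colouring enum action using (_==_; ==⇒≡; ≡⇒==; sat; pull; sat-move; sat-flip; pull-contract)
    open Averaging enum
    cs = elements enum

    colourings : ∀ n → List (Vec Colour n)
    colourings = vecs cs

    -- Loops impose no condition: off z = 0 a loop with non-zero gain never holds, and a trivial one
    -- belongs to the contracted flat.
    ok : ∀ {n} → Vec Colour n → Triple n → Bool
    ok x (i , j , a) = does (i Fin.≟ j) ∨ not (sat x (i , j , a))

    proper : ∀ {n} → Vec Colour n → List (Triple n) → Bool
    proper x L = allᵇ (ok x) L

    ok-elim : ∀ {n} (x : Vec Colour n) {i j a} → i ≢ j → ok x (i , j , a) ≡ true → lookup x i ≢ lookup x j · a
    ok-elim x {i} {j} {a} i≢j h e rewrite dec-false (i Fin.≟ j) i≢j | ≡⇒== e = case h of λ ()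

    ok-flip : ∀ {n} (x : Vec Colour n) e → ok x (flip e) ≡ true → ok x e ≡ true
    ok-flip x (i , j , a) h with i Fin.≟ j
    ... | yes _  = refl
    ... | no i≢j rewrite dec-false (j Fin.≟ i) (i≢j ∘ sym) = trans (cong not (sym (sat-flip x (i , j , a)))) h

    proper-∈ : ∀ {n} (x : Vec Colour n) {L e} → proper x L ≡ true → e ∈ L → ok x e ≡ true
    proper-∈ x {L} h = allᵇ-elim (ok x) L h

    proper-∈± : ∀ {n} (x : Vec Colour n) {L e} → proper x L ≡ true → e ∈± L → ok x e ≡ true
    proper-∈± x h (inj₁ e∈) = proper-∈ x h e∈
    proper-∈± x {e = e} h (inj₂ e∈) = ok-flip x e (proper-∈ x h e∈)

    proper-cong : ∀ {n} (x y : Vec Colour n) L → (∀ {i j a} → (i , j , a) ∈ L → lookup x i ≡ lookup y i × lookup x j ≡ lookup y j) →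
                  proper x L ≡ proper y L
    proper-cong x y L h = allᵇ-cong-∈ L (λ { {i , j , a} e∈ → cong₂ (λ c d → does (i Fin.≟ j) ∨ not (c == d · a)) (proj₁ (h e∈)) (proj₂ (h e∈)) })

    proper-σ : ∀ {n} c d (x : Vec Colour n) L → proper (Vec.map (σ c d) x) L ≡ proper x L
    proper-σ c d x L = allᵇ-cong-∈ L (λ { {i , j , a} _ → cong (λ b → does (i Fin.≟ j) ∨ not b) (same i j a) })
      where
      same : ∀ i j a → sat (Vec.map (σ c d) x) (i , j , a) ≡ sat x (i , j , a)
      same i j a rewrite Vec.lookup-map i (σ c d) x | Vec.lookup-map j (σ c d) x = true⇔⇒≡
        (λ h → ≡⇒== (trans (sym (σ-σ c d _)) (trans (cong (σ d c) (trans (==⇒≡ h) (sym (σ-· c d _ a)))) (σ-σ c d _))))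
        (λ h → ≡⇒== (trans (cong (σ c d) (==⇒≡ h)) (σ-· c d _ a)))

    -- The colour which the star edge with data (j , b) forbids at the centre.
    key : ∀ {n} → Vec Colour n → Fin n × Fin k → Colour
    key x (j , b) = lookup x j · b

    keys : ∀ {n} → Vec Colour n → List (Fin n × Fin k) → List Colour
    keys x = map (key x)

    avoid : Colour → List Colour → Bool
    avoid c = allᵇ (λ d → not (c == d))

    avoid-elim : ∀ {n} {c} (x : Vec Colour n) {S s} → avoid c (keys x S) ≡ true → s ∈ S → c ≢ key x s
    avoid-elim {c = c} x {S} {s} h s∈ e = case trans (sym (allᵇ-elim _ (keys x S) h (Mem.∈-map⁺ (key x) s∈))) (cong not (≡⇒== e)) of λ ()

    avoid-intro : ∀ {n} {c} (x : Vec Colour n) S → (∀ {s} → s ∈ S → c ≢ key x s) → avoid c (keys x S) ≡ true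
    avoid-intro {c = c} x S h = trans (allᵇ-map _ (key x) S) (allᵇ-intro-∈ _ S (λ s∈ → cong not (¬true⇒false (h s∈ ∘ ==⇒≡))))

    avoid-count : ∀ ks → AllPairs _≢_ ks → ∑ cs (λ c → ⟦ avoid c ks ⟧) ≡ size - pos (length ks)
    avoid-count [] [] = trans ∑-one (sym (ℤ.+-identityʳ size))
    avoid-count (d ∷ ks) (d≢ ∷ u) = begin
      ∑ cs (λ c → ⟦ not (c == d) ∧ avoid c ks ⟧) ≡⟨ ∑-cong cs split ⟩
      ∑ cs (λ c → ⟦ avoid c ks ⟧ + - (⟦ c == d ⟧ * ⟦ avoid c ks ⟧)) ≡⟨ ∑-+ cs _ _ ⟩
      ∑ cs (λ c → ⟦ avoid c ks ⟧) + ∑ cs (λ c → - (⟦ c == d ⟧ * ⟦ avoid c ks ⟧)) ≡⟨ cong₂ _+_ (avoid-count ks u) (trans (∑-neg cs _) (cong -_ (trans (Enumeration.∑-pick enum d (λ c → ⟦ avoid c ks ⟧)) (cong ⟦_⟧ (fresh ks d≢))))) ⟩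
      (size - pos (length ks)) + - 1ℤ ≡⟨ arrange size (pos (length ks)) ⟩
      size - (1ℤ + pos (length ks)) ∎
      where
      open ≡-Reasoning
      arrange : ∀ s l → (s - l) + - 1ℤ ≡ s - (1ℤ + l)
      arrange = solve-∀
      split : ∀ c → ⟦ not (c == d) ∧ avoid c ks ⟧ ≡ ⟦ avoid c ks ⟧ + - (⟦ c == d ⟧ * ⟦ avoid c ks ⟧)
      split c with c == d
      ... | false = sym (ℤ.+-identityʳ ⟦ avoid c ks ⟧)
      ... | true with avoid c ks
      ...   | true  = refl
      ...   | false = refl
      fresh : ∀ ks → All (d ≢_) ks → avoid d ks ≡ true
      fresh []       []         = refl
      fresh (e ∷ ks) (d≢e ∷ ne) = ∧-intro (cong not (¬true⇒false (d≢e ∘ ==⇒≡))) (fresh ks ne)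

    proper-star : ∀ {n} (x : Vec Colour n) w S → (∀ {j b} → (j , b) ∈ S → j ≢ w) →
                  proper x (star w S) ≡ avoid (lookup x w) (keys x S)
    proper-star x w S ne = trans (allᵇ-map (ok x) _ S) (trans (allᵇ-cong-∈ S each) (sym (allᵇ-map _ (key x) S)))
      where
      each : ∀ {s} → s ∈ S → ok x (w , proj₁ s , proj₂ s) ≡ not (lookup x w == key x s)
      each {j , b} s∈ rewrite dec-false (w Fin.≟ j) (ne s∈ ∘ sym) = refl

    module AtSimplicial {n} {A : List (Triple n)} {w S} (simp : Simplicial A w S) where
      open Simplicial simp

      -- For different neighbours a coincidence would violate the edge of A between them that
      -- `closed` supplies; for the same neighbour the action is free.
      keys-distinct : ∀ x → proper x A ≡ true → ∀ {s s′} → s ∈ S → s′ ∈ S → s ≢ s′ → key x s ≢ key x s′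
      keys-distinct x pA {j , b} {j′ , b′} s∈ s′∈ s≢s′ e with j Fin.≟ j′
      ... | yes refl = s≢s′ (cong (j ,_) (free (lookup x j) e))
      ... | no j≢j′  = ok-elim x j≢j′ (proper-∈± x pA (closed s∈ s′∈ j≢j′))
        (trans (sym (·-⊖ˡ (lookup x j) b)) (trans (cong (_· (⊖ b)) e) (·-⊕ (lookup x j′) b′ (⊖ b))))

      proper-split : ∀ x c → proper (x [ w ]≔ c) (A ++ star w S) ≡ proper x A ∧ avoid c (keys x S)
      proper-split x c = trans (allᵇ-++ (ok (x [ w ]≔ c)) A (star w S)) (cong₂ _∧_
        (proper-cong (x [ w ]≔ c) x A (λ e∈ → off (proj₁ (A-avoids e∈)) , off (proj₂ (A-avoids e∈))))
        (trans (proper-star (x [ w ]≔ c) w S S-avoids) (cong₂ avoid (Vec.lookup∘updateAt w x)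
          (List.map-cong-local (keys-same S S-avoids)))))
        where
        off : ∀ {i} → i ≢ w → lookup (x [ w ]≔ c) i ≡ lookup x i
        off i≢w = Vec.lookup∘updateAt′ _ w i≢w x
        keys-same : ∀ S → (∀ {j b} → (j , b) ∈ S → j ≢ w) → All (λ s → key (x [ w ]≔ c) s ≡ key x s) S
        keys-same []            ne = []
        keys-same ((j , b) ∷ S) ne = cong (_· b) (off (ne (here refl))) ∷ keys-same S (ne ∘ there)

      star-sum : ∀ x → ∑ cs (λ c → ⟦ proper (x [ w ]≔ c) (A ++ star w S) ⟧) ≡ ⟦ proper x A ⟧ * (size - pos (length S))
      star-sum x = trans (∑-cong cs (λ c → cong ⟦_⟧ (proper-split x c))) (cases (proper x A) refl)
        where
        cases : ∀ b → proper x A ≡ b → ∑ cs (λ c → ⟦ proper x A ∧ avoid c (keys x S) ⟧) ≡ ⟦ proper x A ⟧ * (size - pos (length S))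
        cases false e rewrite e = ∑-zero cs
        cases true  e rewrite e = trans (avoid-count (keys x S) (AllPairs-map-∈ (key x) S S-unique (keys-distinct x e)))
          (trans (cong (λ l → size - pos l) (List.length-map (key x) S)) (sym (ℤ.*-identityˡ (size - pos (length S)))))

      -- On the right w is unconstrained, whence the factor `size` on the left. The weight h will
      -- say that the surrounding graph, which avoids w, is properly coloured.
      weighted-star-sum : ∀ (h : Vec Colour n → ℤ) → (∀ x c → h (x [ w ]≔ c) ≡ h x) →
        size * ∑ (colourings n) (λ x → h x * ⟦ proper x (A ++ star w S) ⟧) ≡
        (size - pos (length S)) * ∑ (colourings n) (λ x → h x * ⟦ proper x A ⟧)
      weighted-star-sum h h-free = begin
        size * ∑ xs (λ x → h x * ⟦ proper x AS ⟧) ≡⟨ sym (∑-average w (λ x → h x * ⟦ proper x AS ⟧)) ⟩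
        ∑ xs (λ x → ∑ cs (λ c → h (x [ w ]≔ c) * ⟦ proper (x [ w ]≔ c) AS ⟧)) ≡⟨ ∑-cong xs (λ x → ∑-cong cs (λ c → cong (_* ⟦ proper (x [ w ]≔ c) AS ⟧) (h-free x c))) ⟩
        ∑ xs (λ x → ∑ cs (λ c → h x * ⟦ proper (x [ w ]≔ c) AS ⟧)) ≡⟨ ∑-cong xs (λ x → ∑-*ˡ cs (h x) _) ⟩
        ∑ xs (λ x → h x * ∑ cs (λ c → ⟦ proper (x [ w ]≔ c) AS ⟧)) ≡⟨ ∑-cong xs (λ x → cong (h x *_) (star-sum x)) ⟩
        ∑ xs (λ x → h x * (⟦ proper x A ⟧ * (size - pos (length S)))) ≡⟨ ∑-cong xs (λ x → move-out (h x) ⟦ proper x A ⟧ (size - pos (length S))) ⟩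
        ∑ xs (λ x → (size - pos (length S)) * (h x * ⟦ proper x A ⟧)) ≡⟨ ∑-*ˡ xs (size - pos (length S)) _ ⟩
        (size - pos (length S)) * ∑ xs (λ x → h x * ⟦ proper x A ⟧) ∎
        where
        open ≡-Reasoning
        xs = colourings n
        AS = A ++ star w S
        move-out : ∀ a b c → a * (b * c) ≡ c * (a * b)
        move-out = solve-∀

    module Symmetry {n} (V′ : Fin n → Bool) (T₀ : List (Fin n × Fin k))
                    (T₀⊆V′ : ∀ {j b} → (j , b) ∈ T₀ → V′ j ≡ true) where

      DependsOn : {B : Set} → (Fin n → Bool) → (Vec Colour n → B) → Set
      DependsOn U F = ∀ x y → (∀ j → U j ≡ true → lookup x j ≡ lookup y j) → F x ≡ F y

      -- When `T₀` contains a vertex with every gain, a clear colour avoids the whole orbit of the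
      -- colour of that vertex; this is what `σ-fixes` asks for.
      clear : Vec Colour n → Colour → Bool
      clear x c = avoid c (keys x T₀)

      twist : Colour → Colour → Vec Colour n → Vec Colour n
      twist c d x = tabulate (λ j → if V′ j then lookup x j else σ c d (lookup x j))

      lookup-twist : ∀ c d x j → lookup (twist c d x) j ≡ (if V′ j then lookup x j else σ c d (lookup x j))
      lookup-twist c d x j = Vec.lookup∘tabulate _ j

      twist-V′ : ∀ c d x j → V′ j ≡ true → lookup (twist c d x) j ≡ lookup x j
      twist-V′ c d x j j∈ = trans (lookup-twist c d x j) (cong (λ b → if b then lookup x j else σ c d (lookup x j)) j∈)

      twist-twist : ∀ c d x → twist d c (twist c d x) ≡ x
      twist-twist c d x = trans (Vec.tabulate-cong each) (Vec.tabulate∘lookup x)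
        where
        each : ∀ j → (if V′ j then lookup (twist c d x) j else σ d c (lookup (twist c d x) j)) ≡ lookup x j
        each j rewrite lookup-twist c d x j with V′ j
        ... | true  = refl
        ... | false = σ-σ c d (lookup x j)

      clear-cong : ∀ x y c → (∀ j → V′ j ≡ true → lookup x j ≡ lookup y j) → clear x c ≡ clear y c
      clear-cong x y c h = trans (allᵇ-map _ (key x) T₀) (trans (allᵇ-cong-∈ T₀
        (λ { {j , b} s∈ → cong (λ d → not (c == d · b)) (h j (T₀⊆V′ s∈)) })) (sym (allᵇ-map _ (key y) T₀)))

      -- Recolour everything outside V′ by the colour automorphism that takes the
      -- colour β x of p to c: it fixes the colours on T₀.
      recolour : (h : Vec Colour n → ℤ) → DependsOn V′ h →
        (β : Vec Colour n → Colour) → DependsOn V′ β → (∀ x → h x ≡ 0ℤ ⊎ clear x (β x) ≡ true) →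
        (F : Vec Colour n → Bool) (U : Fin n → Bool) → DependsOn U F → (∀ c d x → F (Vec.map (σ c d) x) ≡ F x) →
        (p : Fin n) → (∀ j → U j ≡ true → V′ j ≡ true → j ≢ p → ∀ b → (j , b) ∈ T₀) →
        ∑ (colourings n) (λ x → ∑ cs (λ c → h x * (⟦ clear x c ⟧ * ⟦ F (x [ p ]≔ β x) ⟧))) ≡
        ∑ (colourings n) (λ x → ∑ cs (λ c → h x * (⟦ clear x c ⟧ * ⟦ F (x [ p ]≔ c) ⟧)))
      recolour h h-dep β β-dep β-clear F U F-dep F-σ p covers = begin
        ∑ xs (λ x → ∑ cs (λ c → H (x , c))) ≡⟨ sym (∑-product xs cs H) ⟩
        ∑ (elements pairs) H ≡⟨ ∑-cong (elements pairs) (λ { (x , c) → agree x c }) ⟩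
        ∑ (elements pairs) (H′ ∘ Φ) ≡⟨ Enumeration.∑-reindex pairs Φ Ψ ΨΦ ΦΨ H′ ⟩
        ∑ (elements pairs) H′ ≡⟨ ∑-product xs cs H′ ⟩
        ∑ xs (λ x → ∑ cs (λ c → H′ (x , c))) ∎
        where
        open ≡-Reasoning
        xs = colourings n
        pairs = productEnum (vecEnum enum n) enum
        H H′ : Vec Colour n × Colour → ℤ
        H  (x , c) = h x * (⟦ clear x c ⟧ * ⟦ F (x [ p ]≔ β x) ⟧)
        H′ (x , c) = h x * (⟦ clear x c ⟧ * ⟦ F (x [ p ]≔ c) ⟧)
        -- The colour β x depends only on V′, which `twist` leaves alone, so the inverse map can
        -- recompute it.
        Φ Ψ : Vec Colour n × Colour → Vec Colour n × Colour
        Φ (x , c) = twist (β x) c x , c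
        Ψ (x , c) = twist c (β x) x , c
        β-twist : ∀ c d x → β (twist c d x) ≡ β x
        β-twist c d x = β-dep _ x (twist-V′ c d x)
        ΨΦ : ∀ y → Ψ (Φ y) ≡ y
        ΨΦ (x , c) = cong (_, c) (trans (cong (λ d → twist c d (twist (β x) c x)) (β-twist (β x) c x)) (twist-twist (β x) c x))
        ΦΨ : ∀ y → Φ (Ψ y) ≡ y
        ΦΨ (x , c) = cong (_, c) (trans (cong (λ d → twist d c (twist c (β x) x)) (β-twist c (β x) x)) (twist-twist c (β x) x))
        away : ∀ x c → clear x c ≡ true → ∀ j → (∀ b → (j , b) ∈ T₀) → ∀ a → lookup x j ≢ c · a
        away x c ok j all a e = avoid-elim x ok (all (⊖ a)) (sym (trans (cong (_· (⊖ a)) e) (·-⊖ˡ c a)))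
        -- Applying σ everywhere and twisting outside V′ differ only on V′. There F sees p, which
        -- has colour c on both sides, and vertices covered by `T₀`, whose colours σ fixes.
        same-F : ∀ x c → clear x c ≡ true → clear x (β x) ≡ true → F (x [ p ]≔ β x) ≡ F (twist (β x) c x [ p ]≔ c)
        same-F x c ok okβ = trans (sym (F-σ (β x) c (x [ p ]≔ β x))) (F-dep _ _ each)
          where
          each : ∀ j → U j ≡ true → lookup (Vec.map (σ (β x) c) (x [ p ]≔ β x)) j ≡ lookup (twist (β x) c x [ p ]≔ c) j
          each j j∈U rewrite Vec.lookup-map j (σ (β x) c) (x [ p ]≔ β x) with j Fin.≟ p
          ... | yes refl rewrite Vec.lookup∘updateAt p {f = λ _ → β x} x | Vec.lookup∘updateAt p {f = λ _ → c} (twist (β x) c x) = σ-maps (β x) c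
          ... | no j≢p rewrite Vec.lookup∘updateAt′ j p {f = λ _ → β x} j≢p x | Vec.lookup∘updateAt′ j p {f = λ _ → c} j≢p (twist (β x) c x)
                             | lookup-twist (β x) c x j with V′ j in j∈
          ...   | false = refl
          ...   | true  = σ-fixes (β x) c (lookup x j) (away x (β x) okβ j all) (away x c ok j all)
            where
            all : ∀ b → (j , b) ∈ T₀
            all = covers j j∈U j∈ j≢p
        agree : ∀ x c → H (x , c) ≡ H′ (Φ (x , c))
        agree x c rewrite h-dep (twist (β x) c x) x (twist-V′ (β x) c x) | clear-cong (twist (β x) c x) x c (twist-V′ (β x) c x)
          with β-clear x
        ... | inj₁ h≡0 rewrite h≡0 = refl
        ... | inj₂ okβ with clear x c in ok
        ...   | false = refl
        ...   | true  = cong (λ b → h x * (1ℤ * ⟦ b ⟧)) (same-F x c ok okβ)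

    -- Here v lies among the surrounding vertices `V′` and its neighbour w does not. `U₀` covers the
    -- ends of A and the neighbours of v; by `complete`, v is joined with every gain to those that
    -- are shared.
    module AtAttached {n} {A : List (Triple n)} {v S} (simp : Simplicial A v S) (U₀ V′ : Fin n → Bool)
      (A⊆U₀ : ∀ {i j a} → (i , j , a) ∈ A → U₀ i ≡ true × U₀ j ≡ true)
      (S⊆U₀ : ∀ {j b} → (j , b) ∈ S → U₀ j ≡ true)
      (v∈V′ : V′ v ≡ true)
      (complete : ∀ j → U₀ j ≡ true → V′ j ≡ true → ∀ b → (j , b) ∈ S)
      {w b₀} (wb₀∈S : (w , b₀) ∈ S) (w∉V′ : V′ w ≡ false) where
      open Simplicial simp
      open AtSimplicial simp

      isShared : Fin n × Fin k → Bool
      isShared (j , b) = U₀ j ∧ V′ j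

      T₀ : List (Fin n × Fin k)
      T₀ = selectPairs isShared

      ∈T₀ : ∀ {j} → U₀ j ≡ true → V′ j ≡ true → ∀ b → (j , b) ∈ T₀
      ∈T₀ j∈U j∈V b = ∈-filterᵇ isShared (∈-allPairs _) (∧-intro j∈U j∈V)

      T₀⁻ : ∀ {j b} → (j , b) ∈ T₀ → U₀ j ≡ true × V′ j ≡ true
      T₀⁻ s∈ = ∧-true (∈-filterᵇ⁻ isShared {xs = allPairs n k} s∈)

      T₀⊆S : ∀ {s} → s ∈ T₀ → s ∈ S
      T₀⊆S {j , b} s∈ = let j∈U , j∈V = T₀⁻ s∈ in complete j j∈U j∈V b

      open Symmetry V′ T₀ (proj₂ ∘ T₀⁻)

      τ : Relabelling n n
      τ = contract w v (⊖ b₀)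

      w≢v : w ≢ v
      w≢v = S-avoids wb₀∈S

      pull-τ : ∀ x → pull x τ ≡ x [ w ]≔ (lookup x v · (⊖ b₀))
      pull-τ x = pull-contract x w v (⊖ b₀)

      -- The number of clear colours at any proper colouring of A, independent of that colouring
      -- because the keys in `T₀` are distinct.
      M₀ : ℤ
      M₀ = size - pos (length T₀)

      clear-count : ∀ x → proper x A ≡ true → ∑ cs (λ c → ⟦ clear x c ⟧) ≡ M₀
      clear-count x pA = trans (avoid-count (keys x T₀) (AllPairs-map-∈ (key x) T₀ (selectPairs-unique isShared)
          (λ s∈ s′∈ → keys-distinct x pA (T₀⊆S s∈) (T₀⊆S s′∈))))
        (cong (λ l → size - pos l) (List.length-map (key x) T₀))

      -- The weight h will be properness of the surrounding graph, in which v is joined with every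
      -- gain to the shared vertices; so v has a clear colour wherever h does not vanish.
      module _ (h : Vec Colour n → ℤ) (h-dep : DependsOn V′ h)
               (h-clear : ∀ x → h x ≡ 0ℤ ⊎ clear x (lookup x v) ≡ true) where
        private
          xs = colourings n
          AS = A ++ star v S
          deg = size - pos (length S)
          βw : Vec Colour n → Colour
          βw x = lookup x v · (⊖ b₀)

        h-free-w : ∀ x c → h (x [ w ]≔ c) ≡ h x
        h-free-w x c = h-dep _ x (λ j j∈ → Vec.lookup∘updateAt′ j w (λ { refl → case trans (sym w∉V′) j∈ of λ () }) x)

        U₁ : Fin n → Bool
        U₁ j = U₀ j ∨ does (j Fin.≟ v)

        proper-AS-dep : DependsOn U₁ (λ x → proper x AS)
        proper-AS-dep x y e = proper-cong x y AS each
          where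
          each : ∀ {i j a} → (i , j , a) ∈ AS → lookup x i ≡ lookup y i × lookup x j ≡ lookup y j
          each {i} {j} t∈ with Mem.∈-++⁻ A t∈
          ... | inj₁ t∈A = e i (∨-introˡ (proj₁ (A⊆U₀ t∈A))) , e j (∨-introˡ (proj₂ (A⊆U₀ t∈A)))
          ... | inj₂ t∈S with Mem.∈-map⁻ _ t∈S
          ...   | (j , b) , s∈ , refl = e v (∨-introʳ (dec-true (v Fin.≟ v) refl)) , e j (∨-introˡ (S⊆U₀ s∈))

        proper-A-dep : DependsOn U₀ (λ x → proper x A)
        proper-A-dep x y e = proper-cong x y A (λ t∈ → e _ (proj₁ (A⊆U₀ t∈)) , e _ (proj₂ (A⊆U₀ t∈)))

        -- The factor M₀ is spent on a spare clear colour c for `recolour` to work with. A proper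
        -- colouring of A that agrees with x on V′ is enough to know the number of these c.
        insert-clear : (F : Vec Colour n → Bool) → (∀ x → F x ≡ true → Σ (Vec Colour n) λ y → proper y A ≡ true × (∀ j → V′ j ≡ true → lookup y j ≡ lookup x j)) →
          M₀ * ∑ xs (λ x → h x * ⟦ F x ⟧) ≡ ∑ xs (λ x → ∑ cs (λ c → h x * (⟦ clear x c ⟧ * ⟦ F x ⟧)))
        insert-clear F forces = trans (sym (∑-*ˡ xs M₀ _)) (∑-cong xs each)
          where
          pull-out : ∀ x → ∑ cs (λ c → h x * (⟦ clear x c ⟧ * ⟦ F x ⟧)) ≡ h x * (∑ cs (λ c → ⟦ clear x c ⟧) * ⟦ F x ⟧)
          pull-out x = trans (∑-*ˡ cs (h x) _) (cong (h x *_) (∑-*ʳ cs ⟦ F x ⟧ _))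
          swap : ∀ m a b → m * (a * b) ≡ a * (m * b)
          swap = solve-∀
          each : ∀ x → M₀ * (h x * ⟦ F x ⟧) ≡ ∑ cs (λ c → h x * (⟦ clear x c ⟧ * ⟦ F x ⟧))
          each x = trans (swap M₀ (h x) ⟦ F x ⟧) (trans (cong (h x *_) (cases (F x) refl)) (sym (pull-out x)))
            where
            cases : ∀ b → F x ≡ b → M₀ * ⟦ F x ⟧ ≡ ∑ cs (λ c → ⟦ clear x c ⟧) * ⟦ F x ⟧
            cases false e rewrite e = trans (ℤ.*-zeroʳ M₀) (sym (ℤ.*-zeroʳ (∑ cs (λ c → ⟦ clear x c ⟧))))
            cases true  e with y , pA , eq ← forces x e = cong (_* ⟦ F x ⟧) (trans (sym (clear-count y pA))
              (∑-cong cs (λ c → cong ⟦_⟧ (clear-cong y x c eq))))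

        absorb-clear : (F : Vec Colour n → Colour → Bool) → (∀ x c → F x c ≡ true → clear x c ≡ true) →
          ∑ xs (λ x → ∑ cs (λ c → h x * (⟦ clear x c ⟧ * ⟦ F x c ⟧))) ≡ ∑ xs (λ x → ∑ cs (λ c → h x * ⟦ F x c ⟧))
        absorb-clear F implies = ∑-cong xs (λ x → ∑-cong cs (λ c → cong (h x *_) (each x c)))
          where
          each : ∀ x c → ⟦ clear x c ⟧ * ⟦ F x c ⟧ ≡ ⟦ F x c ⟧
          each x c with F x c in e
          ... | false = ℤ.*-zeroʳ ⟦ clear x c ⟧
          ... | true rewrite implies x c e = refl

        -- By `recolour`, h may keep the prescribed colour of v while the inner edges see an
        -- arbitrary clear colour c in its place. Once the two are decoupled, `star-sum` counts the
        -- possible c.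
        star-side : M₀ * (size * ∑ xs (λ x → h x * ⟦ proper x AS ⟧)) ≡ (size * deg) * ∑ xs (λ x → h x * ⟦ proper x A ⟧)
        star-side = begin
          M₀ * (size * ∑ xs (λ x → h x * ⟦ proper x AS ⟧))
            ≡⟨ swap M₀ size _ ⟩
          size * (M₀ * ∑ xs (λ x → h x * ⟦ proper x AS ⟧))
            ≡⟨ cong (size *_) (insert-clear (λ x → proper x AS) (λ x e → x , proj₁ (∧-true (trans (sym (allᵇ-++ (ok x) A (star v S))) e)) , λ _ _ → refl)) ⟩
          size * ∑ xs (λ x → ∑ cs (λ c → h x * (⟦ clear x c ⟧ * ⟦ proper x AS ⟧)))
            ≡⟨ cong (size *_) (∑-cong xs (λ x → ∑-cong cs (λ c → cong (λ y → h x * (⟦ clear x c ⟧ * ⟦ proper y AS ⟧)) (sym (Vec.[]≔-lookup x v))))) ⟩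
          size * ∑ xs (λ x → ∑ cs (λ c → h x * (⟦ clear x c ⟧ * ⟦ proper (x [ v ]≔ lookup x v) AS ⟧)))
            ≡⟨ cong (size *_) (recolour h h-dep (λ x → lookup x v) (λ x y e → e v v∈V′) h-clear (λ x → proper x AS) U₁ proper-AS-dep
                 (λ c d x → proper-σ c d x AS) v covers) ⟩
          size * ∑ xs (λ x → ∑ cs (λ c → h x * (⟦ clear x c ⟧ * ⟦ proper (x [ v ]≔ c) AS ⟧)))
            ≡⟨ cong (size *_) (absorb-clear (λ x c → proper (x [ v ]≔ c) AS) clears) ⟩
          size * ∑ xs (λ x → ∑ cs (λ c → h x * ⟦ proper (x [ v ]≔ c) AS ⟧))
            ≡⟨ cong (size *_) (∑-cong xs (λ x → trans (∑-*ˡ cs (h x) _) (trans (cong (h x *_) (star-sum x)) (move-out (h x) ⟦ proper x A ⟧ deg)))) ⟩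
          size * ∑ xs (λ x → deg * (h x * ⟦ proper x A ⟧))
            ≡⟨ cong (size *_) (∑-*ˡ xs deg _) ⟩
          size * (deg * ∑ xs (λ x → h x * ⟦ proper x A ⟧))
            ≡⟨ sym (ℤ.*-assoc size deg _) ⟩
          (size * deg) * ∑ xs (λ x → h x * ⟦ proper x A ⟧) ∎
          where
          open ≡-Reasoning
          swap : ∀ a b c → a * (b * c) ≡ b * (a * c)
          swap = solve-∀
          move-out : ∀ a b c → a * (b * c) ≡ c * (a * b)
          move-out = solve-∀
          covers : ∀ j → U₁ j ≡ true → V′ j ≡ true → j ≢ v → ∀ b → (j , b) ∈ T₀
          covers j j∈U₁ j∈V′ j≢v with ∨-true {U₀ j} j∈U₁
          ... | inj₁ j∈U₀ = ∈T₀ j∈U₀ j∈V′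
          ... | inj₂ j≡v  = contradiction (does-true (j Fin.≟ v) j≡v) j≢v
          clears : ∀ x c → proper (x [ v ]≔ c) AS ≡ true → clear x c ≡ true
          clears x c e = avoid-intro x T₀ (λ s∈ → avoid-elim x (proj₂ (∧-true {proper x A} (trans (sym (proper-split x c)) e))) (T₀⊆S s∈))

        -- Contraction gives w the colour x v - b₀, clear because clear colours form whole orbits.
        -- `recolour` replaces it by any clear c, and as h does not see w, the sum over c becomes a
        -- sum over the colour of w.
        moved-side : M₀ * ∑ xs (λ x → h x * ⟦ proper x (map (move τ) A) ⟧) ≡ size * ∑ xs (λ x → h x * ⟦ proper x A ⟧)
        moved-side = begin
          M₀ * ∑ xs (λ x → h x * ⟦ proper x (map (move τ) A) ⟧)
            ≡⟨ cong (M₀ *_) (∑-cong xs (λ x → cong (λ b → h x * ⟦ b ⟧) (pulled x))) ⟩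
          M₀ * ∑ xs (λ x → h x * ⟦ proper (x [ w ]≔ βw x) A ⟧)
            ≡⟨ insert-clear (λ x → proper (x [ w ]≔ βw x) A) (λ x e → x [ w ]≔ βw x , e , λ j j∈ → Vec.lookup∘updateAt′ j w (λ { refl → case trans (sym w∉V′) j∈ of λ () }) x) ⟩
          ∑ xs (λ x → ∑ cs (λ c → h x * (⟦ clear x c ⟧ * ⟦ proper (x [ w ]≔ βw x) A ⟧)))
            ≡⟨ recolour h h-dep βw (λ x y e → cong (_· (⊖ b₀)) (e v v∈V′)) βw-clear (λ x → proper x A) U₀ proper-A-dep
                 (λ c d x → proper-σ c d x A) w (λ j j∈U j∈V _ → ∈T₀ j∈U j∈V) ⟩
          ∑ xs (λ x → ∑ cs (λ c → h x * (⟦ clear x c ⟧ * ⟦ proper (x [ w ]≔ c) A ⟧)))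
            ≡⟨ absorb-clear (λ x c → proper (x [ w ]≔ c) A) clears ⟩
          ∑ xs (λ x → ∑ cs (λ c → h x * ⟦ proper (x [ w ]≔ c) A ⟧))
            ≡⟨ ∑-cong xs (λ x → ∑-cong cs (λ c → cong (_* ⟦ proper (x [ w ]≔ c) A ⟧) (sym (h-free-w x c)))) ⟩
          ∑ xs (λ x → ∑ cs (λ c → h (x [ w ]≔ c) * ⟦ proper (x [ w ]≔ c) A ⟧))
            ≡⟨ ∑-average w (λ x → h x * ⟦ proper x A ⟧) ⟩
          size * ∑ xs (λ x → h x * ⟦ proper x A ⟧) ∎
          where
          open ≡-Reasoning
          βw-clear : ∀ x → h x ≡ 0ℤ ⊎ clear x (βw x) ≡ true
          βw-clear x with h-clear x
          ... | inj₁ z  = inj₁ z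
          ... | inj₂ okv = inj₂ (avoid-intro x T₀ (λ { {j , b} s∈ e → let j∈U , j∈V = T₀⁻ s∈ in
            avoid-elim x okv (∈T₀ j∈U j∈V (b ⊕ b₀)) (trans (sym (·-⊖ʳ (lookup x v) b₀)) (trans (cong (_· b₀) e) (·-⊕ (lookup x j) b b₀))) }))
          -- Since v has all edges to a shared vertex j, simpliciality gives w all of them too; a
          -- proper colour of w is therefore clear.
          clears : ∀ x c → proper (x [ w ]≔ c) A ≡ true → clear x c ≡ true
          clears x c e = avoid-intro x T₀ (λ { {j , b} s∈ eq → let j∈U , j∈V = T₀⁻ s∈ ; j≢w = j≢w′ j∈V in
            ok-elim (x [ w ]≔ c) (j≢w ∘ sym) (proper-∈± (x [ w ]≔ c) e (closed wb₀∈S (complete j j∈U j∈V (b ⊕ b₀)) (j≢w ∘ sym)))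
              (trans (Vec.lookup∘updateAt w x) (trans eq (sym (cong₂ _·_ (Vec.lookup∘updateAt′ j w j≢w x) (gain-eq b))))) })
            where
            j≢w′ : ∀ {j} → V′ j ≡ true → j ≢ w
            j≢w′ j∈V refl = case trans (sym w∉V′) j∈V of λ ()
            gain-eq : ∀ b → (b ⊕ b₀) ⊕ (⊖ b₀) ≡ b
            gain-eq b = Solver.solve (b ∷ b₀ ∷ []) ((v0 ⊞ v1) ⊞ (⊟ v1)) v0 refl
          pulled : ∀ x → proper x (map (move τ) A) ≡ proper (x [ w ]≔ βw x) A
          pulled x = trans (allᵇ-map (ok x) (move τ) A) (trans (allᵇ-cong-∈ A (λ {e} → each {e})) (cong (λ y → proper y A) (pull-τ x)))
            where
            root-≢ : ∀ i j → i ≢ v → j ≢ v → does (root τ i Fin.≟ root τ j) ≡ does (i Fin.≟ j)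
            root-≢ i j i≢v j≢v with i Fin.≟ w | j Fin.≟ w
            ... | yes refl | yes refl = trans (dec-true (v Fin.≟ v) refl) (sym (dec-true (w Fin.≟ w) refl))
            ... | yes refl | no j≢w   = trans (dec-false (v Fin.≟ j) (j≢v ∘ sym)) (sym (dec-false (w Fin.≟ j) (j≢w ∘ sym)))
            ... | no i≢w   | yes refl = trans (dec-false (i Fin.≟ v) i≢v) (sym (dec-false (i Fin.≟ w) i≢w))
            ... | no _     | no _     = refl
            each : ∀ {e} → e ∈ A → ok x (move τ e) ≡ ok (pull x τ) e
            each {i , j , a} e∈ = cong₂ (λ b c → b ∨ not c) (root-≢ i j (proj₁ (A-avoids e∈)) (proj₂ (A-avoids e∈))) (sat-move x τ (i , j , a))

        -- Both sides are computed up to the common factor M₀.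
        attached-star-sum : M₀ ≢ 0ℤ →
          size * ∑ xs (λ x → h x * ⟦ proper x AS ⟧) ≡ deg * ∑ xs (λ x → h x * ⟦ proper x (map (move τ) A) ⟧)
        attached-star-sum M₀≢0 = ℤ.*-cancelˡ-≡ M₀ _ _ {{ℤ.≢-nonZero M₀≢0}}
          (trans star-side (trans (rearrange size deg _) (trans (cong (deg *_) (sym moved-side)) (swap deg M₀ _))))
          where
          swap : ∀ a b c → a * (b * c) ≡ b * (a * c)
          swap = solve-∀
          rearrange : ∀ a b c → (a * b) * c ≡ b * (a * c)
          rearrange = solve-∀

  -- Chains of contractions

  private variable
    n m : ℕ

  Loop : Triple n → Set
  Loop (i , j , a) = i ≡ j

  flip-flip : (e : Triple n) → flip (flip e) ≡ e
  flip-flip (i , j , a) = cong (λ b → i , j , b) (Solver.solve (a ∷ []) (⊟ (⊟ v0)) v0 refl)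

  flip-loop : (e : Triple n) → Loop e → Loop (flip e)
  flip-loop (i , j , a) = sym

  move-flip : (ξ : Relabelling n m) (e : Triple n) → move ξ (flip e) ≡ flip (move ξ e)
  move-flip ξ (i , j , a) = cong (λ b → root ξ j , root ξ i , b)
    (Solver.solve (a ∷ gain ξ i ∷ gain ξ j ∷ []) (((⊟ v0) ⊞ v1) ⊞ (⊟ v2)) (⊟ ((v0 ⊞ v2) ⊞ (⊟ v1))) refl)

  ∈±-flip : ∀ {e : Triple n} {L} → flip e ∈± L → e ∈± L
  ∈±-flip (inj₁ p) = inj₂ p
  ∈±-flip {e = e} {L} (inj₂ p) = inj₁ (subst (_∈ L) (flip-flip e) p)

  infix 4 _⊑_ _≋_
  -- Equality of graphs up to orientation of edges and up to loops.
  _⊑_ : List (Triple n) → List (Triple n) → Set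
  L ⊑ M = ∀ {e} → e ∈ L → Loop e ⊎ e ∈± M

  _≋_ : List (Triple n) → List (Triple n) → Set
  L ≋ M = (L ⊑ M) × (M ⊑ L)

  ⊑-∈± : ∀ {L M : List (Triple n)} → L ⊑ M → ∀ {e} → e ∈± L → Loop e ⊎ e ∈± M
  ⊑-∈± h (inj₁ p) = h p
  ⊑-∈± h {e} (inj₂ p) with h p
  ... | inj₁ l = inj₁ (subst Loop (flip-flip e) (flip-loop (flip e) l))
  ... | inj₂ q = inj₂ (∈±-flip q)

  ⊑-trans : ∀ {L M N : List (Triple n)} → L ⊑ M → M ⊑ N → L ⊑ N
  ⊑-trans h h′ e∈ with h e∈
  ... | inj₁ l = inj₁ l
  ... | inj₂ p = ⊑-∈± h′ p

  ≋-trans : ∀ {L M N : List (Triple n)} → L ≋ M → M ≋ N → L ≋ N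
  ≋-trans (a , b) (c , d) = ⊑-trans a c , ⊑-trans d b

  ≋-sym : ∀ {L M : List (Triple n)} → L ≋ M → M ≋ L
  ≋-sym (a , b) = b , a

  move-∈± : (ξ : Relabelling n m) {e : Triple n} {L : List (Triple n)} → e ∈± L → move ξ e ∈± map (move ξ) L
  move-∈± ξ (inj₁ p) = inj₁ (Mem.∈-map⁺ (move ξ) p)
  move-∈± ξ {e} {L} (inj₂ p) = inj₂ (subst (_∈ map (move ξ) L) (move-flip ξ e) (Mem.∈-map⁺ (move ξ) p))

  move-⊑ : (ξ : Relabelling n m) {L M : List (Triple n)} → L ⊑ M → map (move ξ) L ⊑ map (move ξ) M
  move-⊑ ξ h e∈ with Mem.∈-map⁻ (move ξ) e∈
  ... | e′ , e′∈ , refl with h e′∈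
  ...   | inj₁ l = inj₁ (cong (root ξ) l)
  ...   | inj₂ p = inj₂ (move-∈± ξ p)

  move-≋ : (ξ : Relabelling n m) {L M : List (Triple n)} → L ≋ M → map (move ξ) L ≋ map (move ξ) M
  move-≋ ξ (a , b) = move-⊑ ξ a , move-⊑ ξ b

  ++-⊑ : ∀ {L M N : List (Triple n)} → L ⊑ N → M ⊑ N → (L ++ M) ⊑ N
  ++-⊑ {L = L} a b e∈ with Mem.∈-++⁻ L e∈
  ... | inj₁ p = a p
  ... | inj₂ p = b p

  ∈±-++ˡ : ∀ {e : Triple n} {L M} → e ∈± L → e ∈± (L ++ M)
  ∈±-++ˡ (inj₁ p) = inj₁ (Mem.∈-++⁺ˡ p)
  ∈±-++ˡ (inj₂ p) = inj₂ (Mem.∈-++⁺ˡ p)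

  ∈±-++ʳ : ∀ {e : Triple n} L {M} → e ∈± M → e ∈± (L ++ M)
  ∈±-++ʳ L (inj₁ p) = inj₁ (Mem.∈-++⁺ʳ L p)
  ∈±-++ʳ L (inj₂ p) = inj₂ (Mem.∈-++⁺ʳ L p)

  ⊑-++ˡ : ∀ {L M N : List (Triple n)} → L ⊑ M → L ⊑ (M ++ N)
  ⊑-++ˡ h e∈ with h e∈
  ... | inj₁ l = inj₁ l
  ... | inj₂ p = inj₂ (∈±-++ˡ p)

  ⊑-++ʳ : ∀ {L M : List (Triple n)} N → L ⊑ M → L ⊑ (N ++ M)
  ⊑-++ʳ N h e∈ with h e∈
  ... | inj₁ l = inj₁ l
  ... | inj₂ p = inj₂ (∈±-++ʳ N p)

  ⊑-refl : ∀ {L : List (Triple n)} → L ⊑ L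
  ⊑-refl e∈ = inj₂ (inj₁ e∈)

  move-off : ∀ {w : Fin n} {v a i j b} → i ≢ w → j ≢ w → move (contract w v a) (i , j , b) ≡ (i , j , b)
  move-off {w = w} {v} {a} {i} {j} {b} i≢w j≢w rewrite contract-off {w = w} {v} {a} i≢w | contract-off {w = w} {v} {a} j≢w =
    cong (λ g → i , j , g) (Solver.solve (b ∷ []) ((v0 ⊞ nil) ⊞ (⊟ nil)) v0 refl)

  length-palette : ∀ q → length (elements (Palette.enum (palette q))) ≡ q ℕ.* k
  length-palette q = trans (length-product (allFin q) (allFin k)) (cong₂ ℕ._*_ (length-allFin q) (length-allFin k))

  size : ℕ → ℤ
  size q = pos (q ℕ.* k)

  size-palette : ∀ q → Averaging.size (Palette.enum (palette q)) ≡ size q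
  size-palette q = cong pos (length-palette q)

  number : ℕ → List (Triple n) → ℤ
  number q L = ∑ (Proper.colourings (palette q) _) (λ x → ⟦ Proper.proper (palette q) x L ⟧)

  module _ (P : Palette) where
    open Proper P

    proper-⊑ : (x : Vec (Palette.Colour P) n) {L M : List (Triple n)} → L ⊑ M → proper x M ≡ true → proper x L ≡ true
    proper-⊑ x {L} h pM = allᵇ-intro-∈ (ok x) L each
      where
      each : ∀ {e} → e ∈ L → ok x e ≡ true
      each {i , j , a} e∈ with h e∈
      ... | inj₁ l = ∨-introˡ (dec-true (i Fin.≟ j) l)
      ... | inj₂ p = proper-∈± x pM p

    proper-≋ : (x : Vec (Palette.Colour P) n) {L M : List (Triple n)} → L ≋ M → proper x L ≡ proper x M
    proper-≋ x {L} {M} (a , b) = true⇔⇒≡ (proper-⊑ x {M} {L} b) (proper-⊑ x {L} {M} a)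

  number-≋ : ∀ q {L M : List (Triple n)} → L ≋ M → number q L ≡ number q M
  number-≋ q h = ∑-cong (Proper.colourings (palette q) _) (λ x → cong ⟦_⟧ (proper-≋ (palette q) x h))

  -- The factor `size q` on the left is due to the contracted vertex w, which remains in `Fin n` as
  -- an isolated vertex with free colour. The degree d must be the same for every q, as it becomes
  -- the root of a linear polynomial factor.
  data Chain {n : ℕ} : List (Triple n) → List (Triple n) → Set where
    done : ∀ {L M} → L ≋ M → Chain L M
    step : ∀ {L M} w v a d → w ≢ v → (w , v , a) ∈± L →
           (∀ q → n ℕ.< q → size q * number q L ≡ (size q - pos d) * number q (map (move (contract w v a)) L)) →
           Chain (map (move (contract w v a)) L) M → Chain L M

  respects : ∀ {L L′ M : List (Triple n)} → L′ ≋ L → Chain L M → Chain L′ M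
  respects e (done f) = done (≋-trans e f)
  respects {L = L} {L′} e (step w v a d w≢v wv∈ counts rest) = step w v a d w≢v wv∈′
    (λ q n<q → trans (cong (size q *_) (number-≋ q e)) (trans (counts q n<q) (cong ((size q - pos d) *_) (number-≋ q (move-≋ τ (≋-sym e))))))
    (respects (move-≋ τ e) rest)
    where
    τ = contract w v a
    wv∈′ : (w , v , a) ∈± L′
    wv∈′ with ⊑-∈± (proj₂ e) wv∈
    ... | inj₁ l = contradiction l w≢v
    ... | inj₂ p = p

  append : ∀ {L M N : List (Triple n)} → Chain L M → Chain M N → Chain L N
  append (done e) c = respects e c
  append (step w v a d w≢v wv∈ counts rest) c = step w v a d w≢v wv∈ counts (append rest c)

  module _ {A : List (Triple n)} {w S} (simp : Simplicial A w S) (L′ : List (Triple n)) where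
    open Simplicial simp

    star-∈ : ∀ {e} → e ∈ star w S → ∃ λ s → s ∈ S × e ≡ (w , proj₁ s , proj₂ s)
    star-∈ e∈ with Mem.∈-map⁻ _ e∈
    ... | (j , b) , s∈ , eq = (j , b) , s∈ , eq

    -- The star edge (w , j , b) becomes (u , j , b - β), which is in A by simpliciality, or a loop
    -- when j = u; the other edges avoid w.
    contract-centre : ∀ {u β} → (u , β) ∈ S → Avoids w L′ →
                      map (move (contract w u β)) ((A ++ star w S) ++ L′) ≋ (A ++ L′)
    contract-centre {u} {β} uβ∈ L′-avoids = forward , backward
      where
      τ = contract w u β
      fixed : ∀ {e} {L : List (Triple n)} → Avoids w L → e ∈ L → move τ e ≡ e
      fixed {i , j , b} av e∈ = move-off (proj₁ (av e∈)) (proj₂ (av e∈))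
      forward : map (move τ) ((A ++ star w S) ++ L′) ⊑ (A ++ L′)
      forward e∈ with Mem.∈-map⁻ (move τ) e∈
      ... | e , e∈′ , refl with Mem.∈-++⁻ (A ++ star w S) e∈′
      ...   | inj₂ p = inj₂ (inj₁ (Mem.∈-++⁺ʳ A (subst (_∈ L′) (sym (fixed L′-avoids p)) p)))
      ...   | inj₁ p with Mem.∈-++⁻ A p
      ...     | inj₁ p′ = inj₂ (inj₁ (Mem.∈-++⁺ˡ (subst (_∈ A) (sym (fixed A-avoids p′)) p′)))
      ...     | inj₂ p′ with star-∈ p′
      ...       | (j , b) , s∈ , refl rewrite contract-at w u β | contract-off {w = w} {u} {β} (S-avoids s∈) with u Fin.≟ j
      ...         | yes u≡j = inj₁ u≡j
      ...         | no  u≢j = inj₂ (∈±-++ˡ (subst (λ g → (u , j , g) ∈± A)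
                      (Solver.solve (b ∷ β ∷ []) (v0 ⊞ (⊟ v1)) ((v0 ⊞ nil) ⊞ (⊟ v1)) refl) (closed uβ∈ s∈ u≢j)))
      backward : (A ++ L′) ⊑ map (move τ) ((A ++ star w S) ++ L′)
      backward {e} e∈ with Mem.∈-++⁻ A e∈
      ... | inj₁ p = inj₂ (inj₁ (subst (_∈ map (move τ) ((A ++ star w S) ++ L′)) (fixed A-avoids p)
                       (Mem.∈-map⁺ (move τ) (Mem.∈-++⁺ˡ (Mem.∈-++⁺ˡ p)))))
      ... | inj₂ p = inj₂ (inj₁ (subst (_∈ map (move τ) ((A ++ star w S) ++ L′)) (fixed L′-avoids p)
                       (Mem.∈-map⁺ (move τ) (Mem.∈-++⁺ʳ (A ++ star w S) p))))

    -- With u moved onto w, the star edge (w , j , b) coincides with the image of the edge (u , j ,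
    -- b - β) of A, so the star adds nothing but loops.
    contract-leaf : ∀ {u β} → (u , β) ∈ S → Avoids u L′ →
                    map (move (contract u w (⊖ β))) ((A ++ star w S) ++ L′) ≋ (map (move (contract u w (⊖ β))) A ++ L′)
    contract-leaf {u} {β} uβ∈ L′-avoids = forward , backward
      where
      τ = contract u w (⊖ β)
      u≢w : u ≢ w
      u≢w = S-avoids uβ∈
      fixed : ∀ {e} → e ∈ L′ → move τ e ≡ e
      fixed {i , j , b} e∈ = move-off (proj₁ (L′-avoids e∈)) (proj₂ (L′-avoids e∈))
      forward : map (move τ) ((A ++ star w S) ++ L′) ⊑ (map (move τ) A ++ L′)
      forward e∈ with Mem.∈-map⁻ (move τ) e∈
      ... | e , e∈′ , refl with Mem.∈-++⁻ (A ++ star w S) e∈′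
      ...   | inj₂ p = inj₂ (inj₁ (Mem.∈-++⁺ʳ (map (move τ) A) (subst (_∈ L′) (sym (fixed p)) p)))
      ...   | inj₁ p with Mem.∈-++⁻ A p
      ...     | inj₁ p′ = inj₂ (inj₁ (Mem.∈-++⁺ˡ (Mem.∈-map⁺ (move τ) p′)))
      ...     | inj₂ p′ with star-∈ p′
      ...       | (j , b) , s∈ , refl = image s∈ (j Fin.≟ u)
        where
        image : ∀ {j b} → (j , b) ∈ S → Dec (j ≡ u) → Loop (move τ (w , j , b)) ⊎ move τ (w , j , b) ∈± (map (move τ) A ++ L′)
        image s∈ (yes refl) = inj₁ (trans (cong proj₁ (contract-off {w = u} {w} {⊖ β} (u≢w ∘ sym))) (sym (cong proj₁ (contract-at u w (⊖ β)))))
        image {j} {b} s∈ (no j≢u) = inj₂ (∈±-++ˡ (subst (_∈± map (move τ) A) moved (move-∈± τ (closed uβ∈ s∈ (j≢u ∘ sym)))))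
         where
         moved : move τ (u , j , b ⊕ (⊖ β)) ≡ move τ (w , j , b)
         moved rewrite contract-at u w (⊖ β) | contract-off {w = u} {w} {⊖ β} (u≢w ∘ sym) =
          cong (λ g → w , root τ j , g) (Solver.solve (b ∷ β ∷ gain τ j ∷ []) (((v0 ⊞ (⊟ v1)) ⊞ v2) ⊞ (⊟ (⊟ v1))) ((v0 ⊞ v2) ⊞ (⊟ nil)) refl)
      backward : (map (move τ) A ++ L′) ⊑ map (move τ) ((A ++ star w S) ++ L′)
      backward {e} e∈ with Mem.∈-++⁻ (map (move τ) A) e∈
      ... | inj₁ p with Mem.∈-map⁻ (move τ) p
      ...   | e′ , e′∈ , refl = inj₂ (inj₁ (Mem.∈-map⁺ (move τ) (Mem.∈-++⁺ˡ (Mem.∈-++⁺ˡ e′∈))))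
      backward {e} e∈ | inj₂ p = inj₂ (inj₁ (subst (_∈ map (move τ) ((A ++ star w S) ++ L′)) (fixed p)
                       (Mem.∈-map⁺ (move τ) (Mem.∈-++⁺ʳ (A ++ star w S) p))))

    number-++ : ∀ q (M : List (Triple n)) → number q (M ++ L′) ≡
      ∑ (Proper.colourings (palette q) n) (λ x → ⟦ Proper.proper (palette q) x L′ ⟧ * ⟦ Proper.proper (palette q) x M ⟧)
    number-++ q M = ∑-cong (Proper.colourings (palette q) n) (λ x → trans (cong ⟦_⟧ (allᵇ-++ (Proper.ok (palette q) x) M L′))
      (trans (⟦∧⟧ (Proper.proper (palette q) x M) _) (ℤ.*-comm ⟦ Proper.proper (palette q) x M ⟧ _)))

    Chain-centre : ∀ {u β} → (u , β) ∈ S → Avoids w L′ → Chain (A ++ L′) L′ → Chain ((A ++ star w S) ++ L′) L′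
    Chain-centre {u} {β} uβ∈ L′-avoids c = step w u β (length S) (S-avoids uβ∈ ∘ sym)
        (∈±-++ˡ (∈±-++ʳ A (inj₁ (Mem.∈-map⁺ _ uβ∈)))) counts (respects (contract-centre uβ∈ L′-avoids) c)
      where
      counts : ∀ q → n ℕ.< q → size q * number q ((A ++ star w S) ++ L′) ≡
               (size q - pos (length S)) * number q (map (move (contract w u β)) ((A ++ star w S) ++ L′))
      counts q _ = begin
        size q * number q ((A ++ star w S) ++ L′) ≡⟨ cong₂ _*_ (sym (size-palette q)) (number-++ q (A ++ star w S)) ⟩
        _ ≡⟨ AtSimplicial.weighted-star-sum simp (λ x → ⟦ proper x L′ ⟧) free-w ⟩
        _ ≡⟨ cong₂ _*_ (cong (_- pos (length S)) (size-palette q)) (sym (number-++ q A)) ⟩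
        (size q - pos (length S)) * number q (A ++ L′) ≡⟨ cong ((size q - pos (length S)) *_) (number-≋ q (≋-sym (contract-centre uβ∈ L′-avoids))) ⟩
        _ ∎
        where
        open ≡-Reasoning
        open Proper (palette q)
        free-w : ∀ x c → ⟦ proper (x [ w ]≔ c) L′ ⟧ ≡ ⟦ proper x L′ ⟧
        free-w x c = cong ⟦_⟧ (proper-cong (x [ w ]≔ c) x L′ (λ e∈ →
          Vec.lookup∘updateAt′ _ w (proj₁ (L′-avoids e∈)) x , Vec.lookup∘updateAt′ _ w (proj₂ (L′-avoids e∈)) x))

    Chain-leaf : (0<k : 0 ℕ.< k) (U₀ V′ : Fin n → Bool)
      (A⊆U₀ : ∀ {i j a} → (i , j , a) ∈ A → U₀ i ≡ true × U₀ j ≡ true)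
      (S⊆U₀ : ∀ {j b} → (j , b) ∈ S → U₀ j ≡ true)
      (w∈V′ : V′ w ≡ true) (complete : ∀ j → U₀ j ≡ true → V′ j ≡ true → ∀ b → (j , b) ∈ S)
      (L′⊆V′ : ∀ {i j a} → (i , j , a) ∈ L′ → V′ i ≡ true × V′ j ≡ true)
      (shared : ∀ j → U₀ j ≡ true → V′ j ≡ true → ∀ b → (w , j , b) ∈± L′) →
      ∀ {u β} → (u , β) ∈ S → V′ u ≡ false →
      Chain (map (move (contract u w (⊖ β))) A ++ L′) L′ → Chain ((A ++ star w S) ++ L′) L′
    Chain-leaf 0<k U₀ V′ A⊆U₀ S⊆U₀ w∈V′ complete L′⊆V′ shared {u} {β} uβ∈ u∉V′ c =
      step u w (⊖ β) (length S) (S-avoids uβ∈) (∈±-++ˡ (∈±-++ʳ A (inj₂ flipped∈))) counts (respects (contract-leaf uβ∈ L′-avoids) c)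
      where
      flipped∈ : flip (u , w , ⊖ β) ∈ star w S
      flipped∈ = subst (_∈ star w S) (sym (cong (λ b → w , u , b) (Solver.solve (β ∷ []) (⊟ (⊟ v0)) v0 refl))) (Mem.∈-map⁺ _ uβ∈)
      outside-u : ∀ {i} → V′ i ≡ true → i ≢ u
      outside-u i∈ refl = case trans (sym u∉V′) i∈ of λ ()
      L′-avoids : Avoids u L′
      L′-avoids e∈ = outside-u (proj₁ (L′⊆V′ e∈)) , outside-u (proj₂ (L′⊆V′ e∈))
      counts : ∀ q → n ℕ.< q → size q * number q ((A ++ star w S) ++ L′) ≡
               (size q - pos (length S)) * number q (map (move (contract u w (⊖ β))) ((A ++ star w S) ++ L′))
      counts q n<q = begin
        size q * number q ((A ++ star w S) ++ L′) ≡⟨ cong₂ _*_ (sym (size-palette q)) (number-++ q (A ++ star w S)) ⟩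
        _ ≡⟨ attached-star-sum (λ x → ⟦ proper x L′ ⟧) h-dep h-clear M₀≢0 ⟩
        _ ≡⟨ cong₂ _*_ (cong (_- pos (length S)) (size-palette q)) (sym (number-++ q (map (move (contract u w (⊖ β))) A))) ⟩
        (size q - pos (length S)) * number q (map (move (contract u w (⊖ β))) A ++ L′) ≡⟨ cong ((size q - pos (length S)) *_) (number-≋ q (≋-sym (contract-leaf uβ∈ L′-avoids))) ⟩
        _ ∎
        where
        open ≡-Reasoning
        open Proper (palette q)
        open AtAttached simp U₀ V′ A⊆U₀ S⊆U₀ w∈V′ complete uβ∈ u∉V′
        h-dep : ∀ x y → (∀ j → V′ j ≡ true → lookup x j ≡ lookup y j) → ⟦ proper x L′ ⟧ ≡ ⟦ proper y L′ ⟧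
        h-dep x y e = cong ⟦_⟧ (proper-cong x y L′ (λ e∈ → e _ (proj₁ (L′⊆V′ e∈)) , e _ (proj₂ (L′⊆V′ e∈))))
        h-clear : ∀ x → ⟦ proper x L′ ⟧ ≡ 0ℤ ⊎ avoid (lookup x w) (keys x T₀) ≡ true
        h-clear x with proper x L′ in p
        ... | false = inj₁ refl
        ... | true  = inj₂ (avoid-intro x T₀ (λ { {j , b} s∈ → let j∈U , j∈V = T₀⁻ s∈ in
                ok-elim x (λ { refl → S-avoids (complete w j∈U j∈V b) refl }) (proper-∈± x p (shared j j∈U j∈V b)) }))
        -- At most n k pairs are forbidden, and there are q k colours.
        M₀≢0 : M₀ ≢ 0ℤ
        M₀≢0 e = ℕ.<-irrefl (sym (ℤ.+-injective (trans (sym (size-palette q)) (ℤ.i-j≡0⇒i≡j _ _ e))))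
          (ℕ.≤-<-trans (selectPairs-length shared₀) (ℕ.*-monoˡ-< k {{ℕ.>-nonZero 0<k}} n<q))
          where
          shared₀ : Fin n × Fin k → Bool
          shared₀ (j , b) = U₀ j ∧ V′ j

-- Linear independence of the defining forms

module SubgroupGains {c ℓ} (K : CommutativeRing c ℓ) {k : ℕ} (G : FinSubgroup K k) where
  private module K = CommutativeRing K
  open FinSubgroup G

  _⊕_ : Fin k → Fin k → Fin k
  a ⊕ b = proj₁ (closed+ a b)

  ε : Fin k
  ε = proj₁ hasZero

  ⊖_ : Fin k → Fin k
  ⊖ a = proj₁ (closed- a)

  gs-⊕ : ∀ a b → gs (a ⊕ b) K.≈ gs a K.+ gs b
  gs-⊕ a b = proj₂ (closed+ a b)

  gs-ε : gs ε K.≈ K.0#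
  gs-ε = proj₂ hasZero

  gs-⊖ : ∀ a → gs (⊖ a) K.≈ K.- gs a
  gs-⊖ a = proj₂ (closed- a)

  -- The laws hold in K up to its equality; as the indices enumerate the subgroup without
  -- repetition, they hold strictly on indices.
  isAbelianGroup : IsAbelianGroup _≡_ _⊕_ ε ⊖_
  isAbelianGroup = record
    { isGroup = record
      { isMonoid = record
        { isSemigroup = record
          { isMagma = record { isEquivalence = isEquivalence ; ∙-cong = cong₂ _⊕_ }
          ; assoc = λ a b d → distinct _ _ (K.trans (gs-⊕ _ d) (K.trans (K.+-congʳ (gs-⊕ a b))
              (K.trans (K.+-assoc _ _ _) (K.sym (K.trans (gs-⊕ a _) (K.+-congˡ (gs-⊕ b d))))))) }
        ; identity = (λ a → distinct _ _ (K.trans (gs-⊕ ε a) (K.trans (K.+-congʳ gs-ε) (K.+-identityˡ _))))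
                   , (λ a → distinct _ _ (K.trans (gs-⊕ a ε) (K.trans (K.+-congˡ gs-ε) (K.+-identityʳ _)))) }
      ; inverse = (λ a → distinct _ _ (K.trans (gs-⊕ _ a) (K.trans (K.+-congʳ (gs-⊖ a)) (K.trans (K.-‿inverseˡ _) (K.sym gs-ε)))))
                , (λ a → distinct _ _ (K.trans (gs-⊕ a _) (K.trans (K.+-congˡ (gs-⊖ a)) (K.trans (K.-‿inverseʳ _) (K.sym gs-ε)))))
      ; ⁻¹-cong = cong ⊖_ }
    ; comm = λ a b → distinct _ _ (K.trans (gs-⊕ a b) (K.trans (K.+-comm _ _) (K.sym (gs-⊕ b a)))) }

  0<k : 0 ℕ.< k
  0<k = ℕ.≤-<-trans z≤n (Fin.toℕ<n ε)

  gs≈0⇒ε : ∀ a → gs a K.≈ K.0# → a ≡ ε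
  gs≈0⇒ε a h = distinct a ε (K.trans h (K.sym gs-ε))

search : ∀ {m} (p : Fin m → Bool) → (Σ (Fin m) λ i → p i ≡ true) ⊎ (∀ i → p i ≡ false)
search {zero}  p = inj₂ λ ()
search {suc m} p with p Fin.zero in eq | search (p ∘ Fin.suc)
... | true  | _             = inj₁ (Fin.zero , eq)
... | false | inj₁ (i , pi) = inj₁ (Fin.suc i , pi)
... | false | inj₂ none     = inj₂ λ { Fin.zero → eq ; (Fin.suc i) → none i }

∣∣-remove : ∀ {m} (S : Subset m) i → mem i S ≡ true → ∣ S ∣ ≡ suc ∣ S [ i ]≔ false ∣
∣∣-remove (true  ∷ S) Fin.zero    h = refl
∣∣-remove (true  ∷ S) (Fin.suc i) h = cong suc (∣∣-remove S i h)
∣∣-remove (false ∷ S) (Fin.suc i) h = ∣∣-remove S i h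

∣∣-insert : ∀ {m} (S : Subset m) i → mem i S ≡ false → ∣ S [ i ]≔ true ∣ ≡ suc ∣ S ∣
∣∣-insert (false ∷ S) Fin.zero    h = refl
∣∣-insert (true  ∷ S) (Fin.suc i) h = cong suc (∣∣-insert S i h)
∣∣-insert (false ∷ S) (Fin.suc i) h = ∣∣-insert S i h

∣∣-empty : ∀ {m} (S : Subset m) → (∀ i → mem i S ≡ false) → ∣ S ∣ ≡ 0
∣∣-empty {m} S h = trans (cong ∣_∣ (subset-ext {X = S} {⊥} (λ i → trans (h i) (sym (mem-⊥ i))))) (Sub.∣⊥∣≡0 m)

mem-set-≢ : ∀ {m} (S : Subset m) {i j} b → ¬ j ≡ i → mem j (S [ i ]≔ b) ≡ mem j S
mem-set-≢ S b j≢i = Vec.lookup∘updateAt′ _ _ j≢i S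

mem-set : ∀ {m} (S : Subset m) i b → mem i (S [ i ]≔ b) ≡ b
mem-set S i b = Vec.lookup∘updateAt i S

mem-removed : ∀ {m} (S : Subset m) {i j} → mem j (S [ i ]≔ false) ≡ true → (¬ j ≡ i) × mem j S ≡ true
mem-removed S {i} {j} h with j Fin.≟ i
... | yes refl = case trans (sym (mem-set S i false)) h of λ ()
... | no  j≢i  = j≢i , trans (sym (mem-set-≢ S false j≢i)) h

∈-allSubsets : ∀ {m} (S : Subset m) → S ∈ allSubsets m
∈-allSubsets []          = here refl
∈-allSubsets {suc m} (false ∷ S) = Mem.∈-++⁺ˡ (Mem.∈-map⁺ (outside ∷_) (∈-allSubsets S))
∈-allSubsets {suc m} (true  ∷ S) = Mem.∈-++⁺ʳ (map (outside ∷_) (allSubsets m)) (Mem.∈-map⁺ (inside ∷_) (∈-allSubsets S))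

module _ {A : Set} (p : A → Bool) (h : A → ℕ) where

  maxL-bound : ∀ xs {x} → x ∈ xs → p x ≡ true → h x ℕ.≤ maxL (map h (filterᵇ p xs))
  maxL-bound (y ∷ xs) (here refl) px rewrite px = ℕ.m≤m⊔n (h y) _
  maxL-bound (y ∷ xs) (there x∈) px with p y
  ... | true  = ℕ.≤-trans (maxL-bound xs x∈ px) (ℕ.m≤n⊔m (h y) _)
  ... | false = maxL-bound xs x∈ px

  maxL-attained : ∀ xs → (Σ A λ x → p x ≡ true × h x ≡ maxL (map h (filterᵇ p xs))) ⊎ maxL (map h (filterᵇ p xs)) ≡ 0
  maxL-attained [] = inj₂ refl
  maxL-attained (y ∷ xs) with p y in py
  ... | false = maxL-attained xs
  ... | true with ℕ.≤-total (h y) (maxL (map h (filterᵇ p xs)))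
  ...   | inj₂ ≥ = inj₁ (y , py , sym (ℕ.m≥n⇒m⊔n≡m ≥))
  ...   | inj₁ ≤ rewrite ℕ.m≤n⇒m⊔n≡n ≤ = maxL-attained xs

module _ {m : ℕ} (ind : Subset m → Bool) where

  rankOf-bound : ∀ S B → (B ⊆ᵇ S) ≡ true → ind B ≡ true → ∣ B ∣ ℕ.≤ rankOf ind S
  rankOf-bound S B B⊆S indB = maxL-bound _ ∣_∣ (allSubsets m) (∈-allSubsets B) (∧-intro B⊆S indB)

  rankOf-attained : ind ⊥ ≡ true → ∀ S → Σ (Subset m) λ B → (B ⊆ᵇ S) ≡ true × ind B ≡ true × ∣ B ∣ ≡ rankOf ind S
  rankOf-attained ind⊥ S with maxL-attained (λ B → (B ⊆ᵇ S) ∧ ind B) ∣_∣ (allSubsets m)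
  ... | inj₁ (B , h , e) = B , proj₁ (∧-true h) , proj₂ (∧-true {B ⊆ᵇ S} h) , e
  ... | inj₂ e = ⊥ , ⊥⊆ᵇ S , ind⊥ , trans (Sub.∣⊥∣≡0 m) (sym e)

mem-─ : ∀ {m} (X Y : Subset m) i → mem i (X Sub.─ Y) ≡ mem i X ∧ not (mem i Y)
mem-─ (x ∷ X) (true  ∷ Y) Fin.zero    = sym (Bool.∧-zeroʳ x)
mem-─ (x ∷ X) (false ∷ Y) Fin.zero    = sym (Bool.∧-identityʳ x)
mem-─ (x ∷ X) (y ∷ Y)     (Fin.suc i) = mem-─ X Y i

module Arrangement {c ℓ} (K : CommutativeRing c ℓ) (isField : IsField K) {k : ℕ} (G : FinSubgroup K k) where
  private module K = CommutativeRing K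
  open FinSubgroup G using (gs)
  open SubgroupGains K G
  open Gains _⊕_ ε ⊖_ isAbelianGroup
  open GainGraphs K G

  module Linear where
    open K using (Carrier; _≈_; 0#; 1#)
    open import Algebra.Properties.Ring K.ring using (-0#≈0#; -‿distribʳ-*; -‿distribˡ-*; -‿involutive; -‿+-comm)
    open import Relation.Binary.Reasoning.Setoid K.setoid

    sumK-cong : ∀ {m} {h h′ : Fin m → Carrier} → (∀ i → h i ≈ h′ i) → sumK K h ≈ sumK K h′
    sumK-cong {zero}  e = K.refl
    sumK-cong {suc m} e = K.+-cong (e Fin.zero) (sumK-cong (e ∘ Fin.suc))

    sumK-zero : ∀ {m} {h : Fin m → Carrier} → (∀ i → h i ≈ 0#) → sumK K h ≈ 0#
    sumK-zero {zero}  e = K.refl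
    sumK-zero {suc m} e = K.trans (K.+-cong (e Fin.zero) (sumK-zero (e ∘ Fin.suc))) (K.+-identityˡ _)

    +-interchange : ∀ a b d e → (a K.+ b) K.+ (d K.+ e) ≈ (a K.+ d) K.+ (b K.+ e)
    +-interchange a b d e = begin
      (a K.+ b) K.+ (d K.+ e) ≈⟨ K.+-assoc _ _ _ ⟩
      a K.+ (b K.+ (d K.+ e)) ≈⟨ K.+-congˡ (K.sym (K.+-assoc _ _ _)) ⟩
      a K.+ ((b K.+ d) K.+ e) ≈⟨ K.+-congˡ (K.+-congʳ (K.+-comm _ _)) ⟩
      a K.+ ((d K.+ b) K.+ e) ≈⟨ K.+-congˡ (K.+-assoc _ _ _) ⟩
      a K.+ (d K.+ (b K.+ e)) ≈⟨ K.sym (K.+-assoc _ _ _) ⟩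
      (a K.+ d) K.+ (b K.+ e) ∎

    sumK-+ : ∀ {m} (h h′ : Fin m → Carrier) → sumK K (λ i → h i K.+ h′ i) ≈ sumK K h K.+ sumK K h′
    sumK-+ {zero}  h h′ = K.sym (K.+-identityˡ _)
    sumK-+ {suc m} h h′ = K.trans (K.+-congˡ (sumK-+ (h ∘ Fin.suc) (h′ ∘ Fin.suc))) (+-interchange _ _ _ _)

    sumK-* : ∀ {m} a (h : Fin m → Carrier) → sumK K (λ i → a K.* h i) ≈ a K.* sumK K h
    sumK-* {zero}  a h = K.sym (K.zeroʳ a)
    sumK-* {suc m} a h = K.trans (K.+-congˡ (sumK-* a (h ∘ Fin.suc))) (K.sym (K.distribˡ _ _ _))

    single : ∀ {m} → Fin m → Carrier → Fin m → Carrier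
    single i a j = if does (j Fin.≟ i) then a else 0#

    single-self : ∀ {m} (i : Fin m) a → single i a i ≡ a
    single-self i a rewrite dec-true (i Fin.≟ i) refl = refl

    single-other : ∀ {m} {i j : Fin m} a → ¬ j ≡ i → single i a j ≡ 0#
    single-other {i = i} {j} a j≢i rewrite dec-false (j Fin.≟ i) j≢i = refl

    sumK-single : ∀ {m} i a (h : Fin m → Carrier) → sumK K (λ j → single i a j K.* h j) ≈ a K.* h i
    sumK-single {suc m} Fin.zero a h = K.trans (K.+-congˡ (sumK-zero {m} (λ j → K.zeroˡ _))) (K.+-identityʳ _)
    sumK-single (Fin.suc i) a h = K.trans (K.+-cong (K.zeroˡ _) (sumK-single i a (h ∘ Fin.suc))) (K.+-identityˡ _)

    -- Multiples of z and edges are closed under eliminating a vertex. A constant carries a decision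
    -- whether it vanishes, since equality in K need not be decidable; the constants that arise are
    -- 1, 0 and negated gains.
    data Form (n : ℕ) : Set (c ⊔ ℓ) where
      const : (a : Carrier) → Dec (a ≈ 0#) → Form n
      edge  : Triple n → Form n

    lin : ∀ {n} → Form n → Fin (suc n) → Carrier
    lin (const a _) Fin.zero    = a
    lin (const a _) (Fin.suc _) = 0#
    lin (edge (i , j , a))      = formE i j a

    Covector : ℕ → Set c
    Covector n = Fin (suc n) → Carrier

    comb : ∀ {m n} → (Fin m → Covector n) → (Fin m → Carrier) → Covector n
    comb f coef j = sumK K (λ i → coef i K.* f i j)

    Supported : ∀ {m} → Subset m → (Fin m → Carrier) → Set ℓ
    Supported S coef = ∀ i → mem i S ≡ false → coef i ≈ 0#

    -- Requiring the coefficients to vanish off S, instead of masking the terms, turns linear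
    -- combinations into plain sums.
    Independent : ∀ {m n} → (Fin m → Covector n) → Subset m → Set (c ⊔ ℓ)
    Independent f S = ∀ coef → Supported S coef → (∀ j → comb f coef j ≈ 0#) → ∀ i → coef i ≈ 0#

    LinIndep⇒Independent : ∀ {m n} {f g : Fin m → Covector n} {S} → (∀ i j → g i j ≈ f i j) →
                           LinIndep K g S → Independent f S
    LinIndep⇒Independent {f = f} {g} {S} g≈f li coef supp rel i with mem i S in i∈
    ... | false = supp i i∈
    ... | true  = li coef (λ j → K.trans (sumK-cong (term j)) (rel j)) i i∈
      where
      term : ∀ j i → (if mem i S then coef i K.* g i j else 0#) ≈ coef i K.* f i j
      term j i with mem i S in i∈
      ... | true  = K.*-congˡ (g≈f i j)
      ... | false = K.sym (K.trans (K.*-congʳ (supp i i∈)) (K.zeroˡ _))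

    Independent⇒LinIndep : ∀ {m n} {f g : Fin m → Covector n} {S} → (∀ i j → g i j ≈ f i j) →
                           Independent f S → LinIndep K g S
    Independent⇒LinIndep {f = f} {g} {S} g≈f ind coef rel i i∈ =
      K.trans (K.sym (K.reflexive (restricted i i∈)))
              (ind coef′ (λ i i∉ → K.reflexive (cong (λ b → if b then coef i else 0#) i∉))
                   (λ j → K.trans (sumK-cong (term j)) (rel j)) i)
      where
      coef′ : _ → Carrier
      coef′ i = if mem i S then coef i else 0#
      restricted : ∀ i → mem i S ≡ true → coef′ i ≡ coef i
      restricted i i∈ = cong (λ b → if b then coef i else 0#) i∈
      term : ∀ j i → coef′ i K.* f i j ≈ (if mem i S then coef i K.* g i j else 0#)
      term j i with mem i S
      ... | true  = K.*-congˡ (K.sym (g≈f i j))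
      ... | false = K.zeroˡ _

    comb-+-single : ∀ {m n} (f : Fin m → Covector n) coef i a j →
                    comb f (λ l → coef l K.+ single i a l) j ≈ comb f coef j K.+ a K.* f i j
    comb-+-single {m} f coef i a j = begin
      sumK K (λ l → (coef l K.+ single i a l) K.* f l j) ≈⟨ sumK-cong {m} (λ l → K.distribʳ _ _ _) ⟩
      sumK K (λ l → coef l K.* f l j K.+ single i a l K.* f l j) ≈⟨ sumK-+ {m} _ _ ⟩
      comb f coef j K.+ sumK K (λ l → single i a l K.* f l j) ≈⟨ K.+-congˡ (sumK-single i a (λ l → f l j)) ⟩
      comb f coef j K.+ a K.* f i j ∎

    -- Elimination of one vertex variable

    module Elimination {n} (u : Fin n) (g : Fin k) where

      -- The form x 0 - x (u + 1) - g z, where 0 is the vertex to be eliminated.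
      π : Covector (suc n)
      π Fin.zero              = K.- gs g
      π (Fin.suc Fin.zero)    = 1#
      π (Fin.suc (Fin.suc l)) = K.- δ l u

      -- Restriction to the hyperplane π = 0, on which the eliminated variable is x u + g z; its
      -- kernel consists of the multiples of π.
      reduce : Covector (suc n) → Covector n
      reduce v Fin.zero    = v Fin.zero K.+ gs g K.* v (Fin.suc Fin.zero)
      reduce v (Fin.suc l) = v (Fin.suc (Fin.suc l)) K.+ δ l u K.* v (Fin.suc Fin.zero)

      σ : Relabelling (suc n) n
      σ Fin.zero    = u , g
      σ (Fin.suc l) = l , ε

      substitute : Form (suc n) → Form n
      substitute (const a z) = const a z
      substitute (edge e)    = edge (move σ e)

      cancel-+ : ∀ {a b} → a K.+ b ≈ 0# → a ≈ K.- b
      cancel-+ {a} {b} h = begin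
        a ≈⟨ K.sym (K.+-identityʳ a) ⟩
        a K.+ 0# ≈⟨ K.+-congˡ (K.sym (K.-‿inverseʳ b)) ⟩
        a K.+ (b K.+ K.- b) ≈⟨ K.sym (K.+-assoc _ _ _) ⟩
        (a K.+ b) K.+ K.- b ≈⟨ K.+-congʳ h ⟩
        0# K.+ K.- b ≈⟨ K.+-identityˡ _ ⟩
        K.- b ∎

      reduce-kernel : ∀ v → (∀ j → reduce v j ≈ 0#) → ∀ j → v j ≈ v (Fin.suc Fin.zero) K.* π j
      reduce-kernel v h Fin.zero = K.trans (cancel-+ (h Fin.zero)) (K.trans (-‿distribˡ-* _ _) (K.*-comm _ _))
      reduce-kernel v h (Fin.suc Fin.zero) = K.sym (K.*-identityʳ _)
      reduce-kernel v h (Fin.suc (Fin.suc l)) = K.trans (cancel-+ (h (Fin.suc l))) (K.trans (-‿distribˡ-* _ _) (K.*-comm _ _))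

      reduce-cong : ∀ {v w} → (∀ j → v j ≈ w j) → ∀ j → reduce v j ≈ reduce w j
      reduce-cong e Fin.zero    = K.+-cong (e _) (K.*-congˡ (e _))
      reduce-cong e (Fin.suc l) = K.+-cong (e _) (K.*-congˡ (e _))

      reduce-scaled-π : ∀ s j → reduce (λ i → s K.* π i) j ≈ 0#
      reduce-scaled-π s Fin.zero = begin
        s K.* (K.- gs g) K.+ gs g K.* (s K.* 1#) ≈⟨ K.+-cong (K.sym (-‿distribʳ-* _ _)) (K.trans (K.*-congˡ (K.*-identityʳ s)) (K.*-comm _ _)) ⟩
        K.- (s K.* gs g) K.+ s K.* gs g ≈⟨ K.-‿inverseˡ _ ⟩
        0# ∎
      reduce-scaled-π s (Fin.suc l) = begin
        s K.* (K.- δ l u) K.+ δ l u K.* (s K.* 1#) ≈⟨ K.+-cong (K.sym (-‿distribʳ-* _ _)) (K.trans (K.*-congˡ (K.*-identityʳ s)) (K.*-comm _ _)) ⟩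
        K.- (s K.* δ l u) K.+ s K.* δ l u ≈⟨ K.-‿inverseˡ _ ⟩
        0# ∎

      reduce-comb : ∀ {m} (f : Fin m → Covector (suc n)) coef j →
                    reduce (comb f coef) j ≈ comb (reduce ∘ f) coef j
      reduce-comb {m} f coef j = go j
        where
        mix : ∀ a (v w : Fin m → Carrier) → sumK K (λ i → coef i K.* v i) K.+ a K.* sumK K (λ i → coef i K.* w i) ≈
                               sumK K (λ i → coef i K.* (v i K.+ a K.* w i))
        mix a v w = K.sym (begin
          sumK K (λ i → coef i K.* (v i K.+ a K.* w i)) ≈⟨ sumK-cong {m} (λ i → K.trans (K.distribˡ _ _ _) (K.+-congˡ (exchange _ _ _))) ⟩
          sumK K (λ i → coef i K.* v i K.+ a K.* (coef i K.* w i)) ≈⟨ sumK-+ {m} _ _ ⟩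
          sumK K (λ i → coef i K.* v i) K.+ sumK K (λ i → a K.* (coef i K.* w i)) ≈⟨ K.+-congˡ (sumK-* {m} a _) ⟩
          sumK K (λ i → coef i K.* v i) K.+ a K.* sumK K (λ i → coef i K.* w i) ∎)
          where
          exchange : ∀ x y z → x K.* (y K.* z) ≈ y K.* (x K.* z)
          exchange x y z = K.trans (K.sym (K.*-assoc _ _ _)) (K.trans (K.*-congʳ (K.*-comm _ _)) (K.*-assoc _ _ _))
        go : ∀ j → reduce (comb f coef) j ≈ comb (reduce ∘ f) coef j
        go Fin.zero    = mix _ _ _
        go (Fin.suc l) = mix _ _ _

      δ-root : ∀ l i → δ l (root σ i) ≈ δ (Fin.suc l) i K.+ δ l u K.* δ Fin.zero i
      δ-root l Fin.zero    = K.sym (K.trans (K.+-identityˡ _) (K.*-identityʳ _))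
      δ-root l (Fin.suc i) = K.sym (K.trans (K.+-congˡ (K.zeroʳ _)) (K.+-identityʳ _))

      gs-gain : ∀ i → gs (gain σ i) ≈ gs g K.* δ Fin.zero i
      gs-gain Fin.zero    = K.sym (K.*-identityʳ _)
      gs-gain (Fin.suc i) = K.trans gs-ε (K.sym (K.zeroʳ _))

      -- Relabelling an edge and restricting its form to π = 0 are the same substitution.
      lin-substitute : ∀ φ j → lin (substitute φ) j ≈ reduce (lin φ) j
      lin-substitute (const a z) Fin.zero    = K.sym (K.trans (K.+-congˡ (K.zeroʳ _)) (K.+-identityʳ _))
      lin-substitute (const a z) (Fin.suc l) = K.sym (K.trans (K.+-identityˡ _) (K.zeroʳ _))
      lin-substitute (edge (i , j , a)) Fin.zero = begin
        K.- gs ((a ⊕ gain σ j) ⊕ (⊖ gain σ i))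
          ≈⟨ K.-‿cong (K.trans (gs-⊕ _ _) (K.+-cong (gs-⊕ _ _) (gs-⊖ _))) ⟩
        K.- ((gs a K.+ gs (gain σ j)) K.+ K.- gs (gain σ i))
          ≈⟨ K.-‿cong (K.trans (K.+-assoc _ _ _) (K.+-congˡ (K.+-cong (gs-gain j) (K.-‿cong (gs-gain i))))) ⟩
        K.- (gs a K.+ (gs g K.* δ Fin.zero j K.+ K.- (gs g K.* δ Fin.zero i)))
          ≈⟨ K.sym (-‿+-comm _ _) ⟩
        K.- gs a K.+ K.- (gs g K.* δ Fin.zero j K.+ K.- (gs g K.* δ Fin.zero i))
          ≈⟨ K.+-congˡ (K.trans (K.sym (-‿+-comm _ _)) (K.trans (K.+-congˡ (-‿involutive _)) (K.+-comm _ _))) ⟩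
        K.- gs a K.+ (gs g K.* δ Fin.zero i K.+ K.- (gs g K.* δ Fin.zero j))
          ≈⟨ K.+-congˡ (K.+-congˡ (-‿distribʳ-* _ _)) ⟩
        K.- gs a K.+ (gs g K.* δ Fin.zero i K.+ gs g K.* (K.- δ Fin.zero j))
          ≈⟨ K.+-congˡ (K.sym (K.distribˡ _ _ _)) ⟩
        K.- gs a K.+ gs g K.* (δ Fin.zero i K.- δ Fin.zero j) ∎
      lin-substitute (edge (i , j , a)) (Fin.suc l) = begin
        δ l (root σ i) K.- δ l (root σ j)
          ≈⟨ K.+-cong (δ-root l i) (K.-‿cong (δ-root l j)) ⟩
        (δ (Fin.suc l) i K.+ δ l u K.* δ Fin.zero i) K.+ K.- (δ (Fin.suc l) j K.+ δ l u K.* δ Fin.zero j)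
          ≈⟨ K.+-congˡ (K.trans (K.sym (-‿+-comm _ _)) (K.+-congˡ (-‿distribʳ-* _ _))) ⟩
        (δ (Fin.suc l) i K.+ δ l u K.* δ Fin.zero i) K.+ (K.- δ (Fin.suc l) j K.+ δ l u K.* (K.- δ Fin.zero j))
          ≈⟨ +-interchange _ _ _ _ ⟩
        (δ (Fin.suc l) i K.- δ (Fin.suc l) j) K.+ (δ l u K.* δ Fin.zero i K.+ δ l u K.* (K.- δ Fin.zero j))
          ≈⟨ K.+-congˡ (K.sym (K.distribˡ _ _ _)) ⟩
        (δ (Fin.suc l) i K.- δ (Fin.suc l) j) K.+ δ l u K.* (δ Fin.zero i K.- δ Fin.zero j) ∎

      -- The pivot is π up to the sign s, which depends on the orientation of its edge.
      module Pivot {m} (f : Fin m → Form (suc n)) (S : Subset m) (i₀ : Fin m) (i₀∈ : mem i₀ S ≡ true)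
                   (s : Carrier) (s²≈1 : s K.* s ≈ 1#) (pivot : ∀ j → lin (f i₀) j ≈ s K.* π j) where

        f′ : Fin m → Form n
        f′ = substitute ∘ f
        S′ : Subset m
        S′ = S [ i₀ ]≔ false

        comb-substitute : ∀ coef j → comb (lin ∘ f′) coef j ≈ reduce (comb (lin ∘ f) coef) j
        comb-substitute coef j = K.trans (sumK-cong (λ i → K.*-congˡ (lin-substitute (f i) j))) (K.sym (reduce-comb (lin ∘ f) coef j))

        independent⇒ : Independent (lin ∘ f) S → Independent (lin ∘ f′) S′
        independent⇒ ind coef supp rel i with i Fin.≟ i₀
        ... | yes refl = supp i (mem-set S i false)
        ... | no  i≢   = K.trans (K.sym (K.trans (K.+-congˡ (K.reflexive (single-other _ i≢))) (K.+-identityʳ _)))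
                                 (ind (λ l → coef l K.+ single i₀ a l) supp₂ rel₂ i)
          where
          v : Carrier
          v = comb (lin ∘ f) coef (Fin.suc Fin.zero)
          -- A combination whose restriction vanishes is v π, by `reduce-kernel`; this multiple of
          -- the pivot cancels it.
          a : Carrier
          a = K.- (s K.* v)
          supp₂ : Supported S (λ l → coef l K.+ single i₀ a l)
          supp₂ l l∉ with l Fin.≟ i₀
          ... | yes refl = case trans (sym i₀∈) l∉ of λ ()
          ... | no  l≢   = K.trans (K.+-identityʳ _) (supp l (trans (mem-set-≢ S false l≢) l∉))
          rel₂ : ∀ j → comb (lin ∘ f) (λ l → coef l K.+ single i₀ a l) j ≈ 0#
          rel₂ j = begin
            comb (lin ∘ f) (λ l → coef l K.+ single i₀ a l) j ≈⟨ comb-+-single (lin ∘ f) coef i₀ a j ⟩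
            comb (lin ∘ f) coef j K.+ a K.* lin (f i₀) j ≈⟨ K.+-cong (reduce-kernel _ (λ j → K.trans (K.sym (comb-substitute coef j)) (rel j)) j) (K.*-congˡ (pivot j)) ⟩
            v K.* π j K.+ a K.* (s K.* π j) ≈⟨ K.+-congˡ (K.sym (K.*-assoc _ _ _)) ⟩
            v K.* π j K.+ (a K.* s) K.* π j ≈⟨ K.+-congˡ (K.*-congʳ as≈) ⟩
            v K.* π j K.+ (K.- v) K.* π j ≈⟨ K.sym (K.distribʳ _ _ _) ⟩
            (v K.+ K.- v) K.* π j ≈⟨ K.*-congʳ (K.-‿inverseʳ v) ⟩
            0# K.* π j ≈⟨ K.zeroˡ _ ⟩
            0# ∎
            where
            as≈ : a K.* s ≈ K.- v
            as≈ = K.trans (K.sym (-‿distribˡ-* _ _)) (K.-‿cong (K.trans (K.*-comm _ _)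
                  (K.trans (K.sym (K.*-assoc _ _ _)) (K.trans (K.*-congʳ s²≈1) (K.*-identityˡ v)))))

        independent⇐ : Independent (lin ∘ f′) S′ → Independent (lin ∘ f) S
        independent⇐ ind coef supp rel = all
          where
          coef₂ : Fin m → Carrier
          coef₂ l = coef l K.+ single i₀ (K.- coef i₀) l
          supp₂ : Supported S′ coef₂
          supp₂ l l∉ with l Fin.≟ i₀
          ... | yes refl = K.-‿inverseʳ _
          ... | no  l≢   = K.trans (K.+-identityʳ _) (supp l (trans (sym (mem-set-≢ S false l≢)) l∉))
          reduce-zero : ∀ v → (∀ j → v j ≈ 0#) → ∀ j → reduce v j ≈ 0#
          reduce-zero v h Fin.zero    = K.trans (K.+-cong (h _) (K.trans (K.*-congˡ (h _)) (K.zeroʳ _))) (K.+-identityˡ _)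
          reduce-zero v h (Fin.suc l) = K.trans (K.+-cong (h _) (K.trans (K.*-congˡ (h _)) (K.zeroʳ _))) (K.+-identityˡ _)
          rel₂ : ∀ j → comb (lin ∘ f′) coef₂ j ≈ 0#
          rel₂ j = begin
            comb (lin ∘ f′) coef₂ j ≈⟨ comb-+-single (lin ∘ f′) coef i₀ _ j ⟩
            comb (lin ∘ f′) coef j K.+ (K.- coef i₀) K.* lin (f′ i₀) j ≈⟨ K.+-cong (K.trans (comb-substitute coef j) (reduce-zero _ rel j)) (K.*-congˡ (K.trans (lin-substitute (f i₀) j) (K.trans (reduce-cong pivot j) (reduce-scaled-π s j)))) ⟩
            0# K.+ (K.- coef i₀) K.* 0# ≈⟨ K.trans (K.+-identityˡ _) (K.zeroʳ _) ⟩
            0# ∎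
          others : ∀ l → ¬ l ≡ i₀ → coef l ≈ 0#
          others l l≢ = K.trans (K.sym (K.trans (K.+-congˡ (K.reflexive (single-other _ l≢))) (K.+-identityʳ _))) (ind coef₂ supp₂ rel₂ l)
          coef≈single : ∀ l → coef l ≈ single i₀ (coef i₀) l
          coef≈single l with l Fin.≟ i₀
          ... | yes refl = K.refl
          ... | no  l≢   = others l l≢
          -- Only the pivot is left in the relation, and at the coordinate of the eliminated vertex
          -- its entry is s.
          at-i₀ : coef i₀ ≈ 0#
          at-i₀ = begin
            coef i₀ ≈⟨ K.sym (K.*-identityʳ _) ⟩
            coef i₀ K.* 1# ≈⟨ K.*-congˡ (K.sym s²≈1) ⟩
            coef i₀ K.* (s K.* s) ≈⟨ K.sym (K.*-assoc _ _ _) ⟩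
            (coef i₀ K.* s) K.* s ≈⟨ K.*-congʳ (K.*-congˡ (K.sym (K.trans (pivot y) (K.*-identityʳ s)))) ⟩
            (coef i₀ K.* lin (f i₀) y) K.* s ≈⟨ K.*-congʳ (K.sym (sumK-single i₀ (coef i₀) (λ l → lin (f l) y))) ⟩
            sumK K (λ l → single i₀ (coef i₀) l K.* lin (f l) y) K.* s ≈⟨ K.*-congʳ (sumK-cong (λ l → K.*-congʳ (K.sym (coef≈single l)))) ⟩
            comb (lin ∘ f) coef y K.* s ≈⟨ K.*-congʳ (rel y) ⟩
            0# K.* s ≈⟨ K.zeroˡ _ ⟩
            0# ∎
            where
            y : Fin (suc (suc n))
            y = Fin.suc Fin.zero
          all : ∀ l → coef l ≈ 0#
          all l with l Fin.≟ i₀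
          ... | yes refl = at-i₀
          ... | no  l≢   = others l l≢

    -- The points of the arrangement are pairs of a value z : Fin t (only z = 0
    -- matters) and a colouring of the vertices.
    module Points {C : Set} (eC : Enumeration C) (A : Action C) (free : ∀ c a → Action._·_ A c a ≡ c → a ≡ ε)
                  (t : ℕ) (1<t : 1 ℕ.< t) (size-t : length (elements eC) ≡ t) where

      isZero : Fin t → Bool
      isZero z = toℕ z ≡ᵇ 0

      satForm : ∀ {n} → Form n → Bool → Vec C n → Bool
      satForm (const a z) b x = b ∨ does z
      satForm (edge e)    b x = Colouring.sat eC (scaled b A) x e

      satSet : ∀ {m n} → (Fin m → Form n) → Bool → Vec C n → Subset m
      satSet f b x = tabulate (λ i → satForm (f i) b x)

      mem-satSet : ∀ {m n} (f : Fin m → Form n) b x i → mem i (satSet f b x) ≡ satForm (f i) b x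
      mem-satSet f b x i = Vec.lookup∘tabulate _ i

      ⊆satSet : ∀ {m n} {S : Subset m} {f : Fin m → Form n} {b x} →
                (∀ i → mem i S ≡ true → satForm (f i) b x ≡ true) → (S ⊆ᵇ satSet f b x) ≡ true
      ⊆satSet {S = S} {f} {b} {x} h = ⊆ᵇ-intro S (satSet f b x) (λ i i∈ → trans (mem-satSet f b x i) (h i i∈))

      ⊆satSet⁻ : ∀ {m n} {S : Subset m} {f : Fin m → Form n} {b x} → (S ⊆ᵇ satSet f b x) ≡ true →
                 ∀ i → mem i S ≡ true → satForm (f i) b x ≡ true
      ⊆satSet⁻ {S = S} {f} {b} {x} h i i∈ = trans (sym (mem-satSet f b x i)) (⊆ᵇ-elim S (satSet f b x) h i i∈)

      Point : ℕ → Set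
      Point n = Fin t × Vec C n

      pointEnum : ∀ n → Enumeration (Point n)
      pointEnum n = productEnum (finEnum t) (vecEnum eC n)

      satPt : ∀ {m n} → (Fin m → Form n) → Point n → Subset m
      satPt f (z , x) = satSet f (isZero z) x

      points : ∀ {m n} → (Fin m → Form n) → Subset m → ℤ
      points {n = n} f S = ∑ (elements (pointEnum n)) (λ ω → ⟦ S ⊆ᵇ satPt f ω ⟧)

      points-∑ : ∀ {m n} (f : Fin m → Form n) S →
        points f S ≡ ∑ (allFin t) (λ z → ∑ (vecs (elements eC) n) (λ x → ⟦ S ⊆ᵇ satSet f (isZero z) x ⟧))
      points-∑ {n = n} f S = ∑-product (allFin t) (vecs (elements eC) n) _

      -- There are n + 1 coordinates, so d + |S| = n + 1 says that S imposes independent conditions.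
      -- Both alternatives survive elimination, which lowers n together with either |S| or d.
      Count : ∀ {m n} → (Fin m → Form n) → Subset m → Set (c ⊔ ℓ)
      Count {n = n} f S = Σ ℕ λ d → (points f S ≡ pos (t ℕ.^ d)) ×
        ((Independent (lin ∘ f) S × d ℕ.+ ∣ S ∣ ≡ suc n) ⊎ ((¬ Independent (lin ∘ f) S) × suc n ℕ.< d ℕ.+ ∣ S ∣))

      ∑-z : ∀ a b → ∑ (allFin t) (λ z → if isZero z then a else b) ≡ a + pos (ℕ.pred t) * b
      ∑-z a b = go t 1<t
        where
        go : ∀ t → 1 ℕ.< t → ∑ (allFin t) (λ z → if toℕ z ≡ᵇ 0 then a else b) ≡ a + pos (ℕ.pred t) * b
        go (suc t) _ = cong (a +_) (trans (cong (λ l → ∑ l (λ z → if toℕ z ≡ᵇ 0 then a else b)) (sym (List.map-tabulate {n = t} id Fin.suc)))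
          (trans (∑-map Fin.suc (allFin t) (λ z → if toℕ z ≡ᵇ 0 then a else b)) (trans (∑-const (allFin t) b) (cong (λ l → pos l * b) (List.length-tabulate {n = t} id)))))

      isConst : Form 0 → Σ Carrier λ a → Dec (a ≈ 0#)
      isConst (const a z) = a , z

      nonzero : Form 0 → Bool
      nonzero φ = not (does (proj₂ (isConst φ)))

      satForm₀ : ∀ φ b x → satForm φ b x ≡ b ∨ not (nonzero φ)
      satForm₀ (const a z) b x = cong (b ∨_) (sym (Bool.not-involutive (does z)))

      lin₀ : ∀ φ → lin φ Fin.zero ≡ proj₁ (isConst φ)
      lin₀ (const a z) = refl

      count₀-all : ∀ {m} (f : Fin m → Form 0) S → (∀ i → mem i S ≡ true → nonzero (f i) ≡ false) →
                   points f S ≡ pos (t ℕ.^ 1)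
      count₀-all f S h = trans (points-∑ f S) (trans (∑-cong (allFin t) (λ z → trans (ℤ.+-identityʳ _)
          (cong ⟦_⟧ (⊆satSet {S = S} {f} {isZero z} {[]} (λ i i∈ → trans (satForm₀ (f i) (isZero z) []) (trans (cong (λ b → isZero z ∨ not b) (h i i∈)) (Bool.∨-zeroʳ (isZero z))))))))
        (trans (∑-const (allFin t) 1ℤ) (trans (ℤ.*-identityʳ _) (cong pos (trans (List.length-tabulate {n = t} id) (sym (ℕ.*-identityʳ t)))))))

      count₀-zero : ∀ {m} (f : Fin m → Form 0) S i → mem i S ≡ true → nonzero (f i) ≡ true → points f S ≡ pos (t ℕ.^ 0)
      count₀-zero f S i i∈ nz = trans (points-∑ f S) (trans (∑-cong (allFin t) each)
          (trans (∑-z 1ℤ 0ℤ) (trans (cong (λ s → 1ℤ + s) (ℤ.*-zeroʳ (pos (ℕ.pred t)))) refl)))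
        where
        each : ∀ z → ⟦ S ⊆ᵇ satSet f (isZero z) [] ⟧ + 0ℤ ≡ (if isZero z then 1ℤ else 0ℤ)
        each z with isZero z
        ... | true  = trans (ℤ.+-identityʳ _) (cong ⟦_⟧ (⊆satSet {S = S} {f} {true} {[]} (λ i _ → satForm₀ (f i) true [])))
        ... | false = trans (ℤ.+-identityʳ _) (cong ⟦_⟧ (¬true⇒false (λ h →
          case trans (sym (⊆satSet⁻ {S = S} {f} {false} {[]} h i i∈)) (trans (satForm₀ (f i) false []) (cong not nz)) of λ ())))

      nonzero⇒≉0 : ∀ φ → nonzero φ ≡ true → ¬ proj₁ (isConst φ) ≈ 0#
      nonzero⇒≉0 (const a (no a≉0)) _ = a≉0

      zero⇒≈0 : ∀ φ → nonzero φ ≡ false → proj₁ (isConst φ) ≈ 0#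
      zero⇒≈0 (const a (yes a≈0)) _ = a≈0

      1≉0 : ¬ 1# ≈ 0#
      1≉0 h = IsField.0≉1 isField (K.sym h)

      -- Only the coordinate z is left. A non-zero form in S forces z = 0, and S is independent if
      -- it has no other member; if all forms in S vanish, z is free and S is independent only when
      -- empty.
      count-0 : ∀ {m} (f : Fin m → Form 0) S → Count f S
      count-0 {m} f S with search (λ i → mem i S ∧ nonzero (f i))
      ... | inj₁ (i , h) with i∈ , nz ← ∧-true {mem i S} h = 0 , count₀-zero f S i i∈ nz , rank
        where
        S′ : Subset m
        S′ = S [ i ]≔ false
        a : Fin m → Carrier
        a j = lin (f j) Fin.zero
        ai≉0 : ¬ a i ≈ 0#
        ai≉0 = nonzero⇒≉0 (f i) nz ∘ K.trans (K.reflexive (sym (lin₀ (f i))))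
        rank : (Independent (lin ∘ f) S × 0 ℕ.+ ∣ S ∣ ≡ 1) ⊎ ((¬ Independent (lin ∘ f) S) × 1 ℕ.< 0 ℕ.+ ∣ S ∣)
        rank with search (λ j → mem j S′)
        ... | inj₂ none = inj₁ (ind , trans (∣∣-remove S i i∈) (cong suc (∣∣-empty S′ none)))
          where
          ind : Independent (lin ∘ f) S
          ind coef supp rel = all
            where
            off : ∀ j → ¬ j ≡ i → coef j ≈ 0#
            off j j≢i = supp j (trans (sym (mem-set-≢ S false j≢i)) (none j))
            is-single : ∀ j → coef j ≈ single i (coef i) j
            is-single j with j Fin.≟ i
            ... | yes refl = K.refl
            ... | no  j≢i  = off j j≢i
            prod : coef i K.* a i ≈ 0#
            prod = K.trans (K.sym (sumK-single i (coef i) a)) (K.trans (sumK-cong (λ j → K.*-congʳ (K.sym (is-single j)))) (rel Fin.zero))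
            inv : Carrier
            inv = proj₁ (IsField.inverse isField (a i) ai≉0)
            at-i : coef i ≈ 0#
            at-i = begin
              coef i ≈⟨ K.sym (K.*-identityʳ _) ⟩
              coef i K.* 1# ≈⟨ K.*-congˡ (K.sym (proj₂ (IsField.inverse isField (a i) ai≉0))) ⟩
              coef i K.* (a i K.* inv) ≈⟨ K.sym (K.*-assoc _ _ _) ⟩
              (coef i K.* a i) K.* inv ≈⟨ K.*-congʳ prod ⟩
              0# K.* inv ≈⟨ K.zeroˡ _ ⟩
              0# ∎
            all : ∀ j → coef j ≈ 0#
            all j with j Fin.≟ i
            ... | yes refl = at-i
            ... | no  j≢i  = off j j≢i
        ... | inj₁ (j , j∈′) with j≢i , j∈ ← mem-removed S {i} {j} j∈′ =
          inj₂ (dep , subst (1 ℕ.<_) (sym (trans (∣∣-remove S i i∈) (cong suc (∣∣-remove S′ j j∈′)))) (s≤s (s≤s z≤n)))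
          where
          -- Two forms on a line are proportional: these coefficients combine the i-th and the j-th
          -- to zero.
          coef : Fin m → Carrier
          coef l = single i (K.- a j) l K.+ single j (a i) l
          dep : ¬ Independent (lin ∘ f) S
          dep ind = ai≉0 (K.trans (K.sym coef-j) (ind coef supp rel j))
            where
            coef-j : coef j ≈ a i
            coef-j = K.trans (K.+-cong (K.reflexive (single-other _ j≢i)) (K.reflexive (single-self j (a i)))) (K.+-identityˡ _)
            supp : Supported S coef
            supp l l∉ = K.trans (K.+-cong (K.reflexive (single-other {i = i} {l} (K.- a j) (λ { refl → case trans (sym l∉) i∈ of λ () })))
                                          (K.reflexive (single-other {i = j} {l} (a i) (λ { refl → case trans (sym l∉) j∈ of λ () })))) (K.+-identityˡ _)
            rel : ∀ y → comb (lin ∘ f) coef y ≈ 0#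
            rel Fin.zero = begin
              comb (lin ∘ f) coef Fin.zero ≈⟨ comb-+-single (lin ∘ f) (single i (K.- a j)) j (a i) Fin.zero ⟩
              comb (lin ∘ f) (single i (K.- a j)) Fin.zero K.+ a i K.* a j ≈⟨ K.+-congʳ (sumK-single i (K.- a j) a) ⟩
              (K.- a j) K.* a i K.+ a i K.* a j ≈⟨ K.+-cong (K.sym (-‿distribˡ-* _ _)) (K.*-comm _ _) ⟩
              K.- (a j K.* a i) K.+ a j K.* a i ≈⟨ K.-‿inverseˡ _ ⟩
              0# ∎
      ... | inj₂ none = 1 , count₀-all f S zeros , rank
        where
        zeros : ∀ i → mem i S ≡ true → nonzero (f i) ≡ false
        zeros i i∈ = trans (cong (_∧ nonzero (f i)) (sym i∈)) (none i)
        rank : (Independent (lin ∘ f) S × 1 ℕ.+ ∣ S ∣ ≡ 1) ⊎ ((¬ Independent (lin ∘ f) S) × 1 ℕ.< 1 ℕ.+ ∣ S ∣)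
        rank with search (λ i → mem i S)
        ... | inj₂ empty = inj₁ ((λ coef supp _ i → supp i (empty i)) , cong suc (∣∣-empty S empty))
        ... | inj₁ (i , i∈) = inj₂ (dep , subst (λ s → 1 ℕ.< suc s) (sym (∣∣-remove S i i∈)) (s≤s (s≤s z≤n)))
          where
          dep : ¬ Independent (lin ∘ f) S
          dep ind = 1≉0 (K.trans (K.reflexive (sym (single-self i 1#))) (ind (single i 1#)
            (λ l l∉ → K.reflexive (single-other {i = i} {l} 1# (λ { refl → case trans (sym l∉) i∈ of λ () })))
            (λ { Fin.zero → K.trans (sumK-single i 1# (λ j → lin (f j) Fin.zero)) (K.trans (K.*-identityˡ _)
                   (K.trans (K.reflexive (lin₀ (f i))) (zero⇒≈0 (f i) (zeros i i∈)))) }) i))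

      module _ {n : ℕ} (u : Fin n) (g : Fin k) where
        open Elimination u g

        satForm-substitute : ∀ φ b x → satForm (substitute φ) b x ≡ satForm φ b (Action._·_ (scaled b A) (lookup x u) g ∷ x)
        satForm-substitute (const a z) b x = refl
        satForm-substitute (edge e) b x = trans (sat-move x σ e) (cong (λ y → sat y e)
            (cong (lookup x u · g ∷_) (trans (Vec.tabulate-cong (λ j → ·-ε (lookup x j))) (Vec.tabulate∘lookup x))))
          where open Colouring eC (scaled b A)

        -- The pivot equation determines the colour of the eliminated vertex from the others, so the
        -- points are those of the substituted forms, while |S| loses the pivot.
        count-pivot : ∀ {m} (f : Fin m → Form (suc n)) S i₀ → mem i₀ S ≡ true →
          (s : Carrier) → s K.* s ≈ 1# → (∀ j → lin (f i₀) j ≈ s K.* π j) →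
          (∀ b c x → satForm (f i₀) b (c ∷ x) ≡ Enumeration._==_ eC c (Action._·_ (scaled b A) (lookup x u) g)) →
          (∀ (f : Fin m → Form n) S → Count f S) → Count f S
        count-pivot {m} f S i₀ i₀∈ s s² lin-i₀ sat-i₀ IH with IH (substitute ∘ f) (S [ i₀ ]≔ false)
        ... | d , pts , rank = d , trans same-points pts , lift rank
          where
          open Pivot f S i₀ i₀∈ s s² lin-i₀
          ∣S∣ : ∣ S ∣ ≡ suc ∣ S′ ∣
          ∣S∣ = ∣∣-remove S i₀ i₀∈
          lift : (Independent (lin ∘ f′) S′ × d ℕ.+ ∣ S′ ∣ ≡ suc n) ⊎ ((¬ Independent (lin ∘ f′) S′) × suc n ℕ.< d ℕ.+ ∣ S′ ∣) →
                 (Independent (lin ∘ f) S × d ℕ.+ ∣ S ∣ ≡ suc (suc n)) ⊎ ((¬ Independent (lin ∘ f) S) × suc (suc n) ℕ.< d ℕ.+ ∣ S ∣)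
          lift (inj₁ (ind , e)) = inj₁ (independent⇐ ind , trans (cong (d ℕ.+_) ∣S∣) (trans (ℕ.+-suc d _) (cong suc e)))
          lift (inj₂ (dep , e)) = inj₂ (dep ∘ independent⇒ , subst (suc (suc n) ℕ.<_) (sym (trans (cong (d ℕ.+_) ∣S∣) (ℕ.+-suc d _))) (s≤s e))
          split : ∀ b c x → (S ⊆ᵇ satSet f b (c ∷ x)) ≡
                            Enumeration._==_ eC c (Action._·_ (scaled b A) (lookup x u) g) ∧ (S′ ⊆ᵇ satSet f′ b x)
          split b c x = true⇔⇒≡ there′ back
            where
            module C = Enumeration eC
            v : C
            v = Action._·_ (scaled b A) (lookup x u) g
            moved : (c C.== v) ≡ true → ∀ i → satForm (f′ i) b x ≡ satForm (f i) b (c ∷ x)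
            moved h i = trans (satForm-substitute (f i) b x) (cong (λ y → satForm (f i) b (y ∷ x)) (sym (C.==⇒≡ h)))
            there′ : (S ⊆ᵇ satSet f b (c ∷ x)) ≡ true → (c C.== v) ∧ (S′ ⊆ᵇ satSet f′ b x) ≡ true
            there′ h = ∧-intro c≡v (⊆satSet {S = S′} {f′} {b} {x} (λ i i∈ → trans (moved c≡v i) (sats i (proj₂ (mem-removed S i∈)))))
              where
              sats : ∀ i → mem i S ≡ true → satForm (f i) b (c ∷ x) ≡ true
              sats = ⊆satSet⁻ {S = S} {f} {b} {c ∷ x} h
              c≡v : (c C.== v) ≡ true
              c≡v = trans (sym (sat-i₀ b c x)) (sats i₀ i₀∈)
            back : (c C.== v) ∧ (S′ ⊆ᵇ satSet f′ b x) ≡ true → (S ⊆ᵇ satSet f b (c ∷ x)) ≡ true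
            back h with c≡v , sub ← ∧-true {c C.== v} h = ⊆satSet {S = S} {f} {b} {c ∷ x} each
              where
              each : ∀ i → mem i S ≡ true → satForm (f i) b (c ∷ x) ≡ true
              each i i∈ with i Fin.≟ i₀
              ... | yes refl = trans (sat-i₀ b c x) c≡v
              ... | no  i≢   = trans (sym (moved c≡v i)) (⊆satSet⁻ {S = S′} {f′} {b} {x} sub i (trans (mem-set-≢ S false i≢) i∈))
          cs = elements eC
          same-points : points f S ≡ points f′ S′
          same-points = trans (points-∑ f S) (trans (∑-cong (allFin t) (λ z → per (isZero z))) (sym (points-∑ f′ S′)))
            where
            per : ∀ b → ∑ (vecs cs (suc n)) (λ x → ⟦ S ⊆ᵇ satSet f b x ⟧) ≡ ∑ (vecs cs n) (λ x → ⟦ S′ ⊆ᵇ satSet f′ b x ⟧)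
            per b = trans (∑-vecs-suc cs n _) (trans (∑-swap cs (vecs cs n) _) (∑-cong (vecs cs n) (λ x →
              trans (∑-cong cs (λ c → trans (cong ⟦_⟧ (split b c x)) (⟦∧⟧ (Enumeration._==_ eC c (Action._·_ (scaled b A) (lookup x u) g)) _)))
                    (Enumeration.∑-pick eC (Action._·_ (scaled b A) (lookup x u) g) (λ _ → ⟦ S′ ⊆ᵇ satSet f′ b x ⟧)))))

      -- Meant for forms without the first vertex variable: a loop there is just a multiple of z.
      -- The two pivot cases receive a dummy value.
      drop : ∀ {n} → Form (suc n) → Form n
      drop (const a z) = const a z
      drop (edge (Fin.zero  , Fin.zero  , a)) = const (K.- gs a) (dec (a Fin.≟ ε))
        where
        dec : Dec (a ≡ ε) → Dec (K.- gs a ≈ 0#)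
        dec (yes refl) = yes (K.trans (K.-‿cong gs-ε) -0#≈0#)
        dec (no a≢ε)   = no (λ h → a≢ε (gs≈0⇒ε a (K.trans (K.sym (-‿involutive _)) (K.trans (K.-‿cong h) -0#≈0#))))
      drop (edge (Fin.zero  , Fin.suc j , a)) = const 0# (yes K.refl)
      drop (edge (Fin.suc i , Fin.zero  , a)) = const 0# (yes K.refl)
      drop (edge (Fin.suc i , Fin.suc j , a)) = edge (i , j , a)

      isPivot : ∀ {n} → Form (suc n) → Bool
      isPivot (const a z) = false
      isPivot (edge (Fin.zero  , Fin.zero  , a)) = false
      isPivot (edge (Fin.zero  , Fin.suc j , a)) = true
      isPivot (edge (Fin.suc i , Fin.zero  , a)) = true
      isPivot (edge (Fin.suc i , Fin.suc j , a)) = false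

      lin-drop-0 : ∀ {n} (φ : Form (suc n)) → isPivot φ ≡ false → lin φ Fin.zero ≈ lin (drop φ) Fin.zero
      lin-drop-0 (const a z) _ = K.refl
      lin-drop-0 (edge (Fin.zero  , Fin.zero  , a)) _ = K.refl
      lin-drop-0 (edge (Fin.suc i , Fin.suc j , a)) _ = K.refl

      lin-drop-1 : ∀ {n} (φ : Form (suc n)) → isPivot φ ≡ false → lin φ (Fin.suc Fin.zero) ≈ 0#
      lin-drop-1 (const a z) _ = K.refl
      lin-drop-1 (edge (Fin.zero  , Fin.zero  , a)) _ = K.-‿inverseʳ _
      lin-drop-1 (edge (Fin.suc i , Fin.suc j , a)) _ = K.-‿inverseʳ _

      lin-drop-suc : ∀ {n} (φ : Form (suc n)) → isPivot φ ≡ false → ∀ l → lin φ (Fin.suc (Fin.suc l)) ≈ lin (drop φ) (Fin.suc l)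
      lin-drop-suc (const a z) _ l = K.refl
      lin-drop-suc (edge (Fin.zero  , Fin.zero  , a)) _ l = K.-‿inverseʳ _
      lin-drop-suc (edge (Fin.suc i , Fin.suc j , a)) _ l = K.refl

      satForm-drop : ∀ {n} (φ : Form (suc n)) → isPivot φ ≡ false → ∀ b c x → satForm φ b (c ∷ x) ≡ satForm (drop φ) b x
      satForm-drop (const a z) _ b c x = refl
      satForm-drop (edge (Fin.zero  , Fin.zero  , a)) _ true  c x = Enumeration.==-refl eC c
      satForm-drop (edge (Fin.zero  , Fin.zero  , a)) _ false c x with a Fin.≟ ε
      ... | yes refl = Enumeration.≡⇒== eC (sym (Action.·-ε A c))
      ... | no a≢ε   = ¬true⇒false (λ h → a≢ε (free c a (sym (Enumeration.==⇒≡ eC h))))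
      satForm-drop (edge (Fin.suc i , Fin.suc j , a)) _ b c x = refl

      -- No form in S involves the first vertex, so its colour is free and contributes a factor t,
      -- while the linear relations stay the same.
      count-free : ∀ {m n} (f : Fin m → Form (suc n)) S → (∀ i → mem i S ≡ true → isPivot (f i) ≡ false) →
                   Count (drop ∘ f) S → Count f S
      count-free {m} {n} f S h (d , pts , rank) = suc d , scaled-points , lift rank
        where
        f′ : Fin m → Form n
        f′ = drop ∘ f
        term : ∀ coef → Supported S coef → ∀ {y y′} →
               (∀ φ → isPivot φ ≡ false → lin φ y ≈ lin (drop φ) y′) → comb (lin ∘ f) coef y ≈ comb (lin ∘ f′) coef y′
        term coef supp {y} {y′} e = sumK-cong {m} each
          where
          each : ∀ i → coef i K.* lin (f i) y ≈ coef i K.* lin (f′ i) y′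
          each i with mem i S in i∈
          ... | true  = K.*-congˡ (e (f i) (h i i∈))
          ... | false = K.trans (K.*-congʳ (supp i i∈)) (K.trans (K.zeroˡ _) (K.sym (K.trans (K.*-congʳ (supp i i∈)) (K.zeroˡ _))))
        vanish : ∀ coef → Supported S coef → comb (lin ∘ f) coef (Fin.suc Fin.zero) ≈ 0#
        vanish coef supp = sumK-zero {m} each
          where
          each : ∀ i → coef i K.* lin (f i) (Fin.suc Fin.zero) ≈ 0#
          each i with mem i S in i∈
          ... | true  = K.trans (K.*-congˡ (lin-drop-1 (f i) (h i i∈))) (K.zeroʳ _)
          ... | false = K.trans (K.*-congʳ (supp i i∈)) (K.zeroˡ _)
        ind⇐ : Independent (lin ∘ f′) S → Independent (lin ∘ f) S
        ind⇐ ind coef supp rel = ind coef supp λ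
          { Fin.zero    → K.trans (K.sym (term coef supp lin-drop-0)) (rel _)
          ; (Fin.suc l) → K.trans (K.sym (term coef supp (λ φ p → lin-drop-suc φ p l))) (rel _) }
        ind⇒ : Independent (lin ∘ f) S → Independent (lin ∘ f′) S
        ind⇒ ind coef supp rel = ind coef supp λ
          { Fin.zero              → K.trans (term coef supp lin-drop-0) (rel _)
          ; (Fin.suc Fin.zero)    → vanish coef supp
          ; (Fin.suc (Fin.suc l)) → K.trans (term coef supp (λ φ p → lin-drop-suc φ p l)) (rel _) }
        lift : (Independent (lin ∘ f′) S × d ℕ.+ ∣ S ∣ ≡ suc n) ⊎ ((¬ Independent (lin ∘ f′) S) × suc n ℕ.< d ℕ.+ ∣ S ∣) →
               (Independent (lin ∘ f) S × suc d ℕ.+ ∣ S ∣ ≡ suc (suc n)) ⊎ ((¬ Independent (lin ∘ f) S) × suc (suc n) ℕ.< suc d ℕ.+ ∣ S ∣)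
        lift (inj₁ (ind , e)) = inj₁ (ind⇐ ind , cong suc e)
        lift (inj₂ (dep , e)) = inj₂ (dep ∘ ind⇒ , s≤s e)
        cs = elements eC
        same : ∀ b c x → (S ⊆ᵇ satSet f b (c ∷ x)) ≡ (S ⊆ᵇ satSet f′ b x)
        same b c x = true⇔⇒≡
          (λ p → ⊆satSet {S = S} {f′} {b} {x} (λ i i∈ → trans (sym (satForm-drop (f i) (h i i∈) b c x)) (⊆satSet⁻ {S = S} {f} {b} {c ∷ x} p i i∈)))
          (λ p → ⊆satSet {S = S} {f} {b} {c ∷ x} (λ i i∈ → trans (satForm-drop (f i) (h i i∈) b c x) (⊆satSet⁻ {S = S} {f′} {b} {x} p i i∈)))
        per : ∀ b → ∑ (vecs cs (suc n)) (λ x → ⟦ S ⊆ᵇ satSet f b x ⟧) ≡ pos t * ∑ (vecs cs n) (λ x → ⟦ S ⊆ᵇ satSet f′ b x ⟧)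
        per b = trans (∑-vecs-suc cs n _) (trans (∑-cong cs (λ c → ∑-cong (vecs cs n) (λ x → cong ⟦_⟧ (same b c x))))
          (trans (∑-const cs _) (cong (λ s → pos s * ∑ (vecs cs n) (λ x → ⟦ S ⊆ᵇ satSet f′ b x ⟧)) size-t)))
        scaled-points : points f S ≡ pos (t ℕ.^ suc d)
        scaled-points = trans (points-∑ f S) (trans (∑-cong (allFin t) (λ z → per (isZero z)))
          (trans (∑-*ˡ (allFin t) (pos t) _) (trans (cong (pos t *_) (trans (sym (points-∑ f′ S)) pts)) (sym (ℤ.pos-* t (t ℕ.^ d))))))

      count : ∀ {m} n (f : Fin m → Form n) S → Count f S
      count zero f S = count-0 f S
      count {m} (suc n) f S with search (λ i → mem i S ∧ isPivot (f i))
      ... | inj₂ none = count-free f S (λ i i∈ → trans (cong (_∧ isPivot (f i)) (sym i∈)) (none i)) (count n (drop ∘ f) S)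
      ... | inj₁ (i₀ , h) with i₀∈ , piv ← ∧-true {mem i₀ S} h = by-pivot (f i₀) refl piv
        where
        by-pivot : ∀ φ → f i₀ ≡ φ → isPivot φ ≡ true → Count f S
        by-pivot (edge (Fin.zero , Fin.suc u , g)) eq _ = count-pivot u g f S i₀ i₀∈ 1# (K.*-identityˡ _)
            (λ j → subst (λ φ → lin φ j ≈ 1# K.* π j) (sym eq) (lins j))
            (λ b c x → cong (λ φ → satForm φ b (c ∷ x)) eq) (count n)
          where
          open Elimination u g
          lins : ∀ j → lin (edge (Fin.zero , Fin.suc u , g)) j ≈ 1# K.* π j
          lins Fin.zero              = K.sym (K.*-identityˡ _)
          lins (Fin.suc Fin.zero)    = K.trans (K.+-congˡ -0#≈0#) (K.trans (K.+-identityʳ _) (K.sym (K.*-identityˡ _)))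
          lins (Fin.suc (Fin.suc l)) = K.trans (K.+-identityˡ _) (K.sym (K.*-identityˡ _))
        by-pivot (edge (Fin.suc u , Fin.zero , g)) eq _ = count-pivot u (⊖ g) f S i₀ i₀∈ (K.- 1#) neg²
            (λ j → subst (λ φ → lin φ j ≈ (K.- 1#) K.* π j) (sym eq) (lins j))
            sats (count n)
          where
          open Elimination u (⊖ g)
          neg : ∀ a → (K.- 1#) K.* a ≈ K.- a
          neg a = K.trans (K.sym (-‿distribˡ-* _ _)) (K.-‿cong (K.*-identityˡ a))
          neg² : (K.- 1#) K.* (K.- 1#) ≈ 1#
          neg² = K.trans (neg _) (-‿involutive _)
          lins : ∀ j → lin (edge (Fin.suc u , Fin.zero , g)) j ≈ (K.- 1#) K.* π j
          lins Fin.zero              = K.sym (K.trans (neg _) (K.-‿cong (K.trans (K.-‿cong (gs-⊖ g)) (-‿involutive _))))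
          lins (Fin.suc Fin.zero)    = K.trans (K.+-identityˡ _) (K.sym (neg _))
          lins (Fin.suc (Fin.suc l)) = K.trans (K.+-congˡ -0#≈0#) (K.trans (K.+-identityʳ _) (K.sym (K.trans (neg _) (-‿involutive _))))
          sats : ∀ b c x → satForm (f i₀) b (c ∷ x) ≡ Enumeration._==_ eC c (Action._·_ (scaled b A) (lookup x u) (⊖ g))
          sats b c x = trans (cong (λ φ → satForm φ b (c ∷ x)) eq) (sym (Colouring.sat-flip eC (scaled b A) (c ∷ x) (Fin.suc u , Fin.zero , g)))

      module Rank {m n} (f : Fin m → Form n) (ind : Subset m → Bool)
                  (ind⇒ : ∀ S → ind S ≡ true → Independent (lin ∘ f) S)
                  (ind⇐ : ∀ S → Independent (lin ∘ f) S → ind S ≡ true) where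

        ind-⊥ : ind ⊥ ≡ true
        ind-⊥ = ind⇐ ⊥ (λ coef supp _ i → supp i (mem-⊥ i))

        basis : ∀ S → Σ (Subset m) λ B → (B ⊆ᵇ S) ≡ true × ind B ≡ true × ∣ B ∣ ≡ rankOf ind S
        basis = rankOf-attained ind ind-⊥

        points-independent : ∀ B → ind B ≡ true → Σ ℕ λ d → points f B ≡ pos (t ℕ.^ d) × d ℕ.+ ∣ B ∣ ≡ suc n
        points-independent B indB with count n f B
        ... | d , pts , inj₁ (_ , e)   = d , pts , e
        ... | d , pts , inj₂ (dep , _) = contradiction (ind⇒ B indB) dep

        rank≤ : ∀ S → rankOf ind S ℕ.≤ suc n
        rank≤ S with basis S
        ... | B , _ , indB , e with points-independent B indB
        ...   | d , _ , e′ = subst₂ ℕ._≤_ e e′ (ℕ.m≤n+m ∣ B ∣ d)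

        -- Adding an element of S to a maximal independent subset B cannot cut down
        -- the common zeros of B, as the number of points would have to drop.
        basis-spans : ∀ S B → (B ⊆ᵇ S) ≡ true → ind B ≡ true → ∣ B ∣ ≡ rankOf ind S →
                      ∀ ω → (B ⊆ᵇ satPt f ω) ≡ true → (S ⊆ᵇ satPt f ω) ≡ true
        basis-spans S B B⊆S indB maximal ω B⊆ = ⊆ᵇ-intro S (satPt f ω) each
          where
          each : ∀ e → mem e S ≡ true → mem e (satPt f ω) ≡ true
          each e e∈S with mem e (satPt f ω) in e∉ω
          ... | true  = refl
          ... | false with mem e B in e∈B
          ...   | true  = case trans (sym e∉ω) (⊆ᵇ-elim B (satPt f ω) B⊆ e e∈B) of λ ()
          ...   | false = contradiction (too-few (points-independent B indB) (count n f B′)) (ℕ.<-irrefl refl)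
            where
            B′ : Subset m
            B′ = B [ e ]≔ true
            ∣B′∣ : ∣ B′ ∣ ≡ suc ∣ B ∣
            ∣B′∣ = ∣∣-insert B e e∈B
            B⊆B′ : ∀ i → mem i B ≡ true → mem i B′ ≡ true
            B⊆B′ i i∈ with i Fin.≟ e
            ... | yes refl = mem-set B e true
            ... | no  i≢e  = trans (mem-set-≢ B true i≢e) i∈
            B′⊆S : (B′ ⊆ᵇ S) ≡ true
            B′⊆S = ⊆ᵇ-intro B′ S inS
              where
              inS : ∀ i → mem i B′ ≡ true → mem i S ≡ true
              inS i i∈ with i Fin.≟ e
              ... | yes refl = e∈S
              ... | no  i≢e  = ⊆ᵇ-elim B S B⊆S i (trans (sym (mem-set-≢ B true i≢e)) i∈)
            fewer : points f B′ ℤ.< points f B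
            fewer = Enumeration.∑-strict (pointEnum n)
              (λ ω → ⟦⟧-mono (λ h → ⊆ᵇ-intro B (satPt f ω) (λ i i∈ → ⊆ᵇ-elim B′ (satPt f ω) h i (B⊆B′ i i∈))))
              ω (subst₂ (λ a b → ⟦ a ⟧ ℤ.< ⟦ b ⟧)
                   (sym (¬true⇒false (λ h → case trans (sym e∉ω) (⊆ᵇ-elim B′ (satPt f ω) h e (mem-set B e true)) of λ ())))
                   (sym B⊆) (ℤ.+<+ (s≤s z≤n)))
            too-few : (Σ ℕ λ d → points f B ≡ pos (t ℕ.^ d) × d ℕ.+ ∣ B ∣ ≡ suc n) → Count f B′ → suc n ℕ.< suc n
            too-few _ (d′ , _ , inj₁ (indep , _)) = contradiction
              (subst₂ ℕ._≤_ ∣B′∣ (sym maximal) (rankOf-bound ind S B′ B′⊆S (ind⇐ B′ indep))) (ℕ.<-irrefl refl)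
            -- Dependence gives n + 1 < d′ + |B| + 1, and fewer points give d′ < d; together they
            -- exceed the exact value d + |B| = n + 1.
            too-few (d , ptsB , e) (d′ , ptsB′ , inj₂ (_ , lt)) = subst₂ ℕ._<_ refl e
              (ℕ.<-≤-trans lt (ℕ.≤-trans (ℕ.≤-reflexive (trans (cong (d′ ℕ.+_) ∣B′∣) (ℕ.+-suc d′ ∣ B ∣)))
                (ℕ.+-monoˡ-≤ ∣ B ∣ (^-cancel-< t d′ d 1<t (ℤ.drop‿+<+ (subst₂ ℤ._<_ ptsB′ ptsB fewer))))))

        -- A maximal independent subset has the same common zeros as S, and for an independent set
        -- their number is known exactly.
        points-rank : ∀ S → points f S ≡ pos (t ℕ.^ (suc n ∸ rankOf ind S))
        points-rank S with basis S
        ... | B , B⊆S , indB , e with points-independent B indB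
        ...   | d , pts , e′ = trans (∑-cong (elements (pointEnum n)) (λ ω → cong ⟦_⟧ (same ω)))
                  (trans pts (cong (λ a → pos (t ℕ.^ a))
                    (trans (sym (ℕ.m+n∸n≡m d ∣ B ∣)) (cong₂ _∸_ e′ e))))
          where
          same : ∀ ω → (S ⊆ᵇ satPt f ω) ≡ (B ⊆ᵇ satPt f ω)
          same ω = true⇔⇒≡
            (λ h → ⊆ᵇ-intro B (satPt f ω) (λ i i∈ → ⊆ᵇ-elim S (satPt f ω) h i (⊆ᵇ-elim B S B⊆S i i∈)))
            (basis-spans S B B⊆S indB e ω)

  open Linear

  -- The class of gain graphs

  private variable
    N : ℕ

  isEdge : GainGraph N k → Triple N → Bool
  isEdge Γ (i , j , a) = E Γ i j a

  edges : GainGraph N k → List (Triple N)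
  edges {N} Γ = filterᵇ (isEdge Γ) (cartesianProduct (allFin N) (allPairs N k))

  ∈-edges : (Γ : GainGraph N k) {e : Triple N} → isEdge Γ e ≡ true → e ∈ edges Γ
  ∈-edges Γ {i , s} h = ∈-filterᵇ (isEdge Γ) (Mem.∈-cartesianProduct⁺ (Mem.∈-allFin i) (∈-allPairs s)) h

  ∈-edges⁻ : (Γ : GainGraph N k) {e : Triple N} → e ∈ edges Γ → isEdge Γ e ≡ true
  ∈-edges⁻ {N} Γ h = ∈-filterᵇ⁻ (isEdge Γ) {xs = cartesianProduct (allFin N) (allPairs N k)} h

  embed : Relabelling N N → GainGraph N k → List (Triple N)
  embed ι Γ = map (move ι) (edges Γ)

  ∈-embed : (ι : Relabelling N N) (Γ : GainGraph N k) {e : Triple N} → isEdge Γ e ≡ true → move ι e ∈ embed ι Γ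
  ∈-embed ι Γ h = Mem.∈-map⁺ (move ι) (∈-edges Γ h)

  ∈-embed⁻ : (ι : Relabelling N N) (Γ : GainGraph N k) {e : Triple N} → e ∈ embed ι Γ → ∃ λ e′ → isEdge Γ e′ ≡ true × e ≡ move ι e′
  ∈-embed⁻ ι Γ e∈ with Mem.∈-map⁻ (move ι) e∈
  ... | e′ , e′∈ , eq = e′ , ∈-edges⁻ Γ e′∈ , eq

  -- The vertices of Γ are placed by ι into a larger graph whose remaining edges
  -- L′ live on V′; the two parts meet in a complete graph.
  record Placed (Γ : GainGraph N k) (ι : Relabelling N N) (V′ : Fin N → Bool) (L′ : List (Triple N)) : Set where
    field
      injective : ∀ {u v} → mem u (V Γ) ≡ true → mem v (V Γ) ≡ true → root ι u ≡ root ι v → u ≡ v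
      L′⊆V′     : ∀ {i j a} → (i , j , a) ∈ L′ → V′ i ≡ true × V′ j ≡ true
      complete  : ∀ {u v} → mem u (V Γ) ≡ true → mem v (V Γ) ≡ true → V′ (root ι u) ≡ true → V′ (root ι v) ≡ true →
                  u ≢ v → ∀ a → E Γ u v a ≡ true
      shared    : ∀ {u v} → mem u (V Γ) ≡ true → mem v (V Γ) ≡ true → V′ (root ι u) ≡ true → V′ (root ι v) ≡ true →
                  u ≢ v → ∀ a → (root ι u , root ι v , a) ∈± L′

  -- All placements are quantified over, because the induction changes them: a takeover alters ι,
  -- and a gluing enlarges the surrounding graph.
  Reduces : GainGraph N k → Set
  Reduces Γ = ∀ ι V′ L′ → Placed Γ ι V′ L′ → Chain (embed ι Γ ++ L′) L′

  E-sym : {Γ : GainGraph N k} → WF Γ → ∀ {u v a} → E Γ u v a ≡ true → E Γ v u (⊖ a) ≡ true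
  E-sym wf {u} {v} {a} h = trans (sym (WF.symmetric wf u v a (⊖ a) (gs-⊖ a))) h

  E-sym⁻ : {Γ : GainGraph N k} → WF Γ → ∀ {u v a} → E Γ v u (⊖ a) ≡ true → E Γ u v a ≡ true
  E-sym⁻ wf {u} {v} {a} h = trans (WF.symmetric wf u v a (⊖ a) (gs-⊖ a)) h

  module AtSimplicialVertex (Γ : GainGraph N k) (v : Fin N) (wf : WF Γ) (v∈V : mem v (V Γ) ≡ true) (ls : LinkSimplicial Γ v) where

    Γ∖v : GainGraph N k
    Γ∖v = delete Γ v

    ∈V∖v⁻ : ∀ {u} → mem u (V Γ∖v) ≡ true → mem u (V Γ) ≡ true × u ≢ v
    ∈V∖v⁻ {u} h with p , q ← ∧-true {mem u (V Γ)} (trans (sym (mem-─ (V Γ) ⁅ v ⁆ u)) h) =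
      p , λ { refl → case trans (sym q) (cong not (mem-⁅⁆ v)) of λ () }

    ∈V∖v : ∀ {u} → mem u (V Γ) ≡ true → u ≢ v → mem u (V Γ∖v) ≡ true
    ∈V∖v {u} u∈ u≢v = trans (mem-─ (V Γ) ⁅ v ⁆ u) (∧-intro u∈ (cong not (¬true⇒false (u≢v ∘ mem-⁅⁆⇒≡))))

    E∖v⁻ : ∀ {i j a} → E Γ∖v i j a ≡ true → mem i (V Γ∖v) ≡ true × mem j (V Γ∖v) ≡ true × E Γ i j a ≡ true
    E∖v⁻ {i} {j} h with p , q ← ∧-true {mem i (V Γ∖v)} h with r , s ← ∧-true {mem j (V Γ∖v)} q = p , r , s

    E∖v : ∀ {i j a} → E Γ i j a ≡ true → i ≢ v → j ≢ v → E Γ∖v i j a ≡ true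
    E∖v {i} {j} {a} h i≢v j≢v with i∈ , j∈ , _ ← WF.endpoints wf i j a h =
      ∧-intro (∈V∖v i∈ i≢v) (∧-intro (∈V∖v j∈ j≢v) h)

    -- The gain of the path from u to w through v, whose first edge is traversed backwards.
    link-gain : ∀ {u w a b d} → E Γ v u a ≡ true → E Γ v w b ≡ true → u ≢ w → (⊖ a) ⊕ b ≡ d → E Γ u w d ≡ true
    link-gain {u} {w} {a} {b} ea eb u≢w refl = ls u w (⊖ a) b ((⊖ a) ⊕ b) (E-sym wf ea) eb u≢w (gs-⊕ (⊖ a) b)

    neighbour : ∀ {j b} → E Γ v j b ≡ true → mem j (V Γ) ≡ true × j ≢ v
    neighbour {j} {b} h with _ , j∈ , v≢j ← WF.endpoints wf v j b h = j∈ , v≢j ∘ sym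

    module _ (ι : Relabelling N N) (injective : ∀ {u w} → mem u (V Γ) ≡ true → mem w (V Γ) ≡ true → root ι u ≡ root ι w → u ≡ w) where

      A : List (Triple N)
      A = embed ι Γ∖v

      spoke : Fin N × Fin k → Fin N × Fin k
      spoke (j , b) = root ι j , (b ⊕ gain ι j) ⊕ (⊖ gain ι v)

      atV : Fin N × Fin k → Bool
      atV (j , b) = E Γ v j b

      S : List (Fin N × Fin k)
      S = map spoke (selectPairs atV)

      ∈S : ∀ {j b} → E Γ v j b ≡ true → spoke (j , b) ∈ S
      ∈S h = Mem.∈-map⁺ spoke (∈-filterᵇ atV (∈-allPairs _) h)

      ∈S⁻ : ∀ {s} → s ∈ S → ∃ λ t → atV t ≡ true × s ≡ spoke t
      ∈S⁻ s∈ with Mem.∈-map⁻ spoke s∈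
      ... | t , t∈ , eq = t , ∈-filterᵇ⁻ atV {xs = allPairs N k} t∈ , eq

      root≢v : ∀ {j} → mem j (V Γ) ≡ true → j ≢ v → root ι j ≢ root ι v
      root≢v j∈ j≢v e = j≢v (injective j∈ v∈V e)

      simplicial : Simplicial A (root ι v) S
      simplicial = record
        { A-avoids = avoids
        ; S-avoids = s-avoids
        ; S-unique = AllPairs-map-∈ spoke (selectPairs atV) (selectPairs-unique atV) spoke-injective
        ; closed   = closed }
        where
        avoids : Avoids (root ι v) A
        avoids e∈ with ∈-embed⁻ ι Γ∖v e∈
        ... | (i , j , a) , h , refl with i∈ , j∈ , _ ← E∖v⁻ {i} {j} {a} h
          with i∈V , i≢v ← ∈V∖v⁻ i∈ | j∈V , j≢v ← ∈V∖v⁻ j∈ = root≢v i∈V i≢v , root≢v j∈V j≢v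
        s-avoids : ∀ {j b} → (j , b) ∈ S → j ≢ root ι v
        s-avoids s∈ with ∈S⁻ s∈
        ... | (j , b) , h , refl with j∈ , j≢v ← neighbour h = root≢v j∈ j≢v
        cancel : ∀ b b′ p q → (b ⊕ p) ⊕ (⊖ q) ≡ (b′ ⊕ p) ⊕ (⊖ q) → b ≡ b′
        cancel b b′ p q e = trans (expand b) (trans (cong (_⊕ (q ⊕ (⊖ p))) e) (sym (expand b′)))
          where
          expand : ∀ b → b ≡ ((b ⊕ p) ⊕ (⊖ q)) ⊕ (q ⊕ (⊖ p))
          expand b = Solver.solve (b ∷ p ∷ q ∷ []) v0 (((v0 ⊞ v1) ⊞ (⊟ v2)) ⊞ (v2 ⊞ (⊟ v1))) refl
        spoke-injective : ∀ {s t} → s ∈ selectPairs atV → t ∈ selectPairs atV → s ≢ t → spoke s ≢ spoke t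
        spoke-injective {j , b} {j′ , b′} s∈ t∈ s≢t e
          with refl ← injective (proj₁ (neighbour (∈-filterᵇ⁻ atV {xs = allPairs N k} s∈))) (proj₁ (neighbour (∈-filterᵇ⁻ atV {xs = allPairs N k} t∈))) (cong proj₁ e) =
          s≢t (cong (j ,_) (cancel b b′ (gain ι j) (gain ι v) (cong proj₂ e)))
        closed : ∀ {j b j′ b′} → (j , b) ∈ S → (j′ , b′) ∈ S → j ≢ j′ → (j , j′ , b′ ⊕ (⊖ b)) ∈± A
        closed s∈ s′∈ j≢j′ with ∈S⁻ s∈ | ∈S⁻ s′∈
        ... | (j , b) , h , refl | (j′ , b′) , h′ , refl = inj₁ (subst (_∈ A)
          (cong (λ g → root ι j , root ι j′ , g) (Solver.solve (b ∷ b′ ∷ gain ι j ∷ gain ι j′ ∷ gain ι v ∷ [])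
            ((((⊟ v0) ⊞ v1) ⊞ v3) ⊞ (⊟ v2)) (((v1 ⊞ v3) ⊞ (⊟ v4)) ⊞ (⊟ ((v0 ⊞ v2) ⊞ (⊟ v4)))) refl))
          (∈-embed ι Γ∖v (E∖v (link-gain h h′ (j≢j′ ∘ cong (root ι)) refl) (proj₂ (neighbour h)) (proj₂ (neighbour h′)))))

      split-star : embed ι Γ ≋ (A ++ star (root ι v) S)
      split-star = forward , ++-⊑ {L = A} from-A from-star
        where
        forward : embed ι Γ ⊑ (A ++ star (root ι v) S)
        forward e∈ with ∈-embed⁻ ι Γ e∈
        ... | (i , j , a) , h , refl with i Fin.≟ v | j Fin.≟ v
        ...   | yes refl | _        = inj₂ (∈±-++ʳ A (inj₁ (Mem.∈-map⁺ _ (∈S h))))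
        ...   | no _     | yes refl = inj₂ (∈±-++ʳ A (inj₂ (subst (_∈ star (root ι v) S) (move-flip ι (i , v , a)) (Mem.∈-map⁺ _ (∈S (E-sym wf h))))))
        ...   | no i≢v   | no j≢v   = inj₂ (∈±-++ˡ (inj₁ (∈-embed ι Γ∖v (E∖v h i≢v j≢v))))
        from-A : A ⊑ embed ι Γ
        from-A e∈ with ∈-embed⁻ ι Γ∖v e∈
        ... | (i , j , a) , h , refl = inj₂ (inj₁ (∈-embed ι Γ (proj₂ (proj₂ (E∖v⁻ {i} {j} {a} h)))))
        from-star : star (root ι v) S ⊑ embed ι Γ
        from-star e∈ with Mem.∈-map⁻ _ e∈
        ... | s , s∈ , refl with ∈S⁻ s∈
        ...   | (j , b) , h , refl = inj₂ (inj₁ (∈-embed ι Γ h))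

    restrict : ∀ {ι V′ L′} → Placed Γ ι V′ L′ → Placed Γ∖v ι V′ L′
    restrict P = record
      { injective = λ u∈ w∈ → injective (proj₁ (∈V∖v⁻ u∈)) (proj₁ (∈V∖v⁻ w∈))
      ; L′⊆V′     = L′⊆V′
      ; complete  = λ u∈ w∈ u∈′ w∈′ u≢w a → E∖v (complete (proj₁ (∈V∖v⁻ u∈)) (proj₁ (∈V∖v⁻ w∈)) u∈′ w∈′ u≢w a) (proj₂ (∈V∖v⁻ u∈)) (proj₂ (∈V∖v⁻ w∈))
      ; shared    = λ u∈ w∈ → shared (proj₁ (∈V∖v⁻ u∈)) (proj₁ (∈V∖v⁻ w∈)) }
      where open Placed P

    -- The image of the vertices other than v, in the rôle of `U₀`.
    vertexAt : Relabelling N N → Fin N → Bool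
    vertexAt ι i = does (Fin.any? (λ u → (mem u (V Γ∖v) ∧ does (root ι u Fin.≟ i)) Bool.≟ true))

    vertexAt-root : ∀ (ι : Relabelling N N) {u} → mem u (V Γ∖v) ≡ true → vertexAt ι (root ι u) ≡ true
    vertexAt-root ι {u} u∈ = dec-true (Fin.any? _) (u , ∧-intro u∈ (dec-true (root ι u Fin.≟ root ι u) refl))

    vertexAt⁻ : ∀ (ι : Relabelling N N) {i} → vertexAt ι i ≡ true → ∃ λ u → mem u (V Γ∖v) ≡ true × root ι u ≡ i
    vertexAt⁻ ι {i} h with u , p ← does-true (Fin.any? (λ u → (mem u (V Γ∖v) ∧ does (root ι u Fin.≟ i)) Bool.≟ true)) h
      with u∈ , q ← ∧-true {mem u (V Γ∖v)} p = u , u∈ , does-true (root ι u Fin.≟ i) q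

    -- The neighbour w of v lies outside V′ while v lies inside: w is contracted
    -- onto v, and v then takes over the rôle of w in Γ ∖ v.
    module Takeover {ι : Relabelling N N} {V′ L′} (P : Placed Γ ι V′ L′) (v∈V′ : V′ (root ι v) ≡ true)
                    {w b₀} (e₀ : E Γ v w b₀ ≡ true) (w∉V′ : V′ (root ι w) ≡ false) where
      open Placed P

      β₀ : Fin k
      β₀ = (b₀ ⊕ gain ι w) ⊕ (⊖ gain ι v)

      τ : Relabelling N N
      τ = contract (root ι w) (root ι v) (⊖ β₀)

      w∈V : mem w (V Γ) ≡ true
      w∈V = proj₁ (neighbour e₀)

      ι′ : Relabelling N N
      ι′ = τ ⊙ ι

      root-w : root ι′ w ≡ root ι v
      root-w = cong proj₁ (contract-at (root ι w) (root ι v) (⊖ β₀))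

      root-other : ∀ {u} → mem u (V Γ) ≡ true → u ≢ w → root ι′ u ≡ root ι u
      root-other u∈ u≢w = cong proj₁ (contract-off {w = root ι w} {root ι v} {⊖ β₀} (u≢w ∘ injective u∈ w∈V))

      full : ∀ {u} → mem u (V Γ∖v) ≡ true → V′ (root ι u) ≡ true → ∀ b → E Γ v u b ≡ true
      full u∈ u∈′ with u∈V , u≢v ← ∈V∖v⁻ u∈ = complete v∈V u∈V v∈V′ u∈′ (u≢v ∘ sym)

      -- w inherits all edges from v, by simpliciality of v.
      full-w : ∀ {u} → mem u (V Γ∖v) ≡ true → V′ (root ι u) ≡ true → w ≢ u → ∀ a → E Γ w u a ≡ true
      full-w u∈ u∈′ w≢u a = link-gain e₀ (full u∈ u∈′ (a ⊕ b₀)) w≢u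
        (Solver.solve (a ∷ b₀ ∷ []) ((⊟ v1) ⊞ (v0 ⊞ v1)) v0 refl)

      -- At the place of v, w becomes a shared vertex and must be joined with every gain to the
      -- others: within Γ by `full-w`, within `L′` because v was.
      placed : Placed Γ∖v ι′ V′ L′
      placed = record { injective = inj ; L′⊆V′ = L′⊆V′ ; complete = comp ; shared = share }
        where
        data View (u : Fin N) : Set where
          is-w : u ≡ w → View u
          other : u ≢ w → root ι′ u ≡ root ι u → View u
        view : ∀ {u} → mem u (V Γ∖v) ≡ true → View u
        view {u} u∈ with u Fin.≟ w
        ... | yes u≡w = is-w u≡w
        ... | no  u≢w = other u≢w (root-other (proj₁ (∈V∖v⁻ u∈)) u≢w)
        v-apart : ∀ {u} → mem u (V Γ∖v) ≡ true → root ι u ≢ root ι v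
        v-apart u∈ e = proj₂ (∈V∖v⁻ u∈) (injective (proj₁ (∈V∖v⁻ u∈)) v∈V e)
        inj : ∀ {u u′} → mem u (V Γ∖v) ≡ true → mem u′ (V Γ∖v) ≡ true → root ι′ u ≡ root ι′ u′ → u ≡ u′
        inj u∈ u′∈ e with view u∈ | view u′∈
        ... | is-w p      | is-w q      = trans p (sym q)
        ... | is-w refl   | other _ q   = contradiction (trans (sym q) (trans (sym e) root-w)) (v-apart u′∈)
        ... | other _ p   | is-w refl   = contradiction (trans (sym p) (trans e root-w)) (v-apart u∈)
        ... | other _ p   | other _ q   = injective (proj₁ (∈V∖v⁻ u∈)) (proj₁ (∈V∖v⁻ u′∈)) (trans (sym p) (trans e q))
        comp : ∀ {u u′} → mem u (V Γ∖v) ≡ true → mem u′ (V Γ∖v) ≡ true → V′ (root ι′ u) ≡ true → V′ (root ι′ u′) ≡ true →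
               u ≢ u′ → ∀ a → E Γ∖v u u′ a ≡ true
        comp {u} {u′} u∈ u′∈ h h′ u≢u′ a = E∖v joined (proj₂ (∈V∖v⁻ u∈)) (proj₂ (∈V∖v⁻ u′∈))
          where
          joined : E Γ u u′ a ≡ true
          joined with view u∈ | view u′∈
          ... | is-w p    | is-w q    = contradiction (trans p (sym q)) u≢u′
          ... | is-w refl | other _ q = full-w u′∈ (trans (cong V′ (sym q)) h′) u≢u′ a
          ... | other _ p | is-w refl = E-sym⁻ wf (full-w u∈ (trans (cong V′ (sym p)) h) (u≢u′ ∘ sym) (⊖ a))
          ... | other _ p | other _ q = complete (proj₁ (∈V∖v⁻ u∈)) (proj₁ (∈V∖v⁻ u′∈)) (trans (cong V′ (sym p)) h) (trans (cong V′ (sym q)) h′) u≢u′ a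
        share : ∀ {u u′} → mem u (V Γ∖v) ≡ true → mem u′ (V Γ∖v) ≡ true → V′ (root ι′ u) ≡ true → V′ (root ι′ u′) ≡ true →
                u ≢ u′ → ∀ a → (root ι′ u , root ι′ u′ , a) ∈± L′
        share {u} {u′} u∈ u′∈ h h′ u≢u′ a with u∈V , u≢v ← ∈V∖v⁻ u∈ | u′∈V , u′≢v ← ∈V∖v⁻ u′∈ with view u∈ | view u′∈
        ... | is-w p    | is-w q    = contradiction (trans p (sym q)) u≢u′
        ... | is-w refl | other _ q = subst₂ (λ i j → (i , j , a) ∈± L′) (sym root-w) (sym q)
          (shared v∈V u′∈V v∈V′ (trans (cong V′ (sym q)) h′) (u′≢v ∘ sym) a)
        ... | other _ p | is-w refl = subst₂ (λ i j → (i , j , a) ∈± L′) (sym p) (sym root-w)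
          (shared u∈V v∈V (trans (cong V′ (sym p)) h) v∈V′ u≢v a)
        ... | other _ p | other _ q = subst₂ (λ i j → (i , j , a) ∈± L′) (sym p) (sym q)
          (shared u∈V u′∈V (trans (cong V′ (sym p)) h) (trans (cong V′ (sym q)) h′) u≢u′ a)

      embed-ι′ : embed ι′ Γ∖v ≡ map (move τ) (embed ι Γ∖v)
      embed-ι′ = trans (List.map-cong (λ e → sym (move-⊙ τ ι e)) (edges Γ∖v)) (List.map-∘ (edges Γ∖v))

      takeover : Reduces Γ∖v → Chain ((A ι injective ++ star (root ι v) (S ι injective)) ++ L′) L′
      takeover IH = Chain-leaf (simplicial ι injective) L′ 0<k (vertexAt ι) V′ A⊆ S⊆ v∈V′ comp L′⊆V′ share (∈S ι injective e₀) w∉V′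
          (subst (λ M → Chain (M ++ L′) L′) embed-ι′ (IH ι′ V′ L′ placed))
        where
        A⊆ : ∀ {i j a} → (i , j , a) ∈ A ι injective → vertexAt ι i ≡ true × vertexAt ι j ≡ true
        A⊆ e∈ with ∈-embed⁻ ι Γ∖v e∈
        ... | (i , j , a) , h , refl with i∈ , j∈ , _ ← E∖v⁻ {i} {j} {a} h = vertexAt-root ι i∈ , vertexAt-root ι j∈
        S⊆ : ∀ {j b} → (j , b) ∈ S ι injective → vertexAt ι j ≡ true
        S⊆ s∈ with ∈S⁻ ι injective s∈
        ... | (j , b) , h , refl with j∈ , j≢v ← neighbour h = vertexAt-root ι (∈V∖v j∈ j≢v)
        comp : ∀ j → vertexAt ι j ≡ true → V′ j ≡ true → ∀ b → (j , b) ∈ S ι injective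
        comp j h j∈′ b with vertexAt⁻ ι h
        ... | u , u∈ , refl = subst (λ g → (root ι u , g) ∈ S ι injective)
          (Solver.solve (b ∷ gain ι u ∷ gain ι v ∷ []) ((((v0 ⊞ (⊟ v1)) ⊞ v2) ⊞ v1) ⊞ (⊟ v2)) v0 refl)
          (∈S ι injective (full u∈ j∈′ ((b ⊕ (⊖ gain ι u)) ⊕ gain ι v)))
        share : ∀ j → vertexAt ι j ≡ true → V′ j ≡ true → ∀ b → (root ι v , j , b) ∈± L′
        share j h j∈′ b with vertexAt⁻ ι h
        ... | u , u∈ , refl with u∈V , u≢v ← ∈V∖v⁻ u∈ = shared v∈V u∈V v∈V′ j∈′ (u≢v ∘ sym) b

    reduces : Reduces Γ∖v → Reduces Γ
    reduces IH ι V′ L′ P = respects with-star (cases (V′ (root ι v)) refl)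
      where
      open Placed P
      A′ : List (Triple N)
      A′ = A ι injective
      S′ : List (Fin N × Fin k)
      S′ = S ι injective
      with-star : (embed ι Γ ++ L′) ≋ ((A′ ++ star (root ι v) S′) ++ L′)
      with-star with f , g ← split-star ι injective =
        ++-⊑ {L = embed ι Γ} (⊑-++ˡ f) (⊑-++ʳ (A′ ++ star (root ι v) S′) ⊑-refl) , ++-⊑ {L = A′ ++ star (root ι v) S′} (⊑-++ˡ g) (⊑-++ʳ (embed ι Γ) ⊑-refl)
      absorbed : star (root ι v) S′ ⊑ (A′ ++ L′) → ((A′ ++ star (root ι v) S′) ++ L′) ≋ (A′ ++ L′)
      absorbed h = ++-⊑ {L = A′ ++ star (root ι v) S′} (++-⊑ {L = A′} (⊑-++ˡ ⊑-refl) h) (⊑-++ʳ A′ ⊑-refl) ,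
                   ++-⊑ {L = A′} (⊑-++ˡ (⊑-++ˡ ⊑-refl)) (⊑-++ʳ (A′ ++ star (root ι v) S′) ⊑-refl)
      smaller : Chain (A′ ++ L′) L′
      smaller = IH ι V′ L′ (restrict P)
      star-⊑ : (∀ {j b} → E Γ v j b ≡ true → (root ι v , spoke ι injective (j , b)) ∈± L′) → star (root ι v) S′ ⊑ (A′ ++ L′)
      star-⊑ h e∈ with Mem.∈-map⁻ _ e∈
      ... | s , s∈ , refl with ∈S⁻ ι injective s∈
      ...   | (j , b) , eq , refl = inj₂ (∈±-++ʳ A′ (h eq))
      cases : ∀ b → V′ (root ι v) ≡ b → Chain ((A′ ++ star (root ι v) S′) ++ L′) L′
      cases false v∉ with search (λ u → does (Fin.any? (λ b → E Γ v u b Bool.≟ true)))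
      -- An isolated v has an empty star, so there is no edge to contract.
      ... | inj₂ none = respects (absorbed (star-⊑ (λ {j} {b} eq →
              case trans (sym (none j)) (dec-true (Fin.any? (λ b → E Γ v j b Bool.≟ true)) (b , eq)) of λ ()))) smaller
      ... | inj₁ (u , h) with b , eq ← does-true (Fin.any? (λ b → E Γ v u b Bool.≟ true)) h =
        Chain-centre (simplicial ι injective) L′ (∈S ι injective eq) avoids smaller
        where
        avoids : Avoids (root ι v) L′
        avoids e∈ = (λ { refl → case trans (sym v∉) (proj₁ (L′⊆V′ e∈)) of λ () }) , (λ { refl → case trans (sym v∉) (proj₂ (L′⊆V′ e∈)) of λ () })
      cases true v∈ with search (λ u → does (Fin.any? (λ b → E Γ v u b Bool.≟ true)) ∧ not (V′ (root ι u)))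
      ... | inj₁ (u , h) with h₁ , h₂ ← ∧-true {does (Fin.any? (λ b → E Γ v u b Bool.≟ true))} h
        with b , eq ← does-true (Fin.any? (λ b → E Γ v u b Bool.≟ true)) h₁ =
        Takeover.takeover P v∈ eq (¬true⇒false (λ t → case trans (sym h₂) (cong not t) of λ ())) IH
      -- All neighbours of v are shared, so the star occurs in `L′` already.
      ... | inj₂ none = respects (absorbed (star-⊑ inside′)) smaller
        where
        inside′ : ∀ {j b} → E Γ v j b ≡ true → (root ι v , spoke ι injective (j , b)) ∈± L′
        inside′ {j} {b} eq with j∈ , j≢v ← neighbour eq = shared v∈V j∈ v∈ j∈V′ (j≢v ∘ sym) _
          where
          j∈V′ : V′ (root ι j) ≡ true
          j∈V′ with V′ (root ι j) in e
          ... | true  = refl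
          ... | false = case trans (sym (none j)) (∧-intro (dec-true (Fin.any? (λ b → E Γ v j b Bool.≟ true)) (b , eq)) (cong not e)) of λ ()

  module Glued (Γ : GainGraph N k) (A B : Subset N)
    (V⊆ : ∀ {u} → mem u (V Γ) ≡ true → mem u A ≡ true ⊎ mem u B ≡ true)
    (A⊆V : ∀ {u} → mem u A ≡ true → mem u (V Γ) ≡ true) (B⊆V : ∀ {u} → mem u B ≡ true → mem u (V Γ) ≡ true)
    (E⊆ : ∀ {u v a} → E Γ u v a ≡ true → E (induced Γ A) u v a ≡ true ⊎ E (induced Γ B) u v a ≡ true)
    (A∩B : ∀ {u v} → mem u A ≡ true → mem u B ≡ true → mem v A ≡ true → mem v B ≡ true → u ≢ v → ∀ a → E Γ u v a ≡ true)
    (reduceA : Reduces (induced Γ A)) (reduceB : Reduces (induced Γ B)) where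

    E-induced : ∀ {u v a} W → mem u W ≡ true → mem v W ≡ true → E Γ u v a ≡ true → E (induced Γ W) u v a ≡ true
    E-induced W u∈ v∈ h = ∧-intro u∈ (∧-intro v∈ h)

    E-induced⁻ : ∀ {u v a} W → E (induced Γ W) u v a ≡ true → E Γ u v a ≡ true
    E-induced⁻ {u} {v} W h = proj₂ (∧-true {mem v W} (proj₂ (∧-true {mem u W} h)))

    -- As A contains every shared vertex, B meets the surrounding graph enlarged by Γ[A] exactly in
    -- A ∩ B, which is complete; so B is contracted over this larger graph.
    glue-over-A : ∀ ι V′ L′ → Placed Γ ι V′ L′ → (∀ {u} → mem u (V Γ) ≡ true → V′ (root ι u) ≡ true → mem u A ≡ true) →
                  Chain (embed ι Γ ++ L′) L′
    glue-over-A ι V′ L′ P T⊆A = respects parts (append (reduceB ι V″ L″ placedB) (reduceA ι V′ L′ placedA))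
      where
      open Placed P
      L″ : List (Triple N)
      L″ = embed ι (induced Γ A) ++ L′
      at : Fin N → Fin N → Bool
      at i u = mem u A ∧ does (root ι u Fin.≟ i)
      V″ : Fin N → Bool
      V″ i = V′ i ∨ does (Fin.any? (λ u → at i u Bool.≟ true))
      V″-A : ∀ {u} → mem u A ≡ true → V″ (root ι u) ≡ true
      V″-A {u} u∈ = ∨-introʳ (dec-true (Fin.any? (λ w → at (root ι u) w Bool.≟ true)) (u , ∧-intro u∈ (dec-true (root ι u Fin.≟ root ι u) refl)))
      V″⇒A : ∀ {u} → mem u (V Γ) ≡ true → V″ (root ι u) ≡ true → mem u A ≡ true
      V″⇒A {u} u∈ h with ∨-true {V′ (root ι u)} h
      ... | inj₁ p = T⊆A u∈ p
      ... | inj₂ q with w , r ← does-true (Fin.any? (λ w → at (root ι u) w Bool.≟ true)) q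
        with w∈ , e ← ∧-true {mem w A} r =
        subst (λ z → mem z A ≡ true) (injective (A⊆V w∈) u∈ (does-true (root ι w Fin.≟ root ι u) e)) w∈
      placedA : Placed (induced Γ A) ι V′ L′
      placedA = record
        { injective = λ u∈ v∈ → injective (A⊆V u∈) (A⊆V v∈)
        ; L′⊆V′     = L′⊆V′
        ; complete  = λ u∈ v∈ u∈′ v∈′ ne a → E-induced A u∈ v∈ (complete (A⊆V u∈) (A⊆V v∈) u∈′ v∈′ ne a)
        ; shared    = λ u∈ v∈ → shared (A⊆V u∈) (A⊆V v∈) }
      joint : ∀ {u v} → mem u B ≡ true → mem v B ≡ true → V″ (root ι u) ≡ true → V″ (root ι v) ≡ true → u ≢ v → ∀ a → E Γ u v a ≡ true
      joint u∈ v∈ u∈″ v∈″ = A∩B (V″⇒A (B⊆V u∈) u∈″) u∈ (V″⇒A (B⊆V v∈) v∈″) v∈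
      placedB : Placed (induced Γ B) ι V″ L″
      placedB = record
        { injective = λ u∈ v∈ → injective (B⊆V u∈) (B⊆V v∈)
        ; L′⊆V′     = inside″
        ; complete  = λ u∈ v∈ u∈″ v∈″ ne a → E-induced B u∈ v∈ (joint u∈ v∈ u∈″ v∈″ ne a)
        ; shared    = λ {u} {v} u∈ v∈ u∈″ v∈″ ne a → ∈±-++ˡ (inj₁ (subst (_∈ embed ι (induced Γ A))
            (cong (λ g → root ι u , root ι v , g) (Solver.solve (a ∷ gain ι u ∷ gain ι v ∷ []) (((v0 ⊞ v1 ⊞ (⊟ v2)) ⊞ v2) ⊞ (⊟ v1)) v0 refl))
            (∈-embed ι (induced Γ A) {u , v , (a ⊕ gain ι u) ⊕ (⊖ gain ι v)} (E-induced A (V″⇒A (B⊆V u∈) u∈″) (V″⇒A (B⊆V v∈) v∈″) (joint u∈ v∈ u∈″ v∈″ ne _))))) }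
        where
        inside″ : ∀ {i j a} → (i , j , a) ∈ L″ → V″ i ≡ true × V″ j ≡ true
        inside″ e∈ with Mem.∈-++⁻ (embed ι (induced Γ A)) e∈
        ... | inj₂ p = ∨-introˡ (proj₁ (L′⊆V′ p)) , ∨-introˡ (proj₂ (L′⊆V′ p))
        ... | inj₁ p with ∈-embed⁻ ι (induced Γ A) p
        ...   | (i , j , a) , h , refl = V″-A (proj₁ (∧-true {mem i A} h)) , V″-A (proj₁ (∧-true {mem j A} (proj₂ (∧-true {mem i A} h))))
      parts : (embed ι Γ ++ L′) ≋ (embed ι (induced Γ B) ++ L″)
      parts = ++-⊑ {L = embed ι Γ} forward (⊑-++ʳ (embed ι (induced Γ B)) (⊑-++ʳ (embed ι (induced Γ A)) ⊑-refl)) ,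
              ++-⊑ {L = embed ι (induced Γ B)} (⊑-++ˡ (backward B)) (++-⊑ {L = embed ι (induced Γ A)} (⊑-++ˡ (backward A)) (⊑-++ʳ (embed ι Γ) ⊑-refl))
        where
        forward : embed ι Γ ⊑ (embed ι (induced Γ B) ++ L″)
        forward e∈ with ∈-embed⁻ ι Γ e∈
        ... | e , h , refl with E⊆ h
        ...   | inj₁ p = inj₂ (∈±-++ʳ (embed ι (induced Γ B)) (∈±-++ˡ (inj₁ (∈-embed ι (induced Γ A) p))))
        ...   | inj₂ p = inj₂ (∈±-++ˡ (inj₁ (∈-embed ι (induced Γ B) p)))
        backward : ∀ W → embed ι (induced Γ W) ⊑ embed ι Γ
        backward W e∈ with ∈-embed⁻ ι (induced Γ W) e∈
        ... | (i , j , a) , h , refl = inj₂ (inj₁ (∈-embed ι Γ (E-induced⁻ W h)))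

  -- The shared vertices form a clique, and no edge joins a vertex outside V₁ to one outside V₂;
  -- hence one of the two parts contains them all and can play the rôle of A.
  reduces-glue : (Γ : GainGraph N k) (V₁ V₂ : Subset N) → V Γ ≡ V₁ ∪ V₂ →
    (∀ u v a → E Γ u v a ≡ (E (induced Γ V₁) u v a ∨ E (induced Γ V₂) u v a)) →
    (∀ u v → mem u V₁ ∧ mem u V₂ ≡ true → mem v V₁ ∧ mem v V₂ ≡ true → u ≢ v → ∀ a → E Γ u v a ≡ true) →
    Reduces (induced Γ V₁) → Reduces (induced Γ V₂) → Reduces Γ
  reduces-glue Γ V₁ V₂ V≡ E≡ A∩B r₁ r₂ ι V′ L′ P with search (λ u → mem u (V Γ) ∧ (V′ (root ι u) ∧ not (mem u V₁)))
  ... | inj₂ none = Glued.glue-over-A Γ V₁ V₂ cover ⊆₁ ⊆₂ E∨ (λ p q r s → A∩B _ _ (∧-intro p q) (∧-intro r s)) r₁ r₂ ι V′ L′ P in₁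
    where
    cover : ∀ {u} → mem u (V Γ) ≡ true → mem u V₁ ≡ true ⊎ mem u V₂ ≡ true
    cover {u} h = ∨-true (trans (sym (mem-∪ V₁ V₂ u)) (subst (λ W → mem u W ≡ true) V≡ h))
    ⊆₁ : ∀ {u} → mem u V₁ ≡ true → mem u (V Γ) ≡ true
    ⊆₁ {u} h = subst (λ W → mem u W ≡ true) (sym V≡) (trans (mem-∪ V₁ V₂ u) (∨-introˡ h))
    ⊆₂ : ∀ {u} → mem u V₂ ≡ true → mem u (V Γ) ≡ true
    ⊆₂ {u} h = subst (λ W → mem u W ≡ true) (sym V≡) (trans (mem-∪ V₁ V₂ u) (∨-introʳ h))
    E∨ : ∀ {u v a} → E Γ u v a ≡ true → E (induced Γ V₁) u v a ≡ true ⊎ E (induced Γ V₂) u v a ≡ true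
    E∨ {u} {v} {a} h = ∨-true (trans (sym (E≡ u v a)) h)
    in₁ : ∀ {u} → mem u (V Γ) ≡ true → V′ (root ι u) ≡ true → mem u V₁ ≡ true
    in₁ {u} u∈ u∈′ with mem u V₁ in e
    ... | true  = refl
    ... | false = case trans (sym (none u)) (∧-intro u∈ (∧-intro u∈′ (cong not e))) of λ ()
  ... | inj₁ (w , h) with w∈ , h′ ← ∧-true {mem w (V Γ)} h with w∈′ , w∉₁ ← ∧-true {V′ (root ι w)} h′ =
    Glued.glue-over-A Γ V₂ V₁ cover ⊆₂ ⊆₁ E∨ (λ p q r s → A∩B _ _ (∧-intro q p) (∧-intro s r)) r₂ r₁ ι V′ L′ P in₂
    where
    cover : ∀ {u} → mem u (V Γ) ≡ true → mem u V₂ ≡ true ⊎ mem u V₁ ≡ true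
    cover {u} h = ∨-true (trans (Bool.∨-comm (mem u V₂) _) (trans (sym (mem-∪ V₁ V₂ u)) (subst (λ W → mem u W ≡ true) V≡ h)))
    ⊆₁ : ∀ {u} → mem u V₁ ≡ true → mem u (V Γ) ≡ true
    ⊆₁ {u} h = subst (λ W → mem u W ≡ true) (sym V≡) (trans (mem-∪ V₁ V₂ u) (∨-introˡ h))
    ⊆₂ : ∀ {u} → mem u V₂ ≡ true → mem u (V Γ) ≡ true
    ⊆₂ {u} h = subst (λ W → mem u W ≡ true) (sym V≡) (trans (mem-∪ V₁ V₂ u) (∨-introʳ h))
    E∨ : ∀ {u v a} → E Γ u v a ≡ true → E (induced Γ V₂) u v a ≡ true ⊎ E (induced Γ V₁) u v a ≡ true
    E∨ {u} {v} {a} h = ∨-true (trans (Bool.∨-comm (E (induced Γ V₂) u v a) _) (trans (sym (E≡ u v a)) h))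
    -- A shared vertex u outside V₂ would be joined to w, which lies outside V₁.
    in₂ : ∀ {u} → mem u (V Γ) ≡ true → V′ (root ι u) ≡ true → mem u V₂ ≡ true
    in₂ {u} u∈ u∈′ with mem u V₂ in e
    ... | true  = refl
    ... | false = contradiction joined no-edge
      where
      ∉₁ : mem w V₁ ≡ false
      ∉₁ = trans (sym (Bool.not-involutive _)) (cong not w∉₁)
      w≢u : w ≢ u
      w≢u refl = case cover w∈ of λ { (inj₁ p) → case trans (sym e) p of λ () ; (inj₂ p) → case trans (sym ∉₁) p of λ () }
      joined : E Γ w u ε ≡ true
      joined = Placed.complete P w∈ u∈ w∈′ u∈′ w≢u ε
      no-edge : ¬ E Γ w u ε ≡ true
      no-edge h with E∨ h
      ... | inj₁ p = case trans (sym e) (proj₁ (∧-true {mem u V₂} (proj₂ (∧-true {mem w V₂} p)))) of λ ()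
      ... | inj₂ p = case trans (sym ∉₁) (proj₁ (∧-true {mem w V₁} p)) of λ ()

  inC-reduces : {Γ : GainGraph N k} → InC Γ → Reduces Γ
  inC-reduces (null Γ wf _ empty) ι V′ L′ P = done (++-⊑ {L = embed ι Γ} none ⊑-refl , ⊑-++ʳ (embed ι Γ) ⊑-refl)
    where
    none : embed ι Γ ⊑ L′
    none e∈ with ∈-embed⁻ ι Γ e∈
    ... | (i , j , a) , h , refl = case trans (sym h) (empty i j a) of λ ()
  inC-reduces (simpl Γ v wf v∈ ls c) = AtSimplicialVertex.reduces Γ v wf v∈ ls (inC-reduces c)
  inC-reduces (glue Γ V₁ V₂ wf V≡ c₁ c₂ E≡ A∩B) = reduces-glue Γ V₁ V₂ V≡ E≡ A∩B (inC-reduces c₁) (inC-reduces c₂)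

  InC⇒WF : {Γ : GainGraph N k} → InC Γ → WF Γ
  InC⇒WF (null _ wf _ _)             = wf
  InC⇒WF (simpl _ _ wf _ _ _)        = wf
  InC⇒WF (glue _ _ _ wf _ _ _ _ _)   = wf

  inC-chain : {Γ : GainGraph N k} → InC Γ → Chain (edges Γ) []
  inC-chain {Γ = Γ} c = respects (embedded , unembedded)
      (inC-reduces c idᵣ (λ _ → false) [] (record { injective = λ _ _ e → e ; L′⊆V′ = λ () ; complete = λ _ _ () ; shared = λ _ _ () }))
    where
    embedded : edges Γ ⊑ (embed idᵣ Γ ++ [])
    embedded {e} e∈ = inj₂ (inj₁ (Mem.∈-++⁺ˡ (subst (_∈ embed idᵣ Γ) (move-id e) (Mem.∈-map⁺ (move idᵣ) e∈))))
    unembedded : (embed idᵣ Γ ++ []) ⊑ edges Γ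
    unembedded e∈ with Mem.∈-++⁻ (embed idᵣ Γ) e∈
    ... | inj₁ p with Mem.∈-map⁻ (move idᵣ) p
    ...   | e , e∈′ , refl = inj₂ (inj₁ (subst (_∈ edges Γ) (sym (move-id e)) e∈′))

  1<size : ∀ q → 1 ℕ.< q → 1 ℕ.< q ℕ.* k
  1<size q 1<q = ℕ.<-≤-trans 1<q (ℕ.≤-trans (ℕ.≤-reflexive (sym (ℕ.*-identityʳ q))) (ℕ.*-monoʳ-≤ q 0<k))

  module PalettePoints (q : ℕ) (1<q : 1 ℕ.< q) =
    Points (Palette.enum (palette q)) (Palette.action (palette q))
           (λ c a e → Palette.free (palette q) c (trans e (sym (Palette.·-ε (palette q) c))))
           (q ℕ.* k) (1<size q 1<q) (length-palette q)

  -- From chains of contractions to flags of flats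

  module Family {N m : ℕ} (tr : Fin m → Triple N) where

    E₀ : List (Triple N)
    E₀ = List.tabulate tr

    form : Fin (suc m) → Form N
    form Fin.zero    = const K.1# (no (λ h → IsField.0≉1 isField (K.sym h)))
    form (Fin.suc l) = edge (tr l)

    -- The equations implied by the contracted edges alone; {z = 0}, at index zero, is not among
    -- them.
    closure : Relabelling N N → Subset (suc m)
    closure ξ = false ∷ tabulate (λ l → trivial (move ξ (tr l)))

    mem-closure : ∀ ξ l → mem (Fin.suc l) (closure ξ) ≡ trivial (move ξ (tr l))
    mem-closure ξ l = Vec.lookup∘tabulate _ l

    trivial-intro : ∀ (i j : Fin N) {a} → i ≡ j → a ≡ ε → trivial (i , j , a) ≡ true
    trivial-intro i j {a} p q = ∧-intro (dec-true (i Fin.≟ j) p) (dec-true (a Fin.≟ ε) q)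

    trivial-move : (τ : Relabelling N N) (e : Triple N) → trivial e ≡ true → trivial (move τ e) ≡ true
    trivial-move τ (i , j , a) h with p , q ← ∧-true {does (i Fin.≟ j)} h
      with refl ← does-true (i Fin.≟ j) p | refl ← does-true (a Fin.≟ ε) q =
      trivial-intro (root τ i) (root τ i) refl (Solver.solve (gain τ i ∷ []) ((nil ⊞ v0) ⊞ (⊟ v0)) nil refl)

    -- ξ records the composite of i contractions: root ξ j is the representative of
    -- j, and the equations contracted so far amount to x = pull x ξ.
    record Contracted (i : ℕ) (ξ : Relabelling N N) : Set₁ where
      field
        rooted    : ∀ j → ξ (root ξ j) ≡ (root ξ j , ε)
        connected : ∀ {C} (eC : Enumeration C) (A : Action C) (x : Vec C N) →
                    (∀ l → trivial (move ξ (tr l)) ≡ true → Colouring.sat eC A x (tr l) ≡ true) →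
                    Colouring.pull eC A x ξ ≡ x
        -- `pull` projects all colourings onto the solutions of the contracted equations, with
        -- fibres of size t^i.
        average   : ∀ {C} (eC : Enumeration C) (A : Action C) (H : Vec C N → ℤ) →
                    Averaging.size eC ^ i * ∑ (vecs (elements eC) N) (λ x → ⟦ Enumeration._==_ (vecEnum eC N) (Colouring.pull eC A x ξ) x ⟧ * H x) ≡
                    ∑ (vecs (elements eC) N) (λ x → H (Colouring.pull eC A x ξ))

    contracted-id : Contracted 0 idᵣ
    contracted-id = record
      { rooted    = λ j → refl
      ; connected = λ eC A x _ → Colouring.pull-id eC A x
      ; average   = λ eC A H → trans (ℤ.*-identityˡ _) (∑-cong (vecs (elements eC) N) (λ x →
          trans (cong (λ b → ⟦ b ⟧ * H x) (Enumeration.≡⇒== (vecEnum eC N) (Colouring.pull-id eC A x)))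
                (trans (ℤ.*-identityˡ (H x)) (cong H (sym (Colouring.pull-id eC A x)))))) }

    module Step {i ξ} (inv : Contracted i ξ) {w v a} (w≢v : w ≢ v) (wv∈ : (w , v , a) ∈± map (move ξ) E₀) where
      open Contracted inv

      τ ξ′ : Relabelling N N
      τ  = contract w v a
      ξ′ = τ ⊙ ξ

      source : Σ (Fin m) λ l → move ξ (tr l) ≡ (w , v , a) ⊎ move ξ (tr l) ≡ (v , w , ⊖ a)
      source = go wv∈
        where
        go : (w , v , a) ∈± map (move ξ) E₀ → Σ (Fin m) λ l → move ξ (tr l) ≡ (w , v , a) ⊎ move ξ (tr l) ≡ (v , w , ⊖ a)
        go (inj₁ p) with Mem.∈-map⁻ (move ξ) p
        ... | e , e∈ , eq with Mem.∈-tabulate⁻ e∈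
        ...   | l , refl = l , inj₁ (sym eq)
        go (inj₂ p) with Mem.∈-map⁻ (move ξ) p
        ... | e , e∈ , eq with Mem.∈-tabulate⁻ e∈
        ...   | l , refl = l , inj₂ (sym eq)

      l₀ : Fin m
      l₀ = proj₁ source

      -- Both ends of a moved edge are representatives.
      roots-wv : ξ w ≡ (w , ε) × ξ v ≡ (v , ε)
      roots-wv with source
      ... | l , inj₁ e = subst (λ j → ξ j ≡ (j , ε)) (cong proj₁ e) (rooted _) , subst (λ j → ξ j ≡ (j , ε)) (cong (proj₁ ∘ proj₂) e) (rooted _)
      ... | l , inj₂ e = subst (λ j → ξ j ≡ (j , ε)) (cong (proj₁ ∘ proj₂) e) (rooted _) , subst (λ j → ξ j ≡ (j , ε)) (cong proj₁ e) (rooted _)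

      trivial-l₀ : trivial (move ξ′ (tr l₀)) ≡ true
      trivial-l₀ with source
      ... | l , inj₁ e = subst (λ t → trivial t ≡ true) (trans (cong (move τ) (sym e)) (move-⊙ τ ξ (tr l))) contracted
        where
        contracted : trivial (move τ (w , v , a)) ≡ true
        contracted rewrite contract-at w v a | contract-off {w = w} {v} {a} (w≢v ∘ sym) =
          trivial-intro v v refl (Solver.solve (a ∷ []) ((v0 ⊞ nil) ⊞ (⊟ v0)) nil refl)
      ... | l , inj₂ e = subst (λ t → trivial t ≡ true) (trans (cong (move τ) (sym e)) (move-⊙ τ ξ (tr l))) contracted
        where
        contracted : trivial (move τ (v , w , ⊖ a)) ≡ true
        contracted rewrite contract-at w v a | contract-off {w = w} {v} {a} (w≢v ∘ sym) =
          trivial-intro v v refl (Solver.solve (a ∷ []) (((⊟ v0) ⊞ v0) ⊞ (⊟ nil)) nil refl)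

      trivial-mono : ∀ l → trivial (move ξ (tr l)) ≡ true → trivial (move ξ′ (tr l)) ≡ true
      trivial-mono l h = subst (λ t → trivial t ≡ true) (move-⊙ τ ξ (tr l)) (trivial-move τ (move ξ (tr l)) h)

      ξ′-root : ∀ j → j ≢ w → ξ j ≡ (j , ε) → ξ′ j ≡ (j , ε)
      ξ′-root j j≢w e rewrite e | contract-off {w = w} {v} {a} j≢w = cong (j ,_) (⊕-identityˡ ε)

      rooted′ : ∀ j → ξ′ (root ξ′ j) ≡ (root ξ′ j , ε)
      rooted′ j with root ξ j Fin.≟ w
      ... | yes refl = ξ′-root v (w≢v ∘ sym) (proj₂ roots-wv)
      ... | no  ne   = ξ′-root (root ξ j) ne (rooted j)

      module _ {C} (eC : Enumeration C) (A : Action C) where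
        open Colouring eC A
        open Averaging eC renaming (size to t)
        private
          module Vs = Enumeration (vecEnum eC N)
          xs = vecs (elements eC) N
          cs = elements eC

        pull-τ-id : ∀ x → lookup x w ≡ lookup x v · a → pull x τ ≡ x
        pull-τ-id x e = trans (pull-contract x w v a) (trans (cong (x [ w ]≔_) (sym e)) (Vec.[]≔-lookup x w))

        pull-ξ′ : ∀ x → pull x ξ ≡ x → lookup x w ≡ lookup x v · a → pull x ξ′ ≡ x
        pull-ξ′ x p e = trans (sym (pull-⊙ x τ ξ)) (trans (cong (λ y → pull y ξ) (pull-τ-id x e)) p)

        connected′ : ∀ x → (∀ l → trivial (move ξ′ (tr l)) ≡ true → sat x (tr l) ≡ true) → pull x ξ′ ≡ x
        connected′ x h = pull-ξ′ x pulled edge-wv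
          where
          pulled : pull x ξ ≡ x
          pulled = connected eC A x (λ l p → h l (trivial-mono l p))
          sat-l₀ : sat x (move ξ (tr l₀)) ≡ true
          sat-l₀ = trans (sat-move x ξ (tr l₀)) (trans (cong (λ y → sat y (tr l₀)) pulled) (h l₀ trivial-l₀))
          edge-wv : lookup x w ≡ lookup x v · a
          edge-wv with source | sat-l₀
          ... | l , inj₁ e | s = ==⇒≡ (subst (λ t → sat x t ≡ true) e s)
          ... | l , inj₂ e | s = ==⇒≡ (trans (sym (sat-flip x (w , v , a))) (subst (λ t → sat x t ≡ true) e s))

        fixed-split : ∀ x → (pull x ξ′ Vs.== x) ≡ (pull x ξ Vs.== x) ∧ (lookup x w == lookup x v · a)
        fixed-split x = true⇔⇒≡ there′ (λ h → let p , q = ∧-true {pull x ξ Vs.== x} h in Vs.≡⇒== (pull-ξ′ x (Vs.==⇒≡ p) (==⇒≡ q)))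
          where
          there′ : (pull x ξ′ Vs.== x) ≡ true → (pull x ξ Vs.== x) ∧ (lookup x w == lookup x v · a) ≡ true
          there′ h = ∧-intro (Vs.≡⇒== (trans (cong (λ y → pull y ξ) (sym (pull-τ-id x e))) (trans (pull-⊙ x τ ξ) h′))) (≡⇒== e)
            where
            h′ : pull x ξ′ ≡ x
            h′ = Vs.==⇒≡ h
            ξ′-w : ξ′ w ≡ (v , a)
            ξ′-w rewrite proj₁ roots-wv | contract-at w v a = cong (v ,_) (⊕-identityʳ a)
            e : lookup x w ≡ lookup x v · a
            e = trans (cong (λ y → lookup y w) (sym h′)) (trans (lookup-pull x ξ′ w) (cong (λ p → lookup x (proj₁ p) · proj₂ p) ξ′-w))

        lookup-root : ∀ x {j} → ξ j ≡ (j , ε) → lookup (pull x ξ) j ≡ lookup x j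
        lookup-root x {j} e = trans (lookup-pull x ξ j) (trans (cong (λ p → lookup x (proj₁ p) · proj₂ p) e) (·-ε _))

        -- The equation of the new edge only concerns representatives, which `pull x ξ` does not
        -- recolour. It fixes the colour of w, and averaging over this colour yields the additional
        -- factor t.
        average′ : (H : Vec C N → ℤ) → t ^ suc i * ∑ xs (λ x → ⟦ pull x ξ′ Vs.== x ⟧ * H x) ≡ ∑ xs (λ x → H (pull x ξ′))
        average′ H = begin
          t ^ suc i * ∑ xs (λ x → ⟦ pull x ξ′ Vs.== x ⟧ * H x)
            ≡⟨ ℤ.*-assoc t (t ^ i) _ ⟩
          t * (t ^ i * ∑ xs (λ x → ⟦ pull x ξ′ Vs.== x ⟧ * H x))
            ≡⟨ cong (λ s → t * (t ^ i * s)) (∑-cong xs (λ x → trans (cong (λ b → ⟦ b ⟧ * H x) (fixed-split x))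
                 (trans (cong (_* H x) (⟦∧⟧ (pull x ξ Vs.== x) _)) (ℤ.*-assoc ⟦ pull x ξ Vs.== x ⟧ _ (H x))))) ⟩
          t * (t ^ i * ∑ xs (λ x → ⟦ pull x ξ Vs.== x ⟧ * H′ x))
            ≡⟨ cong (t *_) (average eC A H′) ⟩
          t * ∑ xs (λ x → H′ (pull x ξ))
            ≡⟨ cong (t *_) (∑-cong xs (λ x → cong (λ b → ⟦ b ⟧ * H (pull x ξ))
                 (cong₂ (λ c d → c == d · a) (lookup-root x (proj₁ roots-wv)) (lookup-root x (proj₂ roots-wv))))) ⟩
          t * ∑ xs (λ x → ⟦ lookup x w == lookup x v · a ⟧ * H (pull x ξ))
            ≡⟨ sym (∑-average w (λ x → ⟦ lookup x w == lookup x v · a ⟧ * H (pull x ξ))) ⟩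
          ∑ xs (λ x → ∑ cs (λ c → ⟦ lookup (x [ w ]≔ c) w == lookup (x [ w ]≔ c) v · a ⟧ * H (pull (x [ w ]≔ c) ξ)))
            ≡⟨ ∑-cong xs (λ x → trans (∑-cong cs (λ c → cong (λ b → ⟦ b ⟧ * H (pull (x [ w ]≔ c) ξ))
                 (cong₂ (λ c d → c == d · a) (Vec.lookup∘updateAt w x) (Vec.lookup∘updateAt′ v w (w≢v ∘ sym) x))))
                 (Enumeration.∑-pick eC (lookup x v · a) (λ c → H (pull (x [ w ]≔ c) ξ)))) ⟩
          ∑ xs (λ x → H (pull (x [ w ]≔ (lookup x v · a)) ξ))
            ≡⟨ ∑-cong xs (λ x → cong H (trans (cong (λ y → pull y ξ) (sym (pull-contract x w v a))) (pull-⊙ x τ ξ))) ⟩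
          ∑ xs (λ x → H (pull x ξ′)) ∎
          where
          open ≡-Reasoning
          H′ : Vec C N → ℤ
          H′ x = ⟦ lookup x w == lookup x v · a ⟧ * H x

      contracted′ : Contracted (suc i) ξ′
      contracted′ = record { rooted = rooted′ ; connected = connected′ ; average = average′ }

    flat-mono : ∀ ξ ξ′ → (∀ l → trivial (move ξ (tr l)) ≡ true → trivial (move ξ′ (tr l)) ≡ true) → (closure ξ ⊆ᵇ closure ξ′) ≡ true
    flat-mono ξ ξ′ h = ⊆ᵇ-intro (closure ξ) (closure ξ′) λ
      { (Fin.suc l) p → trans (mem-closure ξ′ l) (h l (trans (sym (mem-closure ξ l)) p)) }

    -- Only the numbers of points, not the definition of the rank, matter below.
    module Ranked (rk : Subset (suc m) → ℕ) (rank≤ : ∀ S → rk S ℕ.≤ suc N)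
      (points-rank : ∀ q (1<q : 1 ℕ.< q) S → PalettePoints.points q 1<q form S ≡ pos ((q ℕ.* k) ℕ.^ (suc N ∸ rk S))) where

      module AtPalette (q : ℕ) (1<q : 1 ℕ.< q) (N<q : N ℕ.< q) where
        P : Palette
        P = palette q
        open Palette P using (Colour; enum; action; free)
        open Proper P using (proper; ok; ok-elim; proper-∈)

        t : ℕ
        t = q ℕ.* k

        1<t : 1 ℕ.< t
        1<t = 1<size q 1<q

        size-t : length (elements enum) ≡ t
        size-t = length-palette q

        module Fr = Colouring enum action

        open PalettePoints q 1<q
        open Realization rk (suc N) rank≤ (pointEnum N) (satPt form) t 1<t (points-rank q 1<q)

        private
          cs = elements enum
          xs = vecs cs N
          module Vs = Enumeration (vecEnum enum N)

        scaledBy : ∀ b → Action Colour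
        scaledBy b = scaled b action

        fixed : Bool → Relabelling N N → Vec Colour N → Bool
        fixed b ξ x = Colouring.pull enum (scaledBy b) x ξ Vs.== x

        fixed⇒≡ : ∀ b ξ x → fixed b ξ x ≡ true → Colouring.pull enum (scaledBy b) x ξ ≡ x
        fixed⇒≡ b ξ x = Vs.==⇒≡ {Colouring.pull enum (scaledBy b) x ξ} {x}

        z₁ : Fin t
        z₁ = Fin.fromℕ< 1<t

        z₁-nonzero : isZero z₁ ≡ false
        z₁-nonzero = cong (_≡ᵇ 0) (Fin.toℕ-fromℕ< 1<t)

        nonzero-sum : (F : Bool → ℤ) → F true ≡ 0ℤ → ∑ (allFin t) (λ z → F (isZero z)) ≡ pos (ℕ.pred t) * F false
        nonzero-sum F h = trans (∑-cong (allFin t) (λ z → branch (isZero z))) (trans (∑-z 0ℤ (F false)) (ℤ.+-identityˡ _))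
          where
          branch : ∀ b → F b ≡ (if b then 0ℤ else F false)
          branch true  = h
          branch false = refl

        t≢0 : ℕ.NonZero t
        t≢0 = ℕ.>-nonZero (ℕ.<-trans (s≤s z≤n) 1<t)

        powers-≢0 : ∀ e → ℤ.NonZero (pos (t ℕ.^ e))
        powers-≢0 e = pos≢0 (ℕ.m^n>0 t {{t≢0}} e)

        exponents : ∀ e f g → pos (t ℕ.^ e) * pos (t ℕ.^ f) ≡ pos (t ℕ.^ g) → e ℕ.+ f ≡ g
        exponents e f g h = ℕ.≤-antisym (^-cancel-≤ t _ _ 1<t (ℕ.≤-reflexive eq)) (^-cancel-≤ t _ _ 1<t (ℕ.≤-reflexive (sym eq)))
          where
          eq : t ℕ.^ (e ℕ.+ f) ≡ t ℕ.^ g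
          eq = trans (ℕ.^-distribˡ-+-* t e f) (ℤ.+-injective (trans (ℤ.pos-* (t ℕ.^ e) (t ℕ.^ f)) h))

        count-xs : ∀ n → ∑ (vecs cs n) (λ _ → 1ℤ) ≡ pos (t ℕ.^ n)
        count-xs zero    = refl
        count-xs (suc n) = trans (∑-vecs-suc cs n _) (trans (∑-cong cs (λ _ → count-xs n))
          (trans (∑-const cs _) (trans (cong (λ s → pos s * pos (t ℕ.^ n)) size-t) (sym (ℤ.pos-* t (t ℕ.^ n))))))

        charPoly-at : ∀ {X} ω → satPt form ω ≡ X →
          pos (t ℕ.^ (suc N ∸ rk ⊤)) * evalPoly (charPolyContr rk X) (suc N) (pos t) ≡ ∑ (elements (pointEnum N)) (λ ω → ⟦ satPt form ω =ᵇ X ⟧)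
        charPoly-at ω refl = Contraction.charPoly-count ω (suc N) (Contraction.ρD≤R ω)

        charPoly-degree : ∀ {X} ω → satPt form ω ≡ X → ∀ d → suc N ℕ.< d → charPolyContr rk X d ≡ 0ℤ
        charPoly-degree ω refl d lt = Contraction.charPoly-high ω d (ℕ.≤-<-trans (Contraction.ρD≤R ω) lt)

        isFlat-at : ∀ {X} ω → satPt form ω ≡ X → MatroidOps.isFlat ⊤ rk X ≡ true
        isFlat-at ω refl = sat-isFlat ω

        -- The top flat: z = 0 and all vertices equal.
        ω⊤ : Point N
        ω⊤ = Fin.fromℕ< (ℕ.<-trans (s≤s z≤n) 1<t) , Vec.replicate N (Fin.fromℕ< 1<q , ε)

        isZero-ω⊤ : isZero (proj₁ ω⊤) ≡ true
        isZero-ω⊤ = cong (_≡ᵇ 0) (Fin.toℕ-fromℕ< (ℕ.<-trans (s≤s z≤n) 1<t))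

        sat-ω⊤ : satPt form ω⊤ ≡ ⊤
        sat-ω⊤ = subset-ext {X = satPt form ω⊤} {⊤} (λ i → trans (mem-satSet form _ _ i) (trans (each i) (sym (mem-⊤ i))))
          where
          each : ∀ i → satForm (form i) (isZero (proj₁ ω⊤)) (proj₂ ω⊤) ≡ true
          each Fin.zero    = ∨-introˡ isZero-ω⊤
          each (Fin.suc l) rewrite isZero-ω⊤ with tr l
          ... | i , j , a = Fr.≡⇒== (trans (Vec.lookup-replicate i c₀) (sym (Vec.lookup-replicate j c₀)))
            where
            c₀ : Fin q × Fin k
            c₀ = Fin.fromℕ< 1<q , ε

        charPoly-top-high : ∀ d → charPolyContr rk ⊤ (suc d) ≡ 0ℤ
        charPoly-top-high d = subst (λ X → charPolyContr rk X (suc d) ≡ 0ℤ) sat-ω⊤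
          (Contraction.charPoly-high ω⊤ (suc d) (ℕ.≤-<-trans (ℕ.≤-reflexive ρD≡0) (s≤s z≤n)))
          where
          ρD≡0 : rk (∁ (satPt form ω⊤) ∪ satPt form ω⊤) ∸ rk (satPt form ω⊤) ≡ 0
          ρD≡0 = trans (cong₂ (λ A B → rk A ∸ rk B) (Contraction.D∪X ω⊤) sat-ω⊤) (ℕ.n∸n≡0 (rk ⊤))

        -- The polynomial is constant, so a single count of the points on all hyperplanes determines
        -- it.
        charPoly-top-0 : charPolyContr rk ⊤ 0 ≡ 1ℤ
        charPoly-top-0 = ℤ.*-cancelˡ-≡ u _ 1ℤ {{powers-≢0 (suc N ∸ rk ⊤)}} (trans (trans lhs count-top) (sym (ℤ.*-identityʳ u)))
          where
          u : ℤ
          u = pos (t ℕ.^ (suc N ∸ rk ⊤))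
          constant : ∀ n → evalPoly (charPolyContr rk ⊤) n (pos t) ≡ charPolyContr rk ⊤ 0
          constant zero    = refl
          constant (suc n) = trans (cong (λ s → charPolyContr rk ⊤ 0 + s) (trans (cong (pos t *_)
            (trans (evalPoly-cong n (pos t) charPoly-top-high) (evalPoly-zero n (pos t)))) (ℤ.*-zeroʳ (pos t)))) (ℤ.+-identityʳ _)
          lhs : u * charPolyContr rk ⊤ 0 ≡ ∑ (elements (pointEnum N)) (λ ω → ⟦ satPt form ω =ᵇ ⊤ ⟧)
          lhs = trans (cong (u *_) (sym (constant (suc N)))) (charPoly-at ω⊤ sat-ω⊤)
          count-top : ∑ (elements (pointEnum N)) (λ ω → ⟦ satPt form ω =ᵇ ⊤ ⟧) ≡ u
          count-top = trans (∑-cong (elements (pointEnum N)) (λ ω → cong ⟦_⟧ (only ω))) (points-rank q 1<q ⊤)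
            where
            only : ∀ ω → (satPt form ω =ᵇ ⊤) ≡ (⊤ ⊆ᵇ satPt form ω)
            only ω = true⇔⇒≡ (λ h → proj₂ (∧-true {satPt form ω ⊆ᵇ ⊤} h))
              (λ h → ∧-intro (⊆ᵇ-intro (satPt form ω) ⊤ (λ i _ → mem-⊤ i)) h)

        module AtState {i ξ} (inv : Contracted i ξ) where
          open Contracted inv
          X = closure ξ
          L = map (move ξ) E₀

          fixed-closure : ∀ b x → (X ⊆ᵇ satSet form b x) ≡ fixed b ξ x
          fixed-closure b x = true⇔⇒≡
            (λ h → Vs.≡⇒== (connected enum (scaledBy b) x (λ l p →
               ⊆satSet⁻ {S = X} {form} {b} {x} h (Fin.suc l) (trans (mem-closure ξ l) p))))
            (λ h → ⊆satSet {S = X} {form} {b} {x} λ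
               { (Fin.suc l) p → trans (cong (λ y → Colouring.sat enum (scaledBy b) y (tr l)) (sym (fixed⇒≡ b ξ x h)))
                   (trans (sym (Colouring.sat-move enum (scaledBy b) x ξ (tr l)))
                          (Colouring.sat-trivial enum (scaledBy b) x (move ξ (tr l)) (trans (sym (mem-closure ξ l)) p))) })

          average-t : ∀ b (H : Vec Colour N → ℤ) → pos (t ℕ.^ i) * ∑ xs (λ x → ⟦ fixed b ξ x ⟧ * H x) ≡ ∑ xs (λ x → H (Colouring.pull enum (scaledBy b) x ξ))
          average-t b H = trans (cong (_* ∑ xs (λ x → ⟦ fixed b ξ x ⟧ * H x)) (trans (pos-^ t i) (cong (λ s → pos s ^ i) (sym size-t)))) (average enum (scaledBy b) H)

          fixed-count : ∀ b → pos (t ℕ.^ i) * ∑ xs (λ x → ⟦ fixed b ξ x ⟧) ≡ pos (t ℕ.^ N)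
          fixed-count b = trans (cong (pos (t ℕ.^ i) *_) (∑-cong xs (λ x → sym (ℤ.*-identityʳ ⟦ fixed b ξ x ⟧))))
            (trans (average-t b (λ _ → 1ℤ)) (count-xs N))

          -- For each of the t values of z the equations in X leave t^(N - i) colourings, so the
          -- corank of X is N + 1 - i.
          rank-closure : rk X ≡ i
          rank-closure = ℕ.+-cancelʳ-≡ (suc N ∸ rk X) (rk X) i (trans (ℕ.m+[n∸m]≡n (rank≤ X)) (sym
            (exponents i (suc N ∸ rk X) (suc N) (trans (cong (pos (t ℕ.^ i) *_) (sym (points-rank q 1<q X))) tally))))
            where
            tally : pos (t ℕ.^ i) * points form X ≡ pos (t ℕ.^ suc N)
            tally = begin
              pos (t ℕ.^ i) * points form X
                ≡⟨ cong (pos (t ℕ.^ i) *_) (trans (points-∑ form X) (∑-cong (allFin t) (λ z → ∑-cong xs (λ x → cong ⟦_⟧ (fixed-closure (isZero z) x))))) ⟩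
              pos (t ℕ.^ i) * ∑ (allFin t) (λ z → ∑ xs (λ x → ⟦ fixed (isZero z) ξ x ⟧))
                ≡⟨ sym (∑-*ˡ (allFin t) (pos (t ℕ.^ i)) _) ⟩
              ∑ (allFin t) (λ z → pos (t ℕ.^ i) * ∑ xs (λ x → ⟦ fixed (isZero z) ξ x ⟧))
                ≡⟨ ∑-cong (allFin t) (λ z → fixed-count (isZero z)) ⟩
              ∑ (allFin t) (λ z → pos (t ℕ.^ N))
                ≡⟨ trans (∑-const (allFin t) (pos (t ℕ.^ N))) (cong (λ s → pos s * pos (t ℕ.^ N)) (length-allFin t)) ⟩
              pos t * pos (t ℕ.^ N)
                ≡⟨ sym (ℤ.pos-* t (t ℕ.^ N)) ⟩
              pos (t ℕ.^ suc N) ∎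
              where open ≡-Reasoning

          -- All representatives receive different orbits of colours.
          orbit : Fin N → Fin q
          orbit j = Fin.inject≤ j (ℕ.<⇒≤ N<q)

          generic : Vec Colour N
          generic = tabulate (λ j → orbit j , ε)

          ω₀ : Point N
          ω₀ = z₁ , Fr.pull generic ξ

          sat-generic : ∀ e → Fr.sat generic e ≡ trivial e
          sat-generic (i , j , a) rewrite Vec.lookup∘tabulate (λ j → orbit j , ε) i | Vec.lookup∘tabulate (λ j → orbit j , ε) j = true⇔⇒≡
            (λ h → let e = Fr.==⇒≡ {orbit i , ε} {orbit j , ε ⊕ a} h in
               trivial-intro i j (Fin.inject≤-injective _ _ i j (cong proj₁ e)) (trans (sym (⊕-identityˡ a)) (sym (cong proj₂ e))))
            (λ h → let p , q = ∧-true {does (i Fin.≟ j)} h in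
               Fr.≡⇒== (cong₂ _,_ (cong orbit (does-true (i Fin.≟ j) p)) (sym (trans (⊕-identityˡ a) (does-true (a Fin.≟ ε) q)))))

          -- With z ≠ 0 and the representatives in different orbits only trivial equations hold.
          -- This exhibits X as the set of hyperplanes through a point, as `Contraction` requires.
          sat-ω₀ : satPt form ω₀ ≡ X
          sat-ω₀ = subset-ext {X = satPt form ω₀} {X} (λ i → trans (mem-satSet form _ _ i) (trans (cong (λ b → satForm (form i) b (Fr.pull generic ξ)) z₁-nonzero) (each i)))
            where
            each : ∀ i → satForm (form i) false (Fr.pull generic ξ) ≡ mem i X
            each Fin.zero    = refl
            each (Fin.suc l) = trans (sym (Fr.sat-move generic ξ (tr l))) (trans (sat-generic (move ξ (tr l))) (sym (mem-closure ξ l)))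

          -- Off z = 0 the action is free, so a non-trivial loop fails by itself and a trivial one
          -- belongs to X; the non-loops of L are exactly the conditions that remain.
          exact : ∀ x → (satSet form false x =ᵇ X) ≡ fixed false ξ x ∧ proper x L
          exact x = true⇔⇒≡ there′ back
            where
            there′ : (satSet form false x =ᵇ X) ≡ true → fixed false ξ x ∧ proper x L ≡ true
            there′ h = ∧-intro fix (allᵇ-intro-∈ (ok x) L each)
              where
              eq : satSet form false x ≡ X
              eq = =ᵇ⇒≡ (satSet form false x) X h
              fix : fixed false ξ x ≡ true
              fix = trans (sym (fixed-closure false x)) (proj₂ (∧-true {satSet form false x ⊆ᵇ X} h))
              sat-l : ∀ l → Fr.sat x (move ξ (tr l)) ≡ trivial (move ξ (tr l))
              sat-l l = trans (Fr.sat-move x ξ (tr l)) (trans (cong (λ y → Fr.sat y (tr l)) (fixed⇒≡ false ξ x fix))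
                (trans (sym (mem-satSet form false x (Fin.suc l))) (trans (cong (mem (Fin.suc l)) eq) (mem-closure ξ l))))
              each : ∀ {e} → e ∈ L → ok x e ≡ true
              each e∈ with Mem.∈-map⁻ (move ξ) e∈
              ... | e′ , e′∈ , refl with Mem.∈-tabulate⁻ e′∈
              ...   | l , refl = trans (cong (λ b → does (proj₁ (move ξ (tr l)) Fin.≟ proj₁ (proj₂ (move ξ (tr l)))) ∨ not b) (sat-l l))
                                   (absorb (does (proj₁ (move ξ (tr l)) Fin.≟ proj₁ (proj₂ (move ξ (tr l))))) _)
                where
                absorb : ∀ a b → a ∨ not (a ∧ b) ≡ true
                absorb true  b = refl
                absorb false b = refl
            back : fixed false ξ x ∧ proper x L ≡ true → (satSet form false x =ᵇ X) ≡ true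
            back h with fix , pL ← ∧-true {fixed false ξ x} h =
              subst (λ Z → (Z =ᵇ X) ≡ true) (sym (subset-ext {X = satSet form false x} {X} (λ i → trans (mem-satSet form false x i) (each i)))) (=ᵇ-refl X)
              where
              via-ok : ∀ e → ok x e ≡ true → Fr.sat x e ≡ trivial e
              via-ok (i , j , a) o = true⇔⇒≡ (λ s → to s (i Fin.≟ j)) (Fr.sat-trivial x (i , j , a))
                where
                to : Fr.sat x (i , j , a) ≡ true → Dec (i ≡ j) → trivial (i , j , a) ≡ true
                to s (no i≢j)   = contradiction (Fr.==⇒≡ s) (ok-elim x i≢j o)
                to s (yes refl) = trivial-intro i i refl (sym (free (lookup x i) (trans (Fr.·-ε _) (Fr.==⇒≡ s))))
              each : ∀ i → satForm (form i) false x ≡ mem i X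
              each Fin.zero    = refl
              each (Fin.suc l) = trans (cong (λ y → Fr.sat y (tr l)) (sym (fixed⇒≡ false ξ x fix))) (trans (sym (Fr.sat-move x ξ (tr l)))
                (trans (via-ok (move ξ (tr l)) (proper-∈ x pL (Mem.∈-map⁺ (move ξ) (Mem.∈-tabulate⁺ l)))) (sym (mem-closure ξ l))))

          -- Properness on L involves representatives only. In `number` the other vertices are
          -- coloured freely, which accounts for the factor t^i.
          exact-count : pos (t ℕ.^ i) * ∑ xs (λ x → ⟦ satSet form false x =ᵇ X ⟧) ≡ number q L
          exact-count = begin
            pos (t ℕ.^ i) * ∑ xs (λ x → ⟦ satSet form false x =ᵇ X ⟧)
              ≡⟨ cong (pos (t ℕ.^ i) *_) (∑-cong xs (λ x → trans (cong ⟦_⟧ (exact x)) (⟦∧⟧ (fixed false ξ x) (proper x L)))) ⟩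
            pos (t ℕ.^ i) * ∑ xs (λ x → ⟦ fixed false ξ x ⟧ * ⟦ proper x L ⟧)
              ≡⟨ average-t false (λ x → ⟦ proper x L ⟧) ⟩
            ∑ xs (λ x → ⟦ proper (Fr.pull x ξ) L ⟧)
              ≡⟨ ∑-cong xs (λ x → cong ⟦_⟧ (Proper.proper-cong P (Fr.pull x ξ) x L (λ e∈ → at-roots x e∈))) ⟩
            number q L ∎
            where
            open ≡-Reasoning
            at-root : ∀ x j → lookup (Fr.pull x ξ) (root ξ j) ≡ lookup x (root ξ j)
            at-root x j = trans (Fr.lookup-pull x ξ (root ξ j)) (trans (cong (λ p → lookup x (proj₁ p) Fr.· proj₂ p) (rooted j)) (Fr.·-ε _))
            at-roots : ∀ x {i j a} → (i , j , a) ∈ L → lookup (Fr.pull x ξ) i ≡ lookup x i × lookup (Fr.pull x ξ) j ≡ lookup x j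
            at-roots x e∈ with Mem.∈-map⁻ (move ξ) e∈
            ... | (i , j , a) , _ , refl = at-root x i , at-root x j

          -- A point lying exactly on X has one of the t - 1 non-zero values of z, because X does
          -- not contain {z = 0}.
          charPoly-number : pos (t ℕ.^ i) * (pos (t ℕ.^ (suc N ∸ rk ⊤)) * evalPoly (charPolyContr rk X) (suc N) (pos t)) ≡ pos (ℕ.pred t) * number q L
          charPoly-number = begin
            pos (t ℕ.^ i) * (pos (t ℕ.^ (suc N ∸ rk ⊤)) * evalPoly (charPolyContr rk X) (suc N) (pos t))
              ≡⟨ cong (pos (t ℕ.^ i) *_) (charPoly-at ω₀ sat-ω₀) ⟩
            pos (t ℕ.^ i) * ∑ (elements (pointEnum N)) (λ ω → ⟦ satPt form ω =ᵇ X ⟧)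
              ≡⟨ cong (pos (t ℕ.^ i) *_) (∑-product (allFin t) xs _) ⟩
            pos (t ℕ.^ i) * ∑ (allFin t) (λ z → ∑ xs (λ x → ⟦ satSet form (isZero z) x =ᵇ X ⟧))
              ≡⟨ cong (pos (t ℕ.^ i) *_) (nonzero-sum (λ b → ∑ xs (λ x → ⟦ satSet form b x =ᵇ X ⟧)) (trans (∑-cong xs (λ x → cong ⟦_⟧ (none x))) (∑-zero xs))) ⟩
            pos (t ℕ.^ i) * (pos (ℕ.pred t) * ∑ xs (λ x → ⟦ satSet form false x =ᵇ X ⟧))
              ≡⟨ swap (pos (t ℕ.^ i)) (pos (ℕ.pred t)) _ ⟩
            pos (ℕ.pred t) * (pos (t ℕ.^ i) * ∑ xs (λ x → ⟦ satSet form false x =ᵇ X ⟧))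
              ≡⟨ cong (pos (ℕ.pred t) *_) exact-count ⟩
            pos (ℕ.pred t) * number q L ∎
            where
            open ≡-Reasoning
            swap : ∀ a b c → a * (b * c) ≡ b * (a * c)
            swap = solve-∀
            none : ∀ x → (satSet form true x =ᵇ X) ≡ false
            none x = refl

          -- Once every edge is a loop, adding z = 0 forces all equations.
          rank-top : (∀ l → root ξ (proj₁ (tr l)) ≡ root ξ (proj₁ (proj₂ (tr l)))) → rk ⊤ ≡ suc i
          rank-top loops = ℕ.+-cancelʳ-≡ (suc N ∸ rk ⊤) (rk ⊤) (suc i) (trans (ℕ.m+[n∸m]≡n (rank≤ ⊤)) (cong suc (sym
            (exponents i (suc N ∸ rk ⊤) N (trans (cong (pos (t ℕ.^ i) *_) (sym (points-rank q 1<q ⊤))) tally)))))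
            where
            at-zero : ∀ x → (⊤ ⊆ᵇ satSet form true x) ≡ fixed true ξ x
            at-zero x = true⇔⇒≡
              (λ h → Vs.≡⇒== (connected enum (scaledBy true) x (λ l _ → ⊆satSet⁻ {S = ⊤} {form} {true} {x} h (Fin.suc l) (mem-⊤ (Fin.suc l)))))
              (λ h → ⊆satSet {S = ⊤} {form} {true} {x} λ { Fin.zero _ → refl ; (Fin.suc l) _ → equal (fixed⇒≡ true ξ x h) (tr l) (loops l) })
              where
              equal : Colouring.pull enum (scaledBy true) x ξ ≡ x → ∀ e → root ξ (proj₁ e) ≡ root ξ (proj₁ (proj₂ e)) → Colouring.sat enum (scaledBy true) x e ≡ true
              equal p (i , j , a) e = Fr.≡⇒== (trans (at i) (trans (cong (lookup x) e) (sym (at j))))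
                where
                at : ∀ j → lookup x j ≡ lookup x (root ξ j)
                at j = trans (cong (λ y → lookup y j) (sym p)) (Colouring.lookup-pull enum (scaledBy true) x ξ j)
            at-nonzero : ∀ x → (⊤ ⊆ᵇ satSet form false x) ≡ false
            at-nonzero x = refl
            tally : pos (t ℕ.^ i) * points form ⊤ ≡ pos (t ℕ.^ N)
            tally = trans (cong (pos (t ℕ.^ i) *_) (trans (points-∑ form ⊤) (trans (∑-cong (allFin t) (λ z → branch (isZero z)))
                (trans (∑-z s 0ℤ) (trans (cong (s +_) (ℤ.*-zeroʳ (pos (ℕ.pred t)))) (ℤ.+-identityʳ s)))))) (fixed-count true)
              where
              s : ℤ
              s = ∑ xs (λ x → ⟦ fixed true ξ x ⟧)
              branch : ∀ b → ∑ xs (λ x → ⟦ ⊤ ⊆ᵇ satSet form b x ⟧) ≡ (if b then s else 0ℤ)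
              branch true  = ∑-cong xs (λ x → cong ⟦_⟧ (at-zero x))
              branch false = trans (∑-cong xs (λ x → cong ⟦_⟧ (at-nonzero x))) (∑-zero xs)

      -- At least N + 2 copies of G: more than N for the generic colouring and for cancelling M₀,
      -- more than one so that t > 1, and unboundedly many choices.
      palette-size : ℕ → ℕ
      palette-size s = suc (suc N) ℕ.+ s

      1<palette-size : ∀ s → 1 ℕ.< palette-size s
      1<palette-size s = s≤s (s≤s z≤n)

      N<palette-size : ∀ s → N ℕ.< palette-size s
      N<palette-size s = s≤s (ℕ.≤-trans (ℕ.m≤m+n N s) (ℕ.n≤1+n (N ℕ.+ s)))

      palette-size-large : ∀ s → s ℕ.< palette-size s ℕ.* k
      palette-size-large s = ℕ.<-≤-trans (ℕ.m<n+m s {suc (suc N)} (s≤s z≤n))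
        (ℕ.≤-trans (ℕ.≤-reflexive (sym (ℕ.*-identityʳ (palette-size s)))) (ℕ.*-monoʳ-≤ (palette-size s) 0<k))

      -- What does not mention q can be read off from any one palette.
      closure-rank : ∀ {i ξ} → Contracted i ξ → rk (closure ξ) ≡ i
      closure-rank = AtPalette.AtState.rank-closure (palette-size 0) (1<palette-size 0) (N<palette-size 0)

      closure-flat : ∀ {i ξ} → Contracted i ξ → MatroidOps.isFlat ⊤ rk (closure ξ) ≡ true
      closure-flat inv = AtPalette.isFlat-at q 1<q N<q (AtPalette.AtState.ω₀ q 1<q N<q inv) (AtPalette.AtState.sat-ω₀ q 1<q N<q inv)
        where
        q = palette-size 0
        1<q = 1<palette-size 0
        N<q = N<palette-size 0

      closure-degree : ∀ {i ξ} → Contracted i ξ → ∀ d → suc N ℕ.< d → charPolyContr rk (closure ξ) d ≡ 0ℤ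
      closure-degree inv = AtPalette.charPoly-degree q 1<q N<q (AtPalette.AtState.ω₀ q 1<q N<q inv) (AtPalette.AtState.sat-ω₀ q 1<q N<q inv)
        where
        q = palette-size 0
        1<q = 1<palette-size 0
        N<q = N<palette-size 0

      -- Passing from i to i + 1 brings one more t into `charPoly-number`; it is matched by the
      -- factor `size q` recorded in the chain, so exactly `size q - d` is left.
      factor-counts : ∀ q (1<q : 1 ℕ.< q) (N<q : N ℕ.< q) {i ξ ξ′} → Contracted i ξ → Contracted (suc i) ξ′ → ∀ d →
        size q * number q (map (move ξ) E₀) ≡ (size q - pos d) * number q (map (move ξ′) E₀) →
        evalPoly (charPolyContr rk (closure ξ)) (suc N) (size q) ≡ (size q - pos d) * evalPoly (charPolyContr rk (closure ξ′)) (suc N) (size q)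
      factor-counts q 1<q N<q {i} {ξ} {ξ′} inv inv′ d counts =
        ℤ.*-cancelˡ-≡ u _ _ {{AtPalette.powers-≢0 q 1<q N<q (suc N ∸ rk ⊤)}} (ℤ.*-cancelˡ-≡ (t * tⁱ) _ _ {{nonzero}} (begin
          (t * tⁱ) * (u * e) ≡⟨ ℤ.*-assoc t tⁱ (u * e) ⟩
          t * (tⁱ * (u * e)) ≡⟨ cong (t *_) (AtPalette.AtState.charPoly-number q 1<q N<q inv) ⟩
          t * (t₁ * n) ≡⟨ swap t t₁ n ⟩
          t₁ * (t * n) ≡⟨ cong (t₁ *_) counts ⟩
          t₁ * (D * n′) ≡⟨ swap t₁ D n′ ⟩
          D * (t₁ * n′) ≡⟨ cong (D *_) (sym (AtPalette.AtState.charPoly-number q 1<q N<q inv′)) ⟩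
          D * (pos ((q ℕ.* k) ℕ.^ suc i) * (u * e′)) ≡⟨ cong (λ s → D * (s * (u * e′))) (ℤ.pos-* (q ℕ.* k) _) ⟩
          D * ((t * tⁱ) * (u * e′)) ≡⟨ trans (swap D (t * tⁱ) (u * e′)) (cong ((t * tⁱ) *_) (swap D u e′)) ⟩
          (t * tⁱ) * (u * (D * e′)) ∎))
        where
        open ≡-Reasoning
        t = size q
        tⁱ = pos ((q ℕ.* k) ℕ.^ i)
        u = pos ((q ℕ.* k) ℕ.^ (suc N ∸ rk ⊤))
        t₁ = pos (ℕ.pred (q ℕ.* k))
        D = size q - pos d
        n = number q (map (move ξ) E₀)
        n′ = number q (map (move ξ′) E₀)
        e = evalPoly (charPolyContr rk (closure ξ)) (suc N) (size q)
        e′ = evalPoly (charPolyContr rk (closure ξ′)) (suc N) (size q)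
        nonzero : ℤ.NonZero (t * tⁱ)
        nonzero = subst ℤ.NonZero (ℤ.pos-* (q ℕ.* k) _) (AtPalette.powers-≢0 q 1<q N<q (suc i))
        swap : ∀ a b c → a * (b * c) ≡ b * (a * c)
        swap = solve-∀

      closure-divides : ∀ {i ξ ξ′} → Contracted i ξ → Contracted (suc i) ξ′ → ∀ d →
        (∀ q → N ℕ.< q → size q * number q (map (move ξ) E₀) ≡ (size q - pos d) * number q (map (move ξ′) E₀)) →
        PolyDivides (charPolyContr rk (closure ξ′)) (charPolyContr rk (closure ξ))
      closure-divides {ξ = ξ} {ξ′} inv inv′ d counts = values-factor⇒PolyDivides (λ s → palette-size s ℕ.* k) palette-size-large
        (charPolyContr rk (closure ξ)) (charPolyContr rk (closure ξ′)) (pos d) (suc N) (closure-degree inv) (closure-degree inv′)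
        (λ s → factor-counts (palette-size s) (1<palette-size s) (N<palette-size s) inv inv′ d (counts (palette-size s) (N<palette-size s)))

      top-divides : ∀ {i ξ} → Contracted i ξ → PolyDivides (charPolyContr rk ⊤) (charPolyContr rk (closure ξ))
      top-divides {ξ = ξ} inv = one-PolyDivides (charPolyContr rk (closure ξ)) (charPolyContr rk ⊤) (suc N)
        (AtPalette.charPoly-top-0 q 1<q N<q) (AtPalette.charPoly-top-high q 1<q N<q) (closure-degree inv)
        where
        q = palette-size 0
        1<q = 1<palette-size 0
        N<q = N<palette-size 0

      top-flat : MatroidOps.isFlat ⊤ rk ⊤ ≡ true
      top-flat = AtPalette.isFlat-at q 1<q N<q (AtPalette.ω⊤ q 1<q N<q) (AtPalette.sat-ω⊤ q 1<q N<q)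
        where
        q = palette-size 0
        1<q = 1<palette-size 0
        N<q = N<palette-size 0

      chain⇒flag : ∀ {L} → Chain L [] → ∀ {i ξ} → Contracted i ξ → L ≡ map (move ξ) E₀ → Flag rk i (closure ξ)
      chain⇒flag (done (⊑[] , _)) {i} {ξ} inv refl =
        -- All edges are loops now, so {z = 0} implies everything: one more rank reaches the whole
        -- set, whose contraction has χ = 1.
        extend (closure ξ) (closure-rank inv) (closure-flat inv) (⊆ᵇ-intro (closure ξ) ⊤ (λ i _ → mem-⊤ i)) (top-divides inv)
          (top (AtPalette.AtState.rank-top (palette-size 0) (1<palette-size 0) (N<palette-size 0) inv loops) top-flat)
        where
        loops : ∀ l → root ξ (proj₁ (tr l)) ≡ root ξ (proj₁ (proj₂ (tr l)))
        loops l with ⊑[] (Mem.∈-map⁺ (move ξ) (Mem.∈-tabulate⁺ {f = tr} l))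
        ... | inj₁ e = e
        ... | inj₂ (inj₁ ())
        ... | inj₂ (inj₂ ())
      chain⇒flag (step w v a d w≢v wv∈ counts rest) {i} {ξ} inv refl =
        extend (closure ξ) (closure-rank inv) (closure-flat inv) (flat-mono ξ ξ′ (Step.trivial-mono inv w≢v wv∈))
          (closure-divides inv inv′ d (λ q N<q → trans (counts q N<q) (cong (λ M → (size q - pos d) * number q M) L′≡)))
          (chain⇒flag rest inv′ L′≡)
        where
        ξ′ : Relabelling N N
        ξ′ = contract w v a ⊙ ξ
        inv′ : Contracted (suc i) ξ′
        inv′ = Step.contracted′ inv w≢v wv∈
        L′≡ : map (move (contract w v a)) (map (move ξ) E₀) ≡ map (move ξ′) E₀
        L′≡ = trans (sym (List.map-∘ E₀)) (List.map-cong (move-⊙ (contract w v a) ξ) E₀)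

  -- Divisional freeness of the arrangement

  module _ {N : ℕ} (g : Triple N → Fin (suc N) → K.Carrier) where

    -- Indexing by positions in the mapped list keeps the ground set of the matroid literally that
    -- of the definition.
    nth : (es : List (Triple N)) → Fin (length (map g es)) → Triple N
    nth (e ∷ es) Fin.zero    = e
    nth (e ∷ es) (Fin.suc l) = nth es l

    tabulate-nth : ∀ es → List.tabulate (nth es) ≡ es
    tabulate-nth []       = refl
    tabulate-nth (e ∷ es) = cong (e ∷_) (tabulate-nth es)

    lookup-nth : ∀ es l → List.lookup (map g es) l ≡ g (nth es l)
    lookup-nth (e ∷ es) Fin.zero    = refl
    lookup-nth (e ∷ es) (Fin.suc l) = lookup-nth es l

    from-list : (es : List (Triple N)) → (∀ e j → g e j K.≈ lin (edge e) j) → (∀ {e} → e ∈ es → proj₁ e ≢ proj₁ (proj₂ e)) →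
                Chain es [] → DivisionallyFree K (formZ ∷ map g es)
    from-list es g-lin nonloop chain dec = toDivisionalFlag ρ (subst (Flag ρ 0) closure-id flag)
      where
      open Family (nth es)
      forms-lin : ∀ i j → List.lookup (formZ ∷ map g es) i j K.≈ lin (form i) j
      forms-lin Fin.zero    Fin.zero    = K.refl
      forms-lin Fin.zero    (Fin.suc _) = K.refl
      forms-lin (Fin.suc l) j           = K.trans (K.reflexive (cong (λ h → h j) (lookup-nth es l))) (g-lin (nth es l) j)
      ind : Subset (suc (length (map g es))) → Bool
      ind S = does (dec S)
      ind⇒ : ∀ S → ind S ≡ true → Independent (lin ∘ form) S
      ind⇒ S h = LinIndep⇒Independent {f = lin ∘ form} {S = S} forms-lin (does-true (dec S) h)
      ind⇐ : ∀ S → Independent (lin ∘ form) S → ind S ≡ true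
      ind⇐ S i = dec-true (dec S) (Independent⇒LinIndep {f = lin ∘ form} {S = S} forms-lin i)
      ρ : Subset (suc (length (map g es))) → ℕ
      ρ = rankOf ind
      flag : Flag ρ 0 (closure idᵣ)
      flag = Ranked.chain⇒flag ρ (PalettePoints.Rank.rank≤ 2 (s≤s (s≤s z≤n)) form ind ind⇒ ind⇐)
        (λ q 1<q → PalettePoints.Rank.points-rank q 1<q form ind ind⇒ ind⇐) chain contracted-id
        (trans (sym (tabulate-nth es)) (trans (sym (List.map-id E₀)) (sym (List.map-cong move-id E₀))))
      -- No edge is a loop at the start, so no equation is trivial yet and the flag begins at the
      -- empty flat.
      closure-id : closure idᵣ ≡ ⊥
      closure-id = subset-ext {X = closure idᵣ} {⊥} each
        where
        apart : ∀ e → proj₁ e ≢ proj₁ (proj₂ e) → trivial (move idᵣ e) ≡ false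
        apart (i , j , a) i≢j = cong (_∧ does (((a ⊕ ε) ⊕ (⊖ ε)) Fin.≟ ε)) (dec-false (i Fin.≟ j) i≢j)
        each : ∀ i → mem i (closure idᵣ) ≡ mem i ⊥
        each Fin.zero    = refl
        each (Fin.suc l) = trans (mem-closure idᵣ l) (trans (apart (nth es l)
          (nonloop (subst (nth es l ∈_) (tabulate-nth es) (Mem.∈-tabulate⁺ l)))) (sym (mem-⊥ l)))

  module _ {N : ℕ} (Γ : GainGraph N k) (inC : InC Γ) where

    wf : WF Γ
    wf = InC⇒WF inC

    ∈-edgeList : ∀ {i j a} → toℕ i ℕ.< toℕ j → E Γ i j a ≡ true → (i , j , a) ∈ edgeList Γ
    ∈-edgeList {i} {j} {a} i<j h = Mem.∈-concatMap⁺ _ (lose (Mem.∈-allFin i) (Mem.∈-concatMap⁺ _ (lose (Mem.∈-allFin j)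
      (Mem.∈-concatMap⁺ _ (lose (Mem.∈-allFin a) (subst (λ b → (i , j , a) ∈ (if b then (i , j , a) ∷ [] else [])) (sym (∧-intro (<⇒<ᵇ-true i<j) h)) (here refl)))))))

    ∈-edgeList⁻ : ∀ {e} → e ∈ edgeList Γ → isEdge Γ e ≡ true
    ∈-edgeList⁻ e∈ with find (Mem.∈-concatMap⁻ _ {xs = allFin N} e∈)
    ... | i , _ , e∈₁ with find (Mem.∈-concatMap⁻ _ {xs = allFin N} e∈₁)
    ...   | j , _ , e∈₂ with find (Mem.∈-concatMap⁻ _ {xs = allFin k} e∈₂)
    ...     | a , _ , e∈₃ = pick ((toℕ i <ᵇ toℕ j) ∧ E Γ i j a) refl e∈₃
      where
      pick : ∀ {e} b → (toℕ i <ᵇ toℕ j) ∧ E Γ i j a ≡ b → e ∈ (if b then (i , j , a) ∷ [] else []) → isEdge Γ e ≡ true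
      pick true h (here refl) = proj₂ (∧-true {toℕ i <ᵇ toℕ j} h)

    -- One list holds an orientation i < j per edge class, the other both; the symmetry of Γ relates
    -- them.
    edgeList≋edges : edgeList Γ ≋ edges Γ
    edgeList≋edges = (λ e∈ → inj₂ (inj₁ (∈-edges Γ (∈-edgeList⁻ e∈)))) , oriented
      where
      oriented : edges Γ ⊑ edgeList Γ
      oriented {i , j , a} e∈ with h ← ∈-edges⁻ Γ e∈ with ℕ.<-cmp (toℕ i) (toℕ j)
      ... | tri< i<j _ _ = inj₂ (inj₁ (∈-edgeList i<j h))
      ... | tri≈ _ i≡j _ = inj₁ (Fin.toℕ-injective i≡j)
      ... | tri> _ _ j<i = inj₂ (inj₂ (∈-edgeList j<i (E-sym wf h)))

    divisionallyFree : DivisionallyFree K (arrForms Γ)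
    divisionallyFree = from-list _ (edgeList Γ) (λ _ _ → K.refl)
        (λ { {i , j , a} e∈ → proj₂ (proj₂ (WF.endpoints wf i j a (∈-edgeList⁻ e∈))) }) (respects edgeList≋edges (inC-chain inC))

theorem4p22 : ∀ {c ℓ} (K : CommutativeRing c ℓ) → IsField K →
    ∀ {k : ℕ} (G : FinSubgroup K k) (N : ℕ) (Γ : GainGraph N k) →
    GainGraphs.InC K G Γ → V Γ ≡ ⊤ →
    DivisionallyFree K (GainGraphs.arrForms K G Γ)
theorem4p22 K isField G N Γ inC _ = Arrangement.divisionallyFree K isField G Γ inC
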